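{- $\mathbf{PQSym}^{(\ell)}$, with its product and with the coproduct $\Delta$ defined by $\Delta f(\boldsymbol{A})=f(\boldsymbol{A}'\oplus\boldsymbol{A}'')$, is a graded connected bialgebra, hence a Hopf algebra. More precisely, the coproduct can be computed in the following way: $$\Delta\mathbf{G}_{(\mathbf{a},u)}=\sum_{\substack{(\mathbf{a}',\mathbf{a}'',u',u'')\\ (\mathbf{a},u)\in(\mathbf{a}',u')\Cup(\mathbf{a}'',u'')}}\mathbf{G}_{(\mathbf{a}',u')}\otimes\mathbf{G}_{(\mathbf{a}'',u'')}.$$
   Context: A parking function of length $n$ is a word $\mathbf{a}=a_1\cdots a_n$ on $\{1,\ldots,n\}$ whose nondecreasing rearrangement $a_1'\cdots a_n'$ satisfies $a_i'\le i$ for all $i$. A colored parking function of level $\ell$ and size $n$ is a pair $(\mathbf{a},u)$ of a parking function $\mathbf{a}$ of length $n$ and a word $u$ of length $n$ over a set $C$ of $\ell$ colors. Parkization: for a word $w=w_1\cdots w_n$ of positive integers let $d(w)=\min\{i:\#\{j:w_j\le i\}<i\}$. If $d(w)=n+1$, then $w$ is a parking function and $\mathrm{Park}(w)=w$. Otherwise let $w'$ be obtained from $w$ by decreasing by $1$ all the letters greater than $d(w)$, and set $\mathrm{Park}(w)=\mathrm{Park}(w')$. The colored parkization of a colored word $(w,u)$ is $(\mathrm{Park}(w),u)$. $\mathbf{PQSym}^{(\ell)}$ is the algebra with linear basis $\mathbf{G}_{(\mathbf{a},u)}$ indexed by all colored parking functions of level $\ell$ (including the empty one), graded by size, with product $$\mathbf{G}_{(\mathbf{a}',u')}\mathbf{G}_{(\mathbf{a}'',u'')}=\sum_{\mathbf{a}\in\mathbf{a}'*\mathbf{a}''}\mathbf{G}_{(\mathbf{a},u'\cdot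 u'')}.$$ Here $u'\cdot u''$ is the concatenation of color words, and the convolution $\mathbf{a}'*\mathbf{a}''$ is the set of all parking functions $\mathbf{a}=v\cdot w$ (concatenation) with $\mathrm{Park}(v)=\mathbf{a}'$ and $\mathrm{Park}(w)=\mathbf{a}''$. It is realized on the colored alphabet $\boldsymbol{A}=A\times C$, with $A=\{1,2,\ldots\}$ totally ordered, $\mathbf{G}_{(\mathbf{a},u)}=\mathbf{G}_{(\mathbf{a},u)}(\boldsymbol{A})$ being the sum of all colored words over $\boldsymbol{A}$ whose colored parkization is $(\mathbf{a},u)$. Coproduct: only the total order on $A$ is used to define the colored parkization. Taking two isomorphic copies $A'$ and $A''$ of $A$, set $\boldsymbol{A}'=A'\times C$, $\boldsymbol{A}''=A''\times C$ and $\boldsymbol{A}'\oplus\boldsymbol{A}''=(A'\oplus A'')\times C$, where $A'\oplus A''$ is the ordered sum. Assuming that $\boldsymbol{A}'$ and $\boldsymbol{A}''$ commute, $f(\boldsymbol{A}')g(\boldsymbol{A}'')$ is identified with $f\otimes g$, and $\Delta f(\boldsymbol{A})=f(\boldsymbol{A}'\oplus\boldsymbol{A}'')$. The shifted shuffle $(\mathbf{a}',u')\Cup(\mathbf{a}'',u'')$ is the shuffle of the words of biletters $(\mathbf{a}',u')$ and $(\mathbf{a}''[k],u'')$, where $k$ is the length of $\mathbf{a}'$ and $\mathbf{a}''[k]$ is $\mathbf{a}''$ with $k$ added to each letter (colors follow their letters). -}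

module Defs where

open import Algebra.Bundles using (CommutativeRing)
open import Algebra.Core using (Op₁; Op₂)
open import Algebra.Module.Bundles using (Module)
import Algebra.Module.Construct.TensorUnit as TensorUnit
open import Algebra.Module.Morphism.Structures using (IsModuleHomomorphism)
open import Algebra.Module.Structures using (IsLeftModule)
open import Algebra.Module.Structures.Biased using (IsModuleFromLeft)
import Algebra.Properties.Ring as RingProperties
open import Algebra.Structures using (IsRing)
open import Data.Bool.Base using (if_then_else_; true; false)
open import Data.Empty using (⊥-elim)
open import Data.Fin.Base using (Fin; toℕ)
import Data.Fin.Properties as Fin
open import Data.Irrelevant using ([_])
open import Data.List.Base using (List; []; _∷_; _++_; allFin; cartesianProduct; cartesianProductWith; concatMap; drop; filter; foldr; length; lookup; map; mapMaybe; take; upTo; zip)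
open import Data.List.Properties using (length-filter; filter-accept; filter-reject)
import Data.List.Properties as List
open import Data.List.Membership.Propositional using (_∈_)
import Data.List.Membership.DecPropositional as DecMembership
import Data.List.Relation.Binary.Subset.Setoid as Subset
open import Data.List.Relation.Unary.All using (All; []; all?)
import Data.List.Relation.Unary.Unique.Setoid as Unique
import Data.List.Sort.InsertionSort.Base as InsertionSort
import Data.Maybe.Base as Maybe
open import Data.Nat.ListAction using (sum)
open import Data.Nat.Base using (ℕ; zero; suc; pred; NonZero; _≤_; _<_)
open import Data.Nat.Properties using (≤-decTotalOrder; _≤?_; _<?_)
import Data.Nat.Base as ℕ
import Data.Nat.Properties as ℕ
open import Data.Product.Base using (Σ-syntax; ∃; _×_; _,_; proj₁; proj₂)
import Data.Product.Properties as Product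
open import Data.Refinement.Base using (Refinement-syntax; value; _,_)
import Data.Refinement.Properties as Refinement
open import Data.Sum.Base using (_⊎_; inj₁; inj₂)
open import Data.Sum.Relation.Binary.LeftOrder using (⊎-<-decTotalOrder)
open import Function.Base using (id)
open import Level using (0ℓ; _⊔_)
open import Relation.Binary.Bundles using (DecTotalOrder)
import Relation.Binary.Construct.On as On
open import Relation.Binary.Definitions using (DecidableEquality)
open import Relation.Binary.PropositionalEquality.Core using (_≡_; _≢_; refl; sym; trans; cong; subst)
open import Relation.Nullary.Decidable.Core using (Dec; yes; no; does; _×-dec_; dec⇒maybe)
open import Relation.Nullary.Negation.Core using (¬_)

sort : List ℕ → List ℕ
sort = InsertionSort.sort ≤-decTotalOrder

IsParking : List ℕ → Set
IsParking a = All (λ x → 1 ≤ x × x ≤ length a) a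
            × (∀ i → lookup (sort a) i ≤ suc (toℕ i))

isParking? : ∀ a → Dec (IsParking a)
isParking? a = all? (λ x → (1 ≤? x) ×-dec (x ≤? length a)) a
         ×-dec Fin.all? (λ i → lookup (sort a) i ≤? suc (toℕ i))

count≤ : ℕ → List ℕ → ℕ
count≤ i w = length (filter (_≤? i) w)

-- The least j among i, …, i+k−1 with count≤ j w < j, and i+k if there is none.
searchFrom : List ℕ → ℕ → ℕ → ℕ
searchFrom w zero    i = i
searchFrom w (suc k) i with count≤ i w <? i
... | yes _ = i
... | no  _ = searchFrom w k (suc i)

-- The search may stop at 1 + length w, which always has the required property.
d : List ℕ → ℕ
d w = searchFrom w (length w) 1

lower : ℕ → List ℕ → List ℕ
lower k = map lowerLetter
  where
  lowerLetter : ℕ → ℕ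
  lowerLetter x with k <? x
  ... | yes _ = pred x
  ... | no  _ = x

-- Each non-final step lowers the sum of the letters (lower-sum below), so the sum is
-- enough fuel; park-done and park-step are the recursive equations of parkization.
parkWithin : ℕ → List ℕ → List ℕ
parkWithin zero       w = w
parkWithin (suc fuel) w with d w ℕ.≟ suc (length w)
... | yes _ = w
... | no  _ = parkWithin fuel (lower (d w) w)

park : List ℕ → List ℕ
park w = parkWithin (sum w) w

searchFrom-< : ∀ w k i → length w < i ℕ.+ k →
               count≤ (searchFrom w k i) w < searchFrom w k i
searchFrom-< w zero    i n<i = ℕ.≤-<-trans (length-filter (_≤? i) w)
                                 (subst (length w <_) (ℕ.+-identityʳ i) n<i)
searchFrom-< w (suc k) i n<i with count≤ i w <? i
... | yes p = p
... | no  _ = searchFrom-< w k (suc i) (subst (length w <_) (ℕ.+-suc i k) n<i)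

searchFrom-≤ : ∀ w k i → searchFrom w k i ≤ i ℕ.+ k
searchFrom-≤ w zero    i = ℕ.m≤m+n i 0
searchFrom-≤ w (suc k) i with count≤ i w <? i
... | yes _ = ℕ.m≤m+n i (suc k)
... | no  _ = subst (searchFrom w k (suc i) ≤_) (sym (ℕ.+-suc i k)) (searchFrom-≤ w k (suc i))

searchFrom-minimal : ∀ w k i j → i ≤ j → j < searchFrom w k i → ¬ (count≤ j w < j)
searchFrom-minimal w zero    i j i≤j j<i = ⊥-elim (ℕ.<⇒≱ j<i i≤j)
searchFrom-minimal w (suc k) i j i≤j j<s with count≤ i w <? i
... | yes _ = ⊥-elim (ℕ.<⇒≱ j<s i≤j)
... | no ¬p with ℕ.m≤n⇒m<n∨m≡n i≤j
...   | inj₁ i<j  = searchFrom-minimal w k (suc i) j i<j j<s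
...   | inj₂ refl = ¬p

d-< : ∀ w → count≤ (d w) w < d w
d-< w = searchFrom-< w (length w) 1 (ℕ.n<1+n (length w))

d-minimal : ∀ w j → 1 ≤ j → j < d w → ¬ (count≤ j w < j)
d-minimal w = searchFrom-minimal w (length w) 1

lower-sum : ∀ k w → sum (lower k w) ℕ.+ length w ≡ sum w ℕ.+ count≤ k w
lower-sum k []      = refl
lower-sum k (x ∷ w) with k <? x
lower-sum k (suc x ∷ w) | yes k<x
  rewrite filter-reject (_≤? k) {xs = w} (ℕ.<⇒≱ k<x)
        | ℕ.+-suc (x ℕ.+ sum (lower k w)) (length w)
        | ℕ.+-assoc x (sum (lower k w)) (length w)
        | ℕ.+-assoc x (sum w) (count≤ k w)
        = cong (λ s → suc (x ℕ.+ s)) (lower-sum k w)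
lower-sum k (x ∷ w) | no k≮x
  rewrite filter-accept (_≤? k) {xs = w} (ℕ.≮⇒≥ k≮x)
        | ℕ.+-suc (x ℕ.+ sum (lower k w)) (length w)
        | ℕ.+-suc (x ℕ.+ sum w) (count≤ k w)
        | ℕ.+-assoc x (sum (lower k w)) (length w)
        | ℕ.+-assoc x (sum w) (count≤ k w)
        = cong (λ s → suc (x ℕ.+ s)) (lower-sum k w)

lower-< : ∀ w → d w ≢ suc (length w) → sum (lower (d w) w) < sum w
lower-< w d≢ = ℕ.+-cancelʳ-< (length w) _ _
  (subst (_< sum w ℕ.+ length w) (sym (lower-sum (d w) w)) (ℕ.+-monoʳ-< (sum w) count<n))
  where
  count<n : count≤ (d w) w < length w
  count<n = ℕ.<-≤-trans (d-< w)
              (ℕ.s≤s⁻¹ (ℕ.≤∧≢⇒< (searchFrom-≤ w (length w) 1) d≢))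

parkWithin-stable : ∀ f g w → sum w ≤ f → sum w ≤ g → parkWithin f w ≡ parkWithin g w
parkWithin-stable zero    zero    w p q = refl
parkWithin-stable zero    (suc g) w p q with d w ℕ.≟ suc (length w)
... | yes _ = refl
... | no d≢ = ⊥-elim (ℕ.n≮0 (ℕ.<-≤-trans (lower-< w d≢) p))
parkWithin-stable (suc f) zero    w p q with d w ℕ.≟ suc (length w)
... | yes _ = refl
... | no d≢ = ⊥-elim (ℕ.n≮0 (ℕ.<-≤-trans (lower-< w d≢) q))
parkWithin-stable (suc f) (suc g) w p q with d w ℕ.≟ suc (length w)
... | yes _ = refl
... | no d≢ = parkWithin-stable f g (lower (d w) w)
                (ℕ.s≤s⁻¹ (ℕ.<-≤-trans (lower-< w d≢) p))
                (ℕ.s≤s⁻¹ (ℕ.<-≤-trans (lower-< w d≢) q))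

parkWithin-done : ∀ f w → d w ≡ suc (length w) → parkWithin f w ≡ w
parkWithin-done zero    w d≡ = refl
parkWithin-done (suc f) w d≡ with d w ℕ.≟ suc (length w)
... | yes _ = refl
... | no d≢ = ⊥-elim (d≢ d≡)

park-done : ∀ w → d w ≡ suc (length w) → park w ≡ w
park-done w = parkWithin-done (sum w) w

park-step : ∀ w → d w ≢ suc (length w) → park w ≡ park (lower (d w) w)
park-step w d≢ = trans (parkWithin-stable (sum w) (suc (sum w)) w ℕ.≤-refl (ℕ.n≤1+n _)) step
  where
  step : parkWithin (suc (sum w)) w ≡ park (lower (d w) w)
  step with d w ℕ.≟ suc (length w)
  ... | yes d≡ = ⊥-elim (d≢ d≡)
  ... | no  _  = parkWithin-stable (sum w) _ _ (ℕ.<⇒≤ (lower-< w d≢)) ℕ.≤-refl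

-- Colored words: a pair (w , u) of words of equal length is encoded as the word of its
-- biletters, so that a colored word over X × C is literally a word over X × C.

module Colored (ℓ : ℕ) where

  Color : Set
  Color = Fin ℓ

  Biword : Set
  Biword = List (ℕ × Color)

  _≟ᵇ_ : DecidableEquality Biword
  _≟ᵇ_ = List.≡-dec (Product.≡-dec ℕ._≟_ Fin._≟_)

  ColoredPF : Set
  ColoredPF = [ w ∈ Biword ∣ IsParking (map proj₁ w) ]

  _≟_ : DecidableEquality ColoredPF
  _≟_ = Refinement._≟_ _≟ᵇ_

  word : ColoredPF → List ℕ
  word a = map proj₁ (value a)

  colors : ColoredPF → List Color
  colors a = map proj₂ (value a)

  size : ColoredPF → ℕ
  size a = length (value a)

  ∅ : ColoredPF
  ∅ = [] , [ ([] , λ ()) ]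

  wordsOfLength : ∀ {a} {X : Set a} → ℕ → List X → List (List X)
  wordsOfLength zero    xs = [] ∷ []
  wordsOfLength (suc n) xs = cartesianProductWith _∷_ xs (wordsOfLength n xs)

  toColoredPF : Biword → Maybe.Maybe ColoredPF
  toColoredPF w = Maybe.map (λ p → w , [ p ]) (dec⇒maybe (isParking? (map proj₁ w)))

  coloredPFs : ℕ → List ColoredPF
  coloredPFs n = mapMaybe toColoredPF
    (wordsOfLength n (cartesianProduct (map suc (upTo n)) (allFin ℓ)))

  -- c = (v · w , u′ · u″) with v · w in the convolution; since park preserves length,
  -- v consists of the first size a letters of c.
  _∈_*_ : ColoredPF → ColoredPF → ColoredPF → Set
  c ∈ a * b = park (take (size a) (word c)) ≡ word a
            × park (drop (size a) (word c)) ≡ word b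
            × colors c ≡ colors a ++ colors b

  _∈?_*_ : ∀ c a b → Dec (c ∈ a * b)
  c ∈? a * b = List.≡-dec ℕ._≟_ _ _
         ×-dec List.≡-dec ℕ._≟_ _ _
         ×-dec List.≡-dec Fin._≟_ _ _

  shuffles : ∀ {a} {X : Set a} → List X → List X → List (List X)
  shuffles []       ys       = ys ∷ []
  shuffles (x ∷ xs) []       = (x ∷ xs) ∷ []
  shuffles (x ∷ xs) (y ∷ ys) =
    map (x ∷_) (shuffles xs (y ∷ ys)) ++ map (y ∷_) (shuffles (x ∷ xs) ys)

  _⋓_ : ColoredPF → ColoredPF → List Biword
  a ⋓ b = shuffles (value a) (map (λ (x , u) → size a ℕ.+ x , u) (value b))

  -- The (a , b) with c in their shifted shuffle; these have size a + size b = size c.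
  unshuffles : ColoredPF → List (ColoredPF × ColoredPF)
  unshuffles c = filter (λ (a , b) → value c ∈? a ⋓ b) (cartesianProduct candidates candidates)
    where
    open DecMembership _≟ᵇ_ using (_∈?_)
    candidates = concatMap coloredPFs (upTo (suc (size c)))

𝔸 : DecTotalOrder 0ℓ 0ℓ 0ℓ
𝔸 = On.decTotalOrder {B = [ n ∈ ℕ ∣ NonZero n ]} ≤-decTotalOrder value

Letters : DecTotalOrder 0ℓ 0ℓ 0ℓ → Set
Letters = DecTotalOrder.Carrier

_⊕_ : (X Y : DecTotalOrder 0ℓ 0ℓ 0ℓ) → DecTotalOrder 0ℓ 0ℓ 0ℓ
_⊕_ = ⊎-<-decTotalOrder

park𝔸 : List (Letters 𝔸) → List ℕ
park𝔸 w = park (map value w)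

-- Parkization over a totally ordered alphabet X depends on the order of X only.  A finite
-- subset F of X containing the letters of w is isomorphic, as an ordered set, to some
-- {1, …, m}, by x ↦ rank F x; the parkization of w over X is the common value of the
-- parkizations of the images of w for all sufficiently large F.  For X = 𝔸 and
-- F ⊇ {1, …, max w} the image of w is w itself, so this is the original parkization.
-- For X = 𝔸 ⊕ 𝔸, of order type ω + ω, no single F carries all the words.
module _ (X : DecTotalOrder 0ℓ 0ℓ 0ℓ) where
  open DecTotalOrder X using (Carrier; module Eq) renaming (_≤?_ to _≤X?_)
  open Subset Eq.setoid using (_⊆_)
  open Unique Eq.setoid using (Unique)

  rank : List Carrier → Carrier → ℕ
  rank F x = length (filter (_≤X? x) F)

  IsParkization : List Carrier → List ℕ → Set
  IsParkization w a = Σ[ F₀ ∈ List Carrier ]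
    (∀ F → Unique F → F₀ ⊆ F → park (map (rank F) w) ≡ a)

record GradedBasis : Set₁ where
  no-eta-equality
  field
    Index  : Set
    _≟_    : DecidableEquality Index
    degree : Index → ℕ

open GradedBasis using (Index; degree)

_⊗ᵇ_ : GradedBasis → GradedBasis → GradedBasis
(B ⊗ᵇ B′) .GradedBasis.Index           = Index B × Index B′
(B ⊗ᵇ B′) .GradedBasis._≟_             = Product.≡-dec (GradedBasis._≟_ B) (GradedBasis._≟_ B′)
(B ⊗ᵇ B′) .GradedBasis.degree (b , b′) = degree B b ℕ.+ degree B′ b′

module FreeModule {c r} (R : CommutativeRing c r) where
  open CommutativeRing R renaming (Carrier to Scalar)
  private module R = CommutativeRing R

  infix  4 _≈ᴹ_
  infixl 6 _+ᴹ_
  infixr 7 _*ₗ_ _⊗_ _⊗ᶠ_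

  -- Finite formal linear combinations; a basis element may occur several times.
  record Free (B : GradedBasis) : Set c where
    constructor ⟦_⟧
    field
      terms : List (Scalar × Index B)
  open Free public

  coefficient : ∀ {B} → Free B → Index B → Scalar
  coefficient {B} x b =
    foldr (λ (s , b′) t → (if does (b′ ≟ b) then s else 0#) + t) 0# (terms x)
    where open GradedBasis B using (_≟_)

  record _≈ᴹ_ {B} (x y : Free B) : Set r where
    constructor pointwise
    field
      at : ∀ b → coefficient x b ≈ coefficient y b
  open _≈ᴹ_ public

  0ᴹ : ∀ {B} → Free B
  0ᴹ = ⟦ [] ⟧

  _+ᴹ_ : ∀ {B} → Op₂ (Free B)
  x +ᴹ y = ⟦ terms x ++ terms y ⟧

  _*ₗ_ : ∀ {B} → Scalar → Free B → Free B
  s *ₗ x = ⟦ map (λ (t , b) → s * t , b) (terms x) ⟧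

  -ᴹ_ : ∀ {B} → Op₁ (Free B)
  -ᴹ x = (- 1#) *ₗ x

  module _ {B : GradedBasis} where
    open GradedBasis B using (_≟_)

    coefficient-+ : ∀ (x y : Free B) b → coefficient (x +ᴹ y) b ≈ coefficient x b + coefficient y b
    coefficient-+ ⟦ []           ⟧ y b = R.sym (+-identityˡ _)
    coefficient-+ ⟦ (s , b′) ∷ x ⟧ y b =
      R.trans (+-congˡ (coefficient-+ ⟦ x ⟧ y b)) (R.sym (+-assoc _ _ _))

    coefficient-*ₗ : ∀ s (x : Free B) b → coefficient (s *ₗ x) b ≈ s * coefficient x b
    coefficient-*ₗ s ⟦ []           ⟧ b = R.sym (zeroʳ s)
    coefficient-*ₗ s ⟦ (t , b′) ∷ x ⟧ b =
      R.trans (+-cong (if-* (does (b′ ≟ b))) (coefficient-*ₗ s ⟦ x ⟧ b)) (R.sym (distribˡ s _ _))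
      where
      if-* : ∀ β → (if β then s * t else 0#) ≈ s * (if β then t else 0#)
      if-* true  = R.refl
      if-* false = R.sym (zeroʳ s)

    private
      via-+ : ∀ (x y x′ y′ : Free B) →
              (∀ b → coefficient x b + coefficient y b ≈ coefficient x′ b + coefficient y′ b) →
              x +ᴹ y ≈ᴹ x′ +ᴹ y′
      via-+ x y x′ y′ h = pointwise λ b →
        R.trans (coefficient-+ x y b) (R.trans (h b) (R.sym (coefficient-+ x′ y′ b)))

    isLeftModule : IsLeftModule ring (_≈ᴹ_ {B}) _+ᴹ_ 0ᴹ -ᴹ_ _*ₗ_
    isLeftModule = record
      { isLeftSemimodule = record
        { +ᴹ-isCommutativeMonoid = record
          { isMonoid = record
            { isSemigroup = record
              { isMagma = record
                { isEquivalence = record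
                  { refl  = pointwise (λ b → R.refl)
                  ; sym   = λ p → pointwise (λ b → R.sym (at p b))
                  ; trans = λ p q → pointwise (λ b → R.trans (at p b) (at q b))
                  }
                ; ∙-cong = λ {x} {y} {u} {v} p q → via-+ x u y v (λ b → +-cong (at p b) (at q b))
                }
              ; assoc = λ x y z → pointwise (λ b → reflexive
                  (cong (λ t → coefficient {B} ⟦ t ⟧ b) (List.++-assoc (terms x) (terms y) (terms z))))
              }
            ; identity = (λ x → pointwise (λ b → R.refl))
                       , (λ x → pointwise (λ b → reflexive
                           (cong (λ t → coefficient {B} ⟦ t ⟧ b) (List.++-identityʳ (terms x)))))
            }
          ; comm = λ x y → via-+ x y y x (λ b → +-comm _ _)
          }
        ; isPreleftSemimodule = record
          { *ₗ-cong = λ {s} {t} {x} {y} s≈t x≈y → pointwise (λ b →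
              R.trans (coefficient-*ₗ s x b)
                (R.trans (*-cong s≈t (at x≈y b)) (R.sym (coefficient-*ₗ t y b))))
          ; *ₗ-zeroˡ = λ x → pointwise (λ b →
              R.trans (coefficient-*ₗ 0# x b) (zeroˡ _))
          ; *ₗ-distribʳ = λ x s t → pointwise (λ b →
              R.trans (coefficient-*ₗ (s + t) x b) (R.trans (distribʳ _ s t)
                (R.sym (R.trans (coefficient-+ (s *ₗ x) (t *ₗ x) b)
                  (+-cong (coefficient-*ₗ s x b) (coefficient-*ₗ t x b))))))
          ; *ₗ-identityˡ = λ x → pointwise (λ b →
              R.trans (coefficient-*ₗ 1# x b) (*-identityˡ _))
          ; *ₗ-assoc = λ s t x → pointwise (λ b →
              R.trans (coefficient-*ₗ (s * t) x b) (R.trans (*-assoc s t _)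
                (R.sym (R.trans (coefficient-*ₗ s (t *ₗ x) b) (*-congˡ (coefficient-*ₗ t x b))))))
          ; *ₗ-zeroʳ = λ s → pointwise (λ b → R.refl)
          ; *ₗ-distribˡ = λ s x y → pointwise (λ b → reflexive
              (cong (λ t → coefficient {B} ⟦ t ⟧ b) (List.map-++ _ (terms x) (terms y))))
          }
        }
      ; -ᴹ‿cong = λ {x} {y} x≈y → pointwise (λ b →
          R.trans (coefficient-neg x b)
            (R.trans (-‿cong (at x≈y b)) (R.sym (coefficient-neg y b))))
      ; -ᴹ‿inverse =
          (λ x → pointwise (λ b → R.trans (coefficient-+ (-ᴹ x) x b)
            (R.trans (+-congʳ (coefficient-neg x b)) (-‿inverseˡ _))))
        , (λ x → pointwise (λ b → R.trans (coefficient-+ x (-ᴹ x) b)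
            (R.trans (+-congˡ (coefficient-neg x b)) (-‿inverseʳ _))))
      }
      where
      coefficient-neg : ∀ (x : Free B) b → coefficient (-ᴹ x) b ≈ - coefficient x b
      coefficient-neg x b = R.trans (coefficient-*ₗ (- 1#) x b) (RingProperties.-1*x≈-x ring _)

  free : GradedBasis → Module R c r
  free B = record
    { isModule = IsModuleFromLeft.isModule {commutativeRing = R}
        (record { isLeftModule = isLeftModule {B} }) }

  scalars : Module R c r
  scalars = TensorUnit.⟨module⟩

  IsLinear : (M N : Module R c r) → (Module.Carrierᴹ M → Module.Carrierᴹ N) → Set (c ⊔ r)
  IsLinear M N = IsModuleHomomorphism (Module.rawModule M) (Module.rawModule N)

  ⟨_⟩ : ∀ {B} → Index B → Free B
  ⟨ b ⟩ = ⟦ (1# , b) ∷ [] ⟧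

  ∑⟨_⟩ : ∀ {B} → List (Index B) → Free B
  ∑⟨ bs ⟩ = ⟦ map (1# ,_) bs ⟧

  extend : ∀ {B B′} → (Index B → Free B′) → Free B → Free B′
  extend f x = foldr (λ (s , b) y → (s *ₗ f b) +ᴹ y) 0ᴹ (terms x)

  extend₂ : ∀ {B B′ B″} → (Index B → Index B′ → Free B″) → Free B → Free B′ → Free B″
  extend₂ f x y = extend (λ b → extend (f b) y) x

  -- The tensor product of the free modules on B and B′ is Free (B ⊗ᵇ B′).
  _⊗_ : ∀ {B B′} → Free B → Free B′ → Free (B ⊗ᵇ B′)
  _⊗_ = extend₂ (λ b b′ → ⟨ b , b′ ⟩)

  -- The tensor product of two linear maps, given by its values on the basis.
  _⊗ᶠ_ : ∀ {B B′ C C′} → (Free B → Free C) → (Free B′ → Free C′) →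
         Free (B ⊗ᵇ B′) → Free (C ⊗ᵇ C′)
  f ⊗ᶠ g = extend (λ (b , b′) → f ⟨ b ⟩ ⊗ g ⟨ b′ ⟩)

  associator : ∀ {B B′ B″} → Free ((B ⊗ᵇ B′) ⊗ᵇ B″) → Free (B ⊗ᵇ (B′ ⊗ᵇ B″))
  associator = extend (λ ((b , b′) , b″) → ⟨ b , (b′ , b″) ⟩)

  Homogeneous : ∀ {B} → ℕ → Free B → Set r
  Homogeneous {B} n x = ∀ b → degree B b ≢ n → coefficient x b ≈ 0#

  module _ (B : GradedBasis) (_∙_ : Op₂ (Free B)) (𝟙 : Free B) where

    record IsAlgebra : Set (c ⊔ r) where
      field
        isRing : IsRing (_≈ᴹ_ {B}) _+ᴹ_ _∙_ -ᴹ_ 0ᴹ 𝟙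
        *ₗ-∙   : ∀ s x y → (s *ₗ x) ∙ y ≈ᴹ s *ₗ (x ∙ y)
        ∙-*ₗ   : ∀ s x y → x ∙ (s *ₗ y) ≈ᴹ s *ₗ (x ∙ y)

  module _ (B : GradedBasis) (Δ : Free B → Free (B ⊗ᵇ B)) (ε : Free B → Scalar) where

    ε⊗id : Free (B ⊗ᵇ B) → Free B
    ε⊗id = extend (λ (b , b′) → ε ⟨ b ⟩ *ₗ ⟨ b′ ⟩)

    id⊗ε : Free (B ⊗ᵇ B) → Free B
    id⊗ε = extend (λ (b , b′) → ε ⟨ b′ ⟩ *ₗ ⟨ b ⟩)

    record IsCoalgebra : Set (c ⊔ r) where
      field
        Δ-linear      : IsLinear (free B) (free (B ⊗ᵇ B)) Δ
        ε-linear      : IsLinear (free B) scalars ε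
        coassociative : ∀ x → associator ((Δ ⊗ᶠ id) (Δ x)) ≈ᴹ (id ⊗ᶠ Δ) (Δ x)
        counitˡ       : ∀ x → ε⊗id (Δ x) ≈ᴹ x
        counitʳ       : ∀ x → id⊗ε (Δ x) ≈ᴹ x

  module _ (B : GradedBasis) (_∙_ : Op₂ (Free B)) (𝟙 : Free B)
           (Δ : Free B → Free (B ⊗ᵇ B)) (ε : Free B → Scalar) where

    _∙⊗_ : Op₂ (Free (B ⊗ᵇ B))
    _∙⊗_ = extend₂ (λ (a , b) (a′ , b′) → (⟨ a ⟩ ∙ ⟨ a′ ⟩) ⊗ (⟨ b ⟩ ∙ ⟨ b′ ⟩))

    record IsBialgebra : Set (c ⊔ r) where
      field
        isAlgebra   : IsAlgebra B _∙_ 𝟙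
        isCoalgebra : IsCoalgebra B Δ ε
        Δ-∙         : ∀ x y → Δ (x ∙ y) ≈ᴹ (Δ x) ∙⊗ (Δ y)
        Δ-𝟙         : Δ 𝟙 ≈ᴹ 𝟙 ⊗ 𝟙
        ε-∙         : ∀ x y → ε (x ∙ y) ≈ ε x * ε y
        ε-𝟙         : ε 𝟙 ≈ 1#

    -- The module is the direct sum of its homogeneous components because the basis is
    -- homogeneous.
    record IsGraded : Set (c ⊔ r) where
      field
        ∙-graded : ∀ {m n x y} → Homogeneous m x → Homogeneous n y → Homogeneous (m ℕ.+ n) (x ∙ y)
        𝟙-graded : Homogeneous 0 𝟙
        Δ-graded : ∀ {n x} → Homogeneous n x → Homogeneous n (Δ x)
        ε-graded : ∀ {n x} → n ≢ 0 → Homogeneous n x → ε x ≈ 0#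

    -- The component of degree 0 is free on the unit.
    record IsConnected : Set (c ⊔ r) where
      field
        𝟙-spans : ∀ x → Homogeneous 0 x → ∃ λ s → x ≈ᴹ s *ₗ 𝟙
        𝟙-free  : ∀ s → s *ₗ 𝟙 ≈ᴹ 0ᴹ → s ≈ 0#

    record IsGradedConnectedBialgebra : Set (c ⊔ r) where
      field
        isBialgebra : IsBialgebra
        isGraded    : IsGraded
        isConnected : IsConnected

    record IsAntipode (S : Free B → Free B) : Set (c ⊔ r) where
      multiply : Free (B ⊗ᵇ B) → Free B
      multiply = extend (λ (b , b′) → ⟨ b ⟩ ∙ ⟨ b′ ⟩)
      field
        S-linear : IsLinear (free B) (free B) S
        inverseˡ : ∀ x → multiply ((S ⊗ᶠ id) (Δ x)) ≈ᴹ ε x *ₗ 𝟙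
        inverseʳ : ∀ x → multiply ((id ⊗ᶠ S) (Δ x)) ≈ᴹ ε x *ₗ 𝟙

    record IsHopfAlgebra : Set (c ⊔ r) where
      field
        isBialgebra : IsBialgebra
        antipode    : Free B → Free B
        isAntipode  : IsAntipode antipode

module PQSym {c r} (R : CommutativeRing c r) (ℓ : ℕ) where
  open CommutativeRing R renaming (Carrier to Scalar)
  open FreeModule R public
  open Colored ℓ public

  coloredPFBasis : GradedBasis
  coloredPFBasis .GradedBasis.Index  = ColoredPF
  coloredPFBasis .GradedBasis._≟_    = _≟_
  coloredPFBasis .GradedBasis.degree = size

  PQSym : Set c
  PQSym = Free coloredPFBasis

  PQSym⊗PQSym : Set c
  PQSym⊗PQSym = Free (coloredPFBasis ⊗ᵇ coloredPFBasis)

  G : ColoredPF → PQSym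
  G = ⟨_⟩

  _·_ : Op₂ PQSym
  _·_ = extend₂ (λ a b → ∑⟨ filter (_∈? a * b) (coloredPFs (size a ℕ.+ size b)) ⟩)

  1PQSym : PQSym
  1PQSym = G ∅

  counit : PQSym → Scalar
  counit f = coefficient f ∅

  -- A formal series of colored words over X × C.
  Series : Set → Set c
  Series X = List (X × Color) → Scalar

  -- f(X × C), where p is parkization over X: linear in f, the series of G a being the sum
  -- of all colored words whose colored parkization is a.
  realize : {X : Set} → (List X → List ℕ) → PQSym → Series X
  realize p f w = foldr (λ (s , a) t → s * G-at a + t) 0# (terms f)
    where
    G-at : ColoredPF → Scalar
    G-at a = if does (zip (p (map proj₁ w)) (map proj₂ w) ≟ᵇ value a) then 1# else 0#

  -- The series f(A′)g(A″), with A′ and A″ commuting: a monomial is a pair of colored words.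
  realize⊗ : {X Y : Set} → (List X → List ℕ) → (List Y → List ℕ) → PQSym⊗PQSym →
             List (X × Color) → List (Y × Color) → Scalar
  realize⊗ p q t v w =
    foldr (λ (s , a , b) z → s * (realize p (G a) v * realize q (G b) w) + z) 0# (terms t)

  -- Letting the letters of X commute with those of Y identifies the words over (X ⊎ Y) × C
  -- having the same restrictions v and w, that is, the shuffles of v and w.
  commute : {X Y : Set} → Series (X ⊎ Y) → List (X × Color) → List (Y × Color) → Scalar
  commute F v w = foldr _+_ 0# (map F (shuffles (map (λ (x , u) → inj₁ x , u) v)
                                                (map (λ (y , u) → inj₂ y , u) w)))

  -- Δ f(A) = f(A′ ⊕ A″), where p is parkization over A′ ⊕ A″.
  IsOrderedSumCoproduct : (List (Letters (𝔸 ⊕ 𝔸)) → List ℕ) → (PQSym → PQSym⊗PQSym) → Set (c ⊔ r)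
  IsOrderedSumCoproduct p Δ =
    ∀ f v w → realize⊗ park𝔸 park𝔸 (Δ f) v w ≈ commute (realize p f) v w

{-# OPTIONS --safe #-}

-- The parkization of w applies to each letter a weakly increasing function that depends only
-- on the numbers of letters of w that are at most i.  Two consequences carry the proof.
-- Parkization commutes with passing to a factor of the word, so that f ↦ (w ↦ coefficient of
-- f at the parkization of w) turns the product into the convolution of series along the
-- deconcatenations of w.  And the parkization of a shuffle of v with a copy of w shifted far
-- above v is the same shuffle of the parkizations of v and w, shifted by the length of v, so
-- that the coproduct over the ordered sum is dual to the shifted shuffle.  The axioms then
-- reduce, coefficient by coefficient, to identities for shuffles and deconcatenations of words.
module Submission where

open import Algebra.Bundles using (CommutativeRing; Ring)
open import Algebra.Module.Bundles using (Module)
open import Algebra.Module.Morphism.Structures using (IsModuleHomomorphism)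
import Algebra.Module.Properties as ModuleProperties
open import Algebra.Module.Structures using (IsLeftModule)
import Algebra.Properties.CommutativeSemigroup as CommutativeSemigroupProperties
import Algebra.Properties.Ring as RingProperties
open import Data.Bool.Base using (false; if_then_else_; true)
open import Data.Empty using (⊥-elim)
open import Data.Fin.Base using (fromℕ<; toℕ) renaming (zero to fzero; suc to fsuc)
import Data.Fin.Properties as Fin
open import Data.Irrelevant using ([_])
open import Data.List.Base using (List; []; _++_; _∷_; allFin; cartesianProduct; concatMap; drop; filter;
  foldr; length; lookup; map; mapMaybe; take; upTo; zip)
import Data.List.Membership.DecPropositional as DecMembership
open import Data.List.Membership.Propositional using (_∈_; _∉_)
import Data.List.Membership.Propositional.Properties as ∈
import Data.List.Membership.Setoid as SetoidMembership
import Data.List.Properties as List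
open import Data.List.Relation.Binary.Permutation.Propositional using (_↭_; ↭-prep; ↭-refl; ↭-reflexive; ↭-sym;
  ↭-trans)
import Data.List.Relation.Binary.Permutation.Propositional.Properties as ↭
import Data.List.Relation.Binary.Subset.Setoid as SetoidSubset
import Data.List.Relation.Unary.All as All
open import Data.List.Relation.Unary.All using (All; []; _∷_)
import Data.List.Relation.Unary.All.Properties as All
import Data.List.Relation.Unary.AllPairs as AllPairs
open import Data.List.Relation.Unary.AllPairs using (AllPairs; []; _∷_)
import Data.List.Relation.Unary.AllPairs.Properties as AllPairs
import Data.List.Relation.Unary.Any as Any
open import Data.List.Relation.Unary.Any using (any?; here; there)
open import Data.List.Relation.Unary.Linked.Properties using (Linked⇒AllPairs)
open import Data.List.Relation.Unary.Unique.Propositional using (Unique)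
import Data.List.Relation.Unary.Unique.Propositional.Properties as Unique
import Data.List.Relation.Unary.Unique.Setoid as SetoidUnique
import Data.List.Sort.InsertionSort.Properties as InsertionSort
import Data.Nat.Base as ℕ
open import Data.Nat.Base using (_<_; _≤_; suc; s≤s; s≤s⁻¹; zero; z≤n; ℕ)
open import Data.Nat.ListAction using (sum)
import Data.Nat.Properties as ℕ
open import Data.Nat.Properties using (_≤?_)
open import Data.Product.Base using (_,_; _×_; map₁; proj₁; proj₂; Σ-syntax; ∃)
open import Data.Product.Properties using (,-injective; ×-≡,≡→≡)
open import Data.Refinement.Base using (_,_; value)
import Data.Refinement.Properties as Refinement
open import Data.Sum using (isInj₁; isInj₂)
open import Data.Sum.Base using ([_,_]′; _⊎_; inj₁; inj₂)
open import Data.Sum.Relation.Binary.LeftOrder using (drop-inj₁; drop-inj₂; ₁∼₁; ₂∼₂)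
open import Data.Sum.Relation.Binary.Pointwise using (inj₁; inj₂)
open import Function.Base using (_∘_; id)
open import Function.Bundles using (mk⇔)
open import Level using (Level)
open import Relation.Binary.Bundles using (DecTotalOrder)
import Relation.Binary.PropositionalEquality as ≡
open import Relation.Binary.PropositionalEquality using (_≡_; _≢_; cong; cong₂; refl; subst)
open import Relation.Nullary.Decidable using (dec-false; dec-true; does-⇔; recompute)
open import Relation.Nullary.Decidable.Core using (Dec; _×-dec_; does; no; yes; ¬?)
open import Relation.Nullary.Negation.Core using (¬_)
open import Defs
open GradedBasis using (Index; degree)

-- The recursion of `park` is awkward to compare between a word and its factors, because each step
-- lowers at a gap computed from the whole word. The closed form `height` sees a word only through
-- its counts, and `parkMap` is unchanged when a subword is lowered at the gap of the surrounding
-- word. Over the ordered sum no integer represents a letter of the right copy, so the shift stays a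
-- parameter `N`, subject only to `height` having saturated at `N`. It is instantiated by the length
-- of a parking function, both for that function and for its factors, and by the number of left
-- letters in a finite set of letters. Elements of a free module are unreduced lists of terms, equal
-- when their coefficients agree. Hence identities are checked on coefficients; that linear
-- extension respects this equality rests on `eval-vanish`, where terms are collected. The coproduct
-- is defined by the shuffle formula. The ordered sum determines it, since every parking function is
-- itself a word over the alphabet. The antipode comes from connectedness alone.

module Parkization where
  open import Data.Nat.Base
  open import Data.Nat.Properties
  open import Relation.Binary.PropositionalEquality

  -- Counting the letters of a word up to a bound.

  count≤-∷-yes : ∀ {i x} w → x ≤ i → count≤ i (x ∷ w) ≡ suc (count≤ i w)
  count≤-∷-yes {i} w x≤i = cong length (List.filter-accept (_≤? i) {xs = w} x≤i)

  count≤-∷-no : ∀ {i x} w → ¬ (x ≤ i) → count≤ i (x ∷ w) ≡ count≤ i w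
  count≤-∷-no {i} w x≰i = cong length (List.filter-reject (_≤? i) {xs = w} x≰i)

  count≤-map-mono : ∀ {i j} (f : ℕ → ℕ) w → (∀ x → x ≤ i → f x ≤ j) → count≤ i w ≤ count≤ j (map f w)
  count≤-map-mono f [] h = z≤n
  count≤-map-mono {i} {j} f (x ∷ w) h with x ≤? i
  ... | yes p rewrite count≤-∷-yes w p | count≤-∷-yes (map f w) (h x p) = s≤s (count≤-map-mono f w h)
  ... | no ¬p rewrite count≤-∷-no w ¬p with f x ≤? j
  ...   | yes q rewrite count≤-∷-yes (map f w) q = m≤n⇒m≤1+n (count≤-map-mono f w h)
  ...   | no ¬q rewrite count≤-∷-no (map f w) ¬q = count≤-map-mono f w h

  count≤-map : ∀ {i j} (f : ℕ → ℕ) w → All (λ x → (x ≤ i → f x ≤ j) × (f x ≤ j → x ≤ i)) w →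
               count≤ j (map f w) ≡ count≤ i w
  count≤-map f [] [] = refl
  count≤-map {i} {j} f (x ∷ w) ((to , from) ∷ hs) with x ≤? i
  ... | yes p rewrite count≤-∷-yes w p | count≤-∷-yes (map f w) (to p) = cong suc (count≤-map f w hs)
  ... | no ¬p rewrite count≤-∷-no w ¬p | count≤-∷-no (map f w) (¬p ∘ from) = count≤-map f w hs

  count≤-mono : ∀ {i j} w → i ≤ j → count≤ i w ≤ count≤ j w
  count≤-mono {i} {j} w i≤j =
    subst (λ v → count≤ i w ≤ count≤ j v) (List.map-id w) (count≤-map-mono id w (λ _ x≤i → ≤-trans x≤i i≤j))

  count≤-all : ∀ {i} w → All (_≤ i) w → count≤ i w ≡ length w
  count≤-all {i} w hs = cong length (List.filter-all (_≤? i) hs)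

  count≤-none : ∀ {i} w → All (i <_) w → count≤ i w ≡ 0
  count≤-none {i} w hs = cong length (List.filter-none (_≤? i) (All.map <⇒≱ hs))

  count≤-length⁻¹ : ∀ {i} w → length w ≤ count≤ i w → All (_≤ i) w
  count≤-length⁻¹ [] h = []
  count≤-length⁻¹ {i} (x ∷ w) h with x ≤? i
  ... | yes p rewrite count≤-∷-yes w p = p ∷ count≤-length⁻¹ w (s≤s⁻¹ h)
  ... | no ¬p rewrite count≤-∷-no w ¬p = ⊥-elim (<⇒≱ h (List.length-filter (_≤? i) w))

  count≤-++ : ∀ i v w → count≤ i (v ++ w) ≡ count≤ i v + count≤ i w
  count≤-++ i v w = trans (cong length (List.filter-++ (_≤? i) v w)) (List.length-++ (filter (_≤? i) v))

  count≤-↭ : ∀ i {v w} → v ↭ w → count≤ i v ≡ count≤ i w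
  count≤-↭ i p = ↭.↭-length (↭.filter-↭ (_≤? i) p)

  -- A crude substitute for the maximum: beyond it every letter is counted.
  letters≤sum : ∀ w → All (_≤ sum w) w
  letters≤sum []      = []
  letters≤sum (x ∷ w) = m≤m+n x (sum w) ∷ All.map (λ y≤ → ≤-trans y≤ (m≤n+m (sum w) x)) (letters≤sum w)

  -- Parkization as a letterwise map

  -- For the counting function c of a word w, one more than this is the image under
  -- parkization of the letter x + 1: unfolding gives height c x = min over 1 ≤ y ≤ x of
  -- (c y + x − y) and x.
  height : (ℕ → ℕ) → ℕ → ℕ
  height c zero    = zero
  height c (suc x) = suc (height c x) ⊓ c (suc x)

  -- Letters start at 1 and `height` at 0, hence the shift. It treats the letter 0 as 1, so that
  -- `parkMap` makes sense on every word.
  parkLetter : List ℕ → ℕ → ℕ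
  parkLetter w x = suc (height (λ i → count≤ i w) (pred x))

  parkMap : List ℕ → List ℕ
  parkMap w = map (parkLetter w) w

  height-cong : ∀ {c c′} x → (∀ {i} → i < x → c (suc i) ≡ c′ (suc i)) → height c x ≡ height c′ x
  height-cong zero    h = refl
  height-cong (suc x) h = cong₂ (λ a b → suc a ⊓ b) (height-cong x (h ∘ m<n⇒m<1+n)) (h ≤-refl)

  height≤count : ∀ c x → height c (suc x) ≤ c (suc x)
  height≤count c x = m⊓n≤n (suc (height c x)) _

  module _ (w : List ℕ) where

    private
      c = λ i → count≤ i w

    height-step : ∀ x → height c x ≤ height c (suc x)
    height-step zero    = z≤n
    height-step (suc x) = ⊓-glb (n≤1+n _) (≤-trans (height≤count c x) (count≤-mono w (n≤1+n _)))

    height-mono : ∀ {x y} → x ≤ y → height c x ≤ height c y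
    height-mono {x} {y} x≤y with m≤n⇒m<n∨m≡n x≤y
    ... | inj₂ refl = ≤-refl
    height-mono {x} {suc y} x≤y | inj₁ x<y = ≤-trans (height-mono (s≤s⁻¹ x<y)) (height-step y)

    height≤length : ∀ x → height c x ≤ length w
    height≤length zero    = z≤n
    height≤length (suc x) = ≤-trans (height≤count c x) (List.length-filter (_≤? suc x) w)

    -- height climbs in unit steps, so every j up to height c x is attained, and where j is
    -- attained for the first time there are at least j letters with image at most j.
    count-parkMap-height : ∀ x {j} → j ≤ height c x → j ≤ count≤ j (parkMap w)
    count-parkMap-height zero    {zero}  j≤h = z≤n
    count-parkMap-height (suc x) {j} j≤h with j ≤? height c x
    ... | yes p = count-parkMap-height x p
    ... | no ¬p with ≤-antisym (≤-trans j≤h (m⊓n≤m (suc (height c x)) _)) (≰⇒> ¬p)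
    ...   | refl = ≤-trans j≤h (≤-trans (height≤count c x)
                     (count≤-map-mono (parkLetter w) w (λ y y≤ → s≤s (height-mono (pred-mono-≤ y≤)))))

    -- If `height` reaches `j` by `sum w`, the previous lemma applies. Otherwise every image is at
    -- most `j`, since no letter exceeds `sum w`, and all letters are counted.
    count-parkMap : ∀ {j} → j ≤ length w → j ≤ count≤ j (parkMap w)
    count-parkMap {j} j≤n with j ≤? height c (sum w)
    ... | yes p = count-parkMap-height (sum w) p
    ... | no ¬p = ≤-trans j≤n
        (≤-reflexive (sym (trans (count≤-all (parkMap w) (All.map⁺ (All.map small (letters≤sum w))))
                    (List.length-map _ w))))
      where
      small : ∀ {x} → x ≤ sum w → parkLetter w x ≤ j
      small {x} x≤ = ≤-trans (s≤s (height-mono (≤-trans pred[n]≤n x≤))) (≰⇒> ¬p)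

  -- Counting characterization of parking functions

  -- The condition whose failure `d` searches for. At `j` equal to the length it also bounds the
  -- letters.
  CountPF : List ℕ → Set
  CountPF w = All (1 ≤_) w × (∀ {j} → j ≤ length w → j ≤ count≤ j w)

  lookup≤⇒count : ∀ {s} → AllPairs _≤_ s → ∀ i j → lookup s i ≤ j → suc (toℕ i) ≤ count≤ j s
  lookup≤⇒count {x ∷ s} (x≤ ∷ ss) fzero    j h rewrite count≤-∷-yes s h = s≤s z≤n
  lookup≤⇒count {x ∷ s} (x≤ ∷ ss) (fsuc i) j h
    rewrite count≤-∷-yes s (≤-trans (All.lookup x≤ (∈.∈-lookup i)) h) = s≤s (lookup≤⇒count ss i j h)

  count⇒lookup≤ : ∀ {s} → AllPairs _≤_ s → ∀ i j → suc (toℕ i) ≤ count≤ j s → lookup s i ≤ j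
  count⇒lookup≤ {x ∷ s} (x≤ ∷ ss) i j h with x ≤? j
  count⇒lookup≤ {x ∷ s} (x≤ ∷ ss) fzero    j h | yes p = p
  count⇒lookup≤ {x ∷ s} (x≤ ∷ ss) (fsuc i) j h | yes p =
    count⇒lookup≤ ss i j (s≤s⁻¹ (subst (_ ≤_) (count≤-∷-yes s p) h))
  count⇒lookup≤ {x ∷ s} (x≤ ∷ ss) i j h | no ¬p =
    ⊥-elim (n≮0 (subst (_ ≤_) (count≤-none (x ∷ s) (≰⇒> ¬p ∷ All.map (<-≤-trans (≰⇒> ¬p)) x≤)) h))

  private
    module Sort = InsertionSort ≤-decTotalOrder

    sort-sorted : ∀ w → AllPairs _≤_ (sort w)
    sort-sorted w = Linked⇒AllPairs ≤-trans (Sort.sort-↗ w)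

  IsParking⇒CountPF : ∀ {w} → IsParking w → CountPF w
  IsParking⇒CountPF {w} (letters , sorted) = All.map proj₁ letters , counts
    where
    counts : ∀ {j} → j ≤ length w → j ≤ count≤ j w
    counts {zero}  _ = z≤n
    counts {suc j} j< = subst₂ _≤_ (cong suc toℕ-i) (count≤-↭ (suc j) (Sort.sort-↭ w))
        (lookup≤⇒count (sort-sorted w) i (suc j) (subst (λ k → lookup (sort w) i ≤ suc k) toℕ-i (sorted i)))
      where
      j<′ = subst (j <_) (sym (↭.↭-length (Sort.sort-↭ w))) j<
      i = fromℕ< j<′
      toℕ-i = Fin.toℕ-fromℕ< j<′

  CountPF⇒≤ : ∀ {w} → CountPF w → All (_≤ length w) w
  CountPF⇒≤ {w} (_ , counts) = count≤-length⁻¹ w (counts ≤-refl)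

  CountPF⇒IsParking : ∀ {w} → CountPF w → IsParking w
  CountPF⇒IsParking {w} pf@(pos , counts) = All.zip (pos , CountPF⇒≤ pf) , λ i →
    count⇒lookup≤ (sort-sorted w) i _
      (subst (suc (toℕ i) ≤_) (sym (count≤-↭ _ (Sort.sort-↭ w)))
        (counts (subst (toℕ i <_) (↭.↭-length (Sort.sort-↭ w)) (Fin.toℕ<n i))))

  parkMap-parking : ∀ w → IsParking (parkMap w)
  parkMap-parking w = CountPF⇒IsParking
    ( All.map⁺ (All.universal (λ _ → s≤s z≤n) w)
    , λ {j} j≤ → count-parkMap w (subst (j ≤_) (List.length-map _ w) j≤))

  -- While the counts stay on or above the diagonal, the minimum never cuts the climb by unit steps.
  height-id : ∀ {c} n → (∀ {j} → j ≤ n → j ≤ c j) → ∀ {x} → x ≤ n → height c x ≡ x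
  height-id n h {zero}  x≤n = refl
  height-id {c} n h {suc x} x≤n = trans (cong (λ a → suc a ⊓ c (suc x)) (height-id n h (≤-trans (n≤1+n x) x≤n)))
                                        (m≤n⇒m⊓n≡m (h x≤n))

  map-id-All : ∀ {A : Set} {f : A → A} {w} → All (λ x → f x ≡ x) w → map f w ≡ w
  map-id-All []       = refl
  map-id-All (p ∷ ps) = cong₂ _∷_ p (map-id-All ps)

  parkMap-id : ∀ {w} → CountPF w → parkMap w ≡ w
  parkMap-id {w} pf@(pos , counts) = map-id-All (All.map fixed (All.zip (pos , CountPF⇒≤ pf)))
    where
    fixed : ∀ {x} → 1 ≤ x × x ≤ length w → parkLetter w x ≡ x
    fixed {suc x} (_ , x≤n) = cong suc (height-id (length w) counts (≤-trans (n≤1+n x) x≤n))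

  -- One step of parkization

  -- The letter function of `lower` is local to it; a named copy is needed to reason about single
  -- letters.
  lowerAt : ℕ → ℕ → ℕ
  lowerAt k x with k <? x
  ... | yes _ = pred x
  ... | no  _ = x

  lower≡map : ∀ k w → lower k w ≡ map (lowerAt k) w
  lower≡map k []      = refl
  lower≡map k (x ∷ w) with k <? x
  ... | yes _ = cong (pred x ∷_) (lower≡map k w)
  ... | no  _ = cong (x ∷_) (lower≡map k w)

  -- Together with the next lemma: lowering at `k` deletes the entry at `k` from the sequence of
  -- counts and leaves the others in order.
  count-lower-< : ∀ {k j} w → j < k → count≤ j (map (lowerAt k) w) ≡ count≤ j w
  count-lower-< {k} {j} w j<k = count≤-map (lowerAt k) w (All.universal letter w)
    where
    letter : ∀ x → (x ≤ j → lowerAt k x ≤ j) × (lowerAt k x ≤ j → x ≤ j)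
    letter x with k <? x
    ... | no  _ = id , id
    ... | yes p = (λ x≤j → ≤-trans pred[n]≤n x≤j) , λ x≤j →
        ⊥-elim (<⇒≱ (≤-trans p (suc-pred-≤ x)) (≤-trans (s≤s x≤j) j<k))
      where
      suc-pred-≤ : ∀ y → y ≤ suc (pred y)
      suc-pred-≤ zero    = z≤n
      suc-pred-≤ (suc y) = ≤-refl

  count-lower-≥ : ∀ {k j} w → k ≤ j → count≤ j (map (lowerAt k) w) ≡ count≤ (suc j) w
  count-lower-≥ {k} {j} w k≤j = count≤-map (lowerAt k) w (All.universal letter w)
    where
    letter : ∀ x → (x ≤ suc j → lowerAt k x ≤ j) × (lowerAt k x ≤ j → x ≤ suc j)
    letter x with k <? x
    ... | no ¬p = (λ _ → ≤-trans (≮⇒≥ ¬p) k≤j) , m≤n⇒m≤1+n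
    letter (suc x) | yes p = s≤s⁻¹ , s≤s

  -- v is a subword of w whose complement is counted by c″; k + 1 is the letter d w at which w
  -- is lowered.
  module _ {k : ℕ} (v w : List ℕ) (c″ : ℕ → ℕ) (c″-mono : ∀ {i j} → i ≤ j → c″ i ≤ c″ j)
           (split : ∀ i → count≤ i w ≡ count≤ i v + c″ i)
           (full : ∀ {j} → j ≤ k → j ≤ count≤ j w) (gap : count≤ (suc k) w ≤ k) where

    private
      c c′ : ℕ → ℕ
      c  i = count≤ i v
      c′ i = count≤ i (map (lowerAt (suc k)) v)

      -- `w` has at most `k` letters up to `k + 1` and at least `y` up to `y`, so at most `k - y`
      -- lie in between, and the subword `v` has no more there. This bounds each candidate in the
      -- minimum defining `height c y`. At `y = k` it says that `height` does not grow at the step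
      -- to `k + 1`.
      height-bound : ∀ {y} → y ≤ k → c (suc k) + y ≤ height c y + k
      height-bound {zero}  _   = subst (_≤ k) (sym (+-identityʳ _))
        (≤-trans (≤-trans (m≤m+n _ _) (≤-reflexive (sym (split (suc k))))) gap)
      height-bound {suc y} y<k with ⊓-sel (suc (height c y)) (c (suc y))
      ... | inj₁ e rewrite e | +-suc (c (suc k)) y = s≤s (height-bound (≤-trans (n≤1+n y) y<k))
      ... | inj₂ e rewrite e = +-cancelˡ-≤ (c″ (suc k)) _ _ (begin
        c″ (suc k) + (c (suc k) + suc y) ≡⟨ +-assoc (c″ (suc k)) (c (suc k)) (suc y) ⟨
        c″ (suc k) + c (suc k) + suc y
          ≡⟨ cong (_+ suc y) (trans (+-comm (c″ (suc k)) _) (sym (split (suc k)))) ⟩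
        count≤ (suc k) w + suc y         ≤⟨ +-mono-≤ gap (full y<k) ⟩
        k + count≤ (suc y) w             ≡⟨ cong (k +_) (trans (split (suc y)) (+-comm (c (suc y)) _)) ⟩
        k + (c″ (suc y) + c (suc y))
          ≤⟨ +-monoʳ-≤ k (+-monoˡ-≤ (c (suc y)) (c″-mono (s≤s (≤-trans (n≤1+n y) y<k)))) ⟩
        k + (c″ (suc k) + c (suc y))     ≡⟨ +-comm k _ ⟩
        c″ (suc k) + c (suc y) + k       ≡⟨ +-assoc (c″ (suc k)) (c (suc y)) k ⟩
        c″ (suc k) + (c (suc y) + k)     ∎)
        where open ≤-Reasoning

      flat : height c (suc k) ≡ height c k
      flat = ≤-antisym (≤-trans (height≤count c k) (+-cancelʳ-≤ k _ _ (height-bound ≤-refl))) (height-step v k)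

      below : ∀ {x} → x ≤ k → height c′ x ≡ height c x
      below {x} x≤k = height-cong x (λ i<x → count-lower-< v (s≤s (≤-trans i<x x≤k)))

      -- With the count at `k + 1` deleted, the recursion runs one index ahead; `flat` makes the two
      -- sequences of heights agree at the junction.
      above : ∀ {x} → k ≤ x → height c′ x ≡ height c (suc x)
      above {x} k≤x with m≤n⇒m<n∨m≡n k≤x
      ... | inj₂ refl = trans (below ≤-refl) (sym flat)
      above {suc x} _ | inj₁ k<x = cong₂ (λ a b → suc a ⊓ b) (above (s≤s⁻¹ k<x)) (count-lower-≥ v k<x)

    parkMap-lower : parkMap (map (lowerAt (suc k)) v) ≡ parkMap v
    parkMap-lower = trans (sym (List.map-∘ v)) (List.map-cong letter v)
      where
      letter : ∀ x → suc (height c′ (pred (lowerAt (suc k) x))) ≡ suc (height c (pred x))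
      letter x with suc k <? x
      letter (suc (suc x)) | yes p = cong suc (above (s≤s⁻¹ (s≤s⁻¹ p)))
      letter (suc zero)    | yes (s≤s ())
      letter zero          | no  _ = refl
      letter (suc x)       | no ¬p = cong suc (below (s≤s⁻¹ (≮⇒≥ ¬p)))

  1≤d : ∀ w → 1 ≤ d w
  1≤d w with d w | d-< w
  ... | suc _ | _ = s≤s z≤n

  d-full : ∀ w {j} → j < d w → j ≤ count≤ j w
  d-full w {zero}  _ = z≤n
  d-full w {suc j} h = ≮⇒≥ (d-minimal w (suc j) (s≤s z≤n) h)

  parkMap-lower-d : ∀ v v″ w → (∀ i → count≤ i w ≡ count≤ i v + count≤ i v″) →
                    parkMap (map (lowerAt (d w)) v) ≡ parkMap v
  parkMap-lower-d v v″ w split with d w | 1≤d w | d-< w | (λ {j} → d-full w {j})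
  ... | suc k | _ | gap | full =
    parkMap-lower v w (λ i → count≤ i v″) (count≤-mono v″) split (full ∘ s≤s) (s≤s⁻¹ gap)

  -- sub and co stand for complementary subword operations such as take n and drop n.
  module _ (sub co : List ℕ → List ℕ) (sub-map : ∀ (f : ℕ → ℕ) w → sub (map f w) ≡ map f (sub w))
           (split : ∀ w i → count≤ i w ≡ count≤ i (sub w) + count≤ i (co w)) where

    -- Each step lowers at the gap of the whole word, which need not be the gap of the factor.
    -- `parkMap-lower-d` allows this, so the steps for `w` leave the parkization of `sub w` alone.
    parkMap-sub-parkWithin : ∀ f w → parkMap (sub (parkWithin f w)) ≡ parkMap (sub w)
    parkMap-sub-parkWithin zero    w = refl
    parkMap-sub-parkWithin (suc f) w with d w ≟ suc (length w)
    ... | yes _ = refl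
    ... | no  _ = trans (parkMap-sub-parkWithin f (lower (d w) w)) (trans
      (cong parkMap (trans (cong sub (lower≡map (d w) w)) (sub-map (lowerAt (d w)) w)))
      (parkMap-lower-d (sub w) (co w) w (split w)))

  -- The recursion ends with `d w` one more than the length, that is, with no gap; positivity
  -- survives because letters are lowered only above `d w`, which is at least 1. Each other step
  -- decreases the sum, so the fuel cannot run out early.
  parkWithin-CountPF : ∀ f w → sum w ≤ f → All (1 ≤_) w → CountPF (parkWithin f w)
  parkWithin-CountPF f w s≤ pos with d w ≟ suc (length w)
  ... | yes d≡ = subst CountPF (sym (parkWithin-done f w d≡))
                   (pos , λ j≤ → d-full w (subst (_ <_) (sym d≡) (s≤s j≤)))
  parkWithin-CountPF zero    w s≤ pos | no d≢ = ⊥-elim (n≮0 (<-≤-trans (lower-< w d≢) s≤))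
  parkWithin-CountPF (suc f) w s≤ pos | no d≢ with d w ≟ suc (length w)
  ... | yes d≡ = ⊥-elim (d≢ d≡)
  ... | no  _  = parkWithin-CountPF f (lower (d w) w) (s≤s⁻¹ (<-≤-trans (lower-< w d≢) s≤))
                   (subst (All (1 ≤_)) (sym (lower≡map (d w) w)) (All.map⁺ (All.map positive pos)))
    where
    positive : ∀ {x} → 1 ≤ x → 1 ≤ lowerAt (d w) x
    positive {x} 1≤x with d w <? x
    ... | yes p = <⇒≤pred (≤-<-trans (1≤d w) p)
    ... | no  _ = 1≤x

  -- Taking the whole word as the subword, `parkMap` is invariant under every step and fixes the
  -- parking function at which the steps end.
  park≡parkMap : ∀ {w} → All (1 ≤_) w → park w ≡ parkMap w
  park≡parkMap {w} pos = trans (sym (parkMap-id (parkWithin-CountPF (sum w) w ≤-refl pos)))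
    (parkMap-sub-parkWithin id (λ _ → []) (λ _ _ → refl) (λ w i → sym (+-identityʳ _)) (sum w) w)

  -- `height` reads counts at positive arguments only, and these do not tell 0 from 1. This carries
  -- identities proved through `park` over to words with arbitrary letters.
  parkMap-pos : ∀ w → parkMap (map (suc ∘ pred) w) ≡ parkMap w
  parkMap-pos w = trans (sym (List.map-∘ w)) (List.map-cong (λ x → cong suc (height-cong (pred x) λ {i} _ →
    count≤-map (suc ∘ pred) w (All.universal (letter i) w))) w)
    where
    letter : ∀ i x → (x ≤ suc i → suc (pred x) ≤ suc i) × (suc (pred x) ≤ suc i → x ≤ suc i)
    letter i zero    = (λ _ → s≤s z≤n) , (λ _ → z≤n)
    letter i (suc x) = id , id

  module _ (sub co : List ℕ → List ℕ) (sub-map : ∀ (f : ℕ → ℕ) w → sub (map f w) ≡ map f (sub w))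
           (split : ∀ w i → count≤ i w ≡ count≤ i (sub w) + count≤ i (co w)) where

    -- `parkMap w` is reached by lowering steps from `w` with its zeros raised to ones, and none of
    -- them affects the parkization of the factor.
    parkMap-sub : ∀ w → parkMap (sub (parkMap w)) ≡ parkMap (sub w)
    parkMap-sub w = begin
      parkMap (sub (parkMap w))
        ≡⟨ cong (parkMap ∘ sub) (trans (sym (parkMap-pos w)) (sym (park≡parkMap pos))) ⟩
      parkMap (sub (park w⁺))    ≡⟨ parkMap-sub-parkWithin sub co sub-map split (sum w⁺) w⁺ ⟩
      parkMap (sub w⁺)           ≡⟨ cong parkMap (sub-map (suc ∘ pred) w) ⟩
      parkMap (map (suc ∘ pred) (sub w)) ≡⟨ parkMap-pos (sub w) ⟩
      parkMap (sub w)            ∎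
      where
      open ≡-Reasoning
      w⁺ = map (suc ∘ pred) w
      pos = All.map⁺ (All.universal (λ _ → s≤s z≤n) w)

  count≤-take-drop : ∀ n w i → count≤ i w ≡ count≤ i (take n w) + count≤ i (drop n w)
  count≤-take-drop n w i = trans (cong (count≤ i) (sym (List.take++drop≡id n w)))
      (count≤-++ i (take n w) (drop n w))

  parkMap-take : ∀ n w → parkMap (take n (parkMap w)) ≡ parkMap (take n w)
  parkMap-take n = parkMap-sub (take n) (drop n) (λ f w → List.take-map n w) (count≤-take-drop n)

  parkMap-drop : ∀ n w → parkMap (drop n (parkMap w)) ≡ parkMap (drop n w)
  parkMap-drop n = parkMap-sub (drop n) (take n) (λ f w → List.drop-map n w)
    (λ w i → trans (count≤-take-drop n w i) (+-comm (count≤ i (take n w)) _))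

  -- Parkization over an ordered sum: s consists of the letters of v and of w shifted by N, and
  -- the hypothesis on height says that N is far enough above v.
  module _ {N : ℕ} (v w s : List ℕ) (pos : All (1 ≤_) w)
           (split : ∀ i → count≤ i s ≡ count≤ i v + count≤ i (map (N +_) w))
           (far : height (λ i → count≤ i v) N ≡ length v) where

    private
      left : ∀ {x} → x ≤ N → height (λ i → count≤ i s) x ≡ height (λ i → count≤ i v) x
      left {x} x≤N = height-cong x λ {i} i<x → trans (split (suc i)) (trans
        (cong (count≤ (suc i) v +_) (count≤-none (map (N +_) w)
          (All.map⁺ (All.map (λ 1≤y → ≤-<-trans (≤-trans i<x x≤N) (m<m+n N 1≤y)) pos))))
        (+-identityʳ _))

      count-v : ∀ {N} v → height (λ i → count≤ i v) N ≡ length v → ∀ {j} → N ≤ j → count≤ j v ≡ length v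
      count-v {N} v far {j} N≤j = ≤-antisym (List.length-filter (_≤? j) v) (≤-trans (≤-reflexive (sym far))
          (bound N N≤j))
        where
        bound : ∀ N → N ≤ j → height (λ i → count≤ i v) N ≤ count≤ j v
        bound zero    _   = z≤n
        bound (suc N) N≤j = ≤-trans (height≤count _ N) (count≤-mono v N≤j)

      -- From `N` on all of `v` is counted, so both sides of the minimum contain `length v`, which
      -- factors out and leaves the recursion for `w`. Writing `y + N` lets `height` unfold at
      -- `suc y`.
      right : ∀ y → height (λ i → count≤ i s) (y + N) ≡ length v + height (λ i → count≤ i w) y
      right zero    = trans (left ≤-refl) (trans far (sym (+-identityʳ _)))
      right (suc y) = begin
        suc (height _ (y + N)) ⊓ count≤ (suc y + N) s
          ≡⟨ cong₂ (λ a b → suc a ⊓ b) (right y) (split (suc y + N)) ⟩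
        suc (length v + height _ y) ⊓ (count≤ (suc y + N) v + count≤ (suc y + N) (map (N +_) w))
          ≡⟨ cong₂ _⊓_ (sym (+-suc (length v) _)) (cong₂ _+_ (count-v v far (m≤n+m N (suc y)))
               (count≤-map (N +_) w (All.universal (λ z →
                 (λ z≤ → ≤-trans (+-monoʳ-≤ N z≤) (≤-reflexive (+-comm N (suc y)))) ,
                 (λ z≤ → +-cancelˡ-≤ N _ _ (≤-trans z≤ (≤-reflexive (+-comm (suc y) N))))) w))) ⟩
        (length v + suc (height _ y)) ⊓ (length v + count≤ (suc y) w)
          ≡⟨ +-distribˡ-⊓ (length v) _ _ ⟨
        length v + suc (height _ y) ⊓ count≤ (suc y) w ∎
        where open ≡-Reasoning

    parkLetter-left : ∀ {x} → x ≤ N → parkLetter s x ≡ parkLetter v x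
    parkLetter-left x≤N = cong suc (left (≤-trans pred[n]≤n x≤N))

    parkLetter-right : ∀ {y} → 1 ≤ y → parkLetter s (N + y) ≡ length v + parkLetter w y
    parkLetter-right {suc y} _ rewrite +-suc N y | +-comm N y | +-suc (length v) (height (λ i → count≤ i w) y) =
      cong suc (right y)

  -- `height` lies below the count, so saturation at `N` forces all letters of `v` to be counted
  -- there.
  far⇒≤ : ∀ {N} v → height (λ i → count≤ i v) N ≡ length v → All (_≤ N) v
  far⇒≤ {zero}  []      _   = []
  far⇒≤ {suc N} v       far = count≤-length⁻¹ v (≤-trans (≤-reflexive (sym far)) (height≤count _ N))

  -- Past `m` every letter is counted, so `height` gains one per step until it saturates, which
  -- takes at most `length v` steps.
  far-beyond : ∀ {m} v → All (_≤ m) v → ∀ {N} → m + length v ≤ N → height (λ i → count≤ i v) N ≡ length v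
  far-beyond {m} v v≤m {N} N≥ = ≤-antisym (height≤length v N) (≤-trans (climb (length v) ≤-refl)
      (height-mono v N≥))
    where
    climb : ∀ j → j ≤ length v → j ≤ height (λ i → count≤ i v) (m + j)
    climb zero    _   = z≤n
    climb (suc j) j<n rewrite +-suc m j = ⊓-glb (s≤s (climb j (≤-trans (n≤1+n j) j<n)))
      (≤-trans j<n (≤-reflexive
        (sym (count≤-all v (All.map (λ x≤m → ≤-trans x≤m (≤-trans (m≤m+n m j) (n≤1+n _))) v≤m)))))

  -- At most `length v″` letters are missing from `v`, so up to `x` it still has at least
  -- `x - length v″` letters. Thus the defect of `v` as a parking function is made up by position
  -- `length w`.
  far-subword : ∀ {w} v v″ → CountPF w → (∀ i → count≤ i w ≡ count≤ i v + count≤ i v″) →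
                length w ≡ length v + length v″ → height (λ i → count≤ i v) (length w) ≡ length v
  far-subword {w} v v″ (_ , full) split len =
    ≤-antisym (height≤length v (length w)) (+-cancelʳ-≤ (length w) _ _ (climb ≤-refl))
    where
    climb : ∀ {x} → x ≤ length w → length v + x ≤ height (λ i → count≤ i v) x + length w
    climb {zero}  _   rewrite +-identityʳ (length v) | len = m≤m+n _ _
    climb {suc x} x<n with ⊓-sel (suc (height (λ i → count≤ i v) x)) (count≤ (suc x) v)
    ... | inj₁ e rewrite e | +-suc (length v) x = s≤s (climb (≤-trans (n≤1+n x) x<n))
    ... | inj₂ e rewrite e = subst (λ n → length v + suc x ≤ count≤ (suc x) v + n) (sym len) (begin
      length v + suc x                               ≤⟨ +-monoʳ-≤ (length v) (full′) ⟩
      length v + (count≤ (suc x) v + count≤ (suc x) v″) ≡⟨ x∙yz≈y∙xz (length v) (count≤ (suc x) v) _ ⟩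
      count≤ (suc x) v + (length v + count≤ (suc x) v″)
        ≤⟨ +-monoʳ-≤ (count≤ (suc x) v) (+-monoʳ-≤ (length v) (List.length-filter (_≤? suc x) v″)) ⟩
      count≤ (suc x) v + (length v + length v″) ∎)
      where
      open ≤-Reasoning
      open import Algebra.Properties.CommutativeSemigroup +-commutativeSemigroup using (x∙yz≈y∙xz)
      full′ : suc x ≤ count≤ (suc x) v + count≤ (suc x) v″
      full′ = ≤-trans (full x<n) (≤-reflexive (split (suc x)))

open Parkization

private
  variable
    α β : Level
    X : Set α
    Y : Set β

-- Shuffles and deconcatenations

splits : List X → List (List X × List X)
splits []       = ([] , []) ∷ []
splits (x ∷ xs) = ([] , x ∷ xs) ∷ map (λ (p , q) → x ∷ p , q) (splits xs)

∈-splits : ∀ (xs : List X) {p q} → (p , q) ∈ splits xs → p ≡ take (length p) xs × q ≡ drop (length p) xs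
∈-splits []       (here refl) = refl , refl
∈-splits (x ∷ xs) (here refl) = refl , refl
∈-splits (x ∷ xs) (there h) with ∈.∈-map⁻ _ h
... | _ , h′ , refl = cong (x ∷_) (proj₁ (∈-splits xs h′)) , proj₂ (∈-splits xs h′)

splits-map : ∀ (f : X → Y) xs → splits (map f xs) ≡ map (λ (p , q) → map f p , map f q) (splits xs)
splits-map f []       = refl
splits-map f (x ∷ xs) = cong (([] , f x ∷ map f xs) ∷_) (≡.trans (cong (map _) (splits-map f xs))
  (≡.trans (≡.sym (List.map-∘ (splits xs))) (List.map-∘ (splits xs))))

module _ (ℓ : ℕ) where
  open Colored ℓ using (shuffles)

  shuffles-[]ʳ : (xs : List X) → shuffles xs [] ≡ xs ∷ []
  shuffles-[]ʳ []       = refl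
  shuffles-[]ʳ (x ∷ xs) = refl

  shuffles-map : ∀ (f : X → Y) xs ys → shuffles (map f xs) (map f ys) ≡ map (map f) (shuffles xs ys)
  shuffles-map f []       ys       = refl
  shuffles-map f (x ∷ xs) []       = refl
  shuffles-map f (x ∷ xs) (y ∷ ys) = ≡.trans
    (cong₂ (λ l r → map (f x ∷_) l ++ map (f y ∷_) r) (shuffles-map f xs (y ∷ ys)) (shuffles-map f (x ∷ xs) ys))
    (≡.trans (cong₂ _++_ (swap x (shuffles xs (y ∷ ys))) (swap y (shuffles (x ∷ xs) ys)))
             (≡.sym (List.map-++ (map f) (map (x ∷_) (shuffles xs (y ∷ ys))) _)))
    where
    swap : ∀ z l → map (f z ∷_) (map (map f) l) ≡ map (map f) (map (z ∷_) l)
    swap z l = ≡.trans (≡.sym (List.map-∘ l)) (List.map-∘ l)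

  shuffles-↭ : ∀ (xs ys : List X) {s} → s ∈ shuffles xs ys → s ↭ xs ++ ys
  shuffles-↭ []       ys (here refl) = ↭-refl
  shuffles-↭ (x ∷ xs) [] (here refl) = ↭-reflexive (≡.sym (List.++-identityʳ (x ∷ xs)))
  shuffles-↭ (x ∷ xs) (y ∷ ys) h with ∈.∈-++⁻ (map (x ∷_) (shuffles xs (y ∷ ys))) h
  ... | inj₁ h₁ with ∈.∈-map⁻ (x ∷_) h₁
  ...   | _ , h′ , refl = ↭-prep x (shuffles-↭ xs (y ∷ ys) h′)
  shuffles-↭ (x ∷ xs) (y ∷ ys) h | inj₂ h₂ with ∈.∈-map⁻ (y ∷_) h₂
  ...   | _ , h′ , refl = ↭-trans (↭-prep y (shuffles-↭ (x ∷ xs) ys h′)) (↭-sym (↭.shift y (x ∷ xs) ys))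

  -- When no letter is common, the first letter of a shuffle tells which word supplied it. This is
  -- what makes the coproduct formula free of multiplicities.
  shuffles-unique : (xs ys : List X) → (∀ {z} → z ∈ xs → z ∉ ys) → Unique (shuffles xs ys)
  shuffles-unique []       ys       _  = [] ∷ []
  shuffles-unique (x ∷ xs) []       _  = [] ∷ []
  shuffles-unique (x ∷ xs) (y ∷ ys) x# = Unique.++⁺
    (Unique.map⁺ List.∷-injectiveʳ (shuffles-unique xs (y ∷ ys) (x# ∘ there)))
    (Unique.map⁺ List.∷-injectiveʳ (shuffles-unique (x ∷ xs) ys (λ z∈ → x# z∈ ∘ there)))
    λ (h₁ , h₂) → heads (∈.∈-map⁻ (x ∷_) h₁) (∈.∈-map⁻ (y ∷_) h₂)
    where
    heads : ∀ {s} → (∃ λ t → t ∈ shuffles xs (y ∷ ys) × s ≡ x ∷ t) →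
            ¬ (∃ λ t → t ∈ shuffles (x ∷ xs) ys × s ≡ y ∷ t)
    heads (_ , _ , refl) (_ , _ , e) = x# (here refl) (here (List.∷-injectiveˡ e))

-- Finite sums, and sums over splits and shuffles.

module Sums {c r} (R : CommutativeRing c r) where
  open CommutativeRing R hiding (refl) renaming (Carrier to Scalar)
  open import Relation.Binary.Reasoning.Setoid setoid
  private
    module R = CommutativeRing R
    module + = CommutativeSemigroupProperties (CommutativeRing.+-commutativeSemigroup R)

  ∑ : List X → (X → Scalar) → Scalar
  ∑ xs φ = foldr (λ x t → φ x + t) 0# xs

  syntax ∑ xs (λ x → e) = ∑[ x ∈ xs ] e
  infixr 8 ∑

  ∑-cong-∈ : ∀ (xs : List X) {φ ψ : X → Scalar} → (∀ {x} → x ∈ xs → φ x ≈ ψ x) → ∑ xs φ ≈ ∑ xs ψ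
  ∑-cong-∈ []       h = R.refl
  ∑-cong-∈ (x ∷ xs) h = +-cong (h (here ≡.refl)) (∑-cong-∈ xs (h ∘ there))

  ∑-cong : ∀ (xs : List X) {φ ψ : X → Scalar} → (∀ x → φ x ≈ ψ x) → ∑ xs φ ≈ ∑ xs ψ
  ∑-cong xs h = ∑-cong-∈ xs (λ {x} _ → h x)

  ∑-++ : ∀ (xs ys : List X) φ → ∑ (xs ++ ys) φ ≈ ∑ xs φ + ∑ ys φ
  ∑-++ []       ys φ = sym (+-identityˡ _)
  ∑-++ (x ∷ xs) ys φ = trans (+-congˡ (∑-++ xs ys φ)) (sym (+-assoc _ _ _))

  ∑-map : ∀ (f : X → Y) xs φ → ∑ (map f xs) φ ≡ ∑ xs (φ ∘ f)
  ∑-map f []       φ = ≡.refl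
  ∑-map f (x ∷ xs) φ = cong (φ (f x) +_) (∑-map f xs φ)

  ∑-0 : ∀ (xs : List X) {φ : X → Scalar} → (∀ {x} → x ∈ xs → φ x ≈ 0#) → ∑ xs φ ≈ 0#
  ∑-0 []       h = R.refl
  ∑-0 (x ∷ xs) h = trans (+-cong (h (here ≡.refl)) (∑-0 xs (h ∘ there))) (+-identityˡ 0#)

  ∑-+ : ∀ (xs : List X) φ ψ → ∑[ x ∈ xs ] (φ x + ψ x) ≈ ∑ xs φ + ∑ xs ψ
  ∑-+ []       φ ψ = sym (+-identityˡ 0#)
  ∑-+ (x ∷ xs) φ ψ = trans (+-congˡ (∑-+ xs φ ψ)) (+.interchange (φ x) (ψ x) _ _)

  ∑-*ˡ : ∀ s (xs : List X) φ → ∑[ x ∈ xs ] (s * φ x) ≈ s * ∑ xs φ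
  ∑-*ˡ s []       φ = sym (zeroʳ s)
  ∑-*ˡ s (x ∷ xs) φ = trans (+-congˡ (∑-*ˡ s xs φ)) (sym (distribˡ s _ _))

  ∑-*ʳ : ∀ s (xs : List X) φ → ∑[ x ∈ xs ] (φ x * s) ≈ ∑ xs φ * s
  ∑-*ʳ s xs φ = trans (∑-cong xs (λ x → *-comm (φ x) s)) (trans (∑-*ˡ s xs φ) (*-comm s _))

  ∑-*-∑ : ∀ (xs : List X) (ys : List Y) φ ψ → ∑[ x ∈ xs ] ∑[ y ∈ ys ] (φ x * ψ y) ≈ ∑ xs φ * ∑ ys ψ
  ∑-*-∑ xs ys φ ψ = trans (∑-cong xs (λ x → ∑-*ˡ (φ x) ys ψ)) (∑-*ʳ (∑ ys ψ) xs φ)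

  ∑-swap : ∀ (xs : List X) (ys : List Y) (φ : X → Y → Scalar) →
      ∑[ x ∈ xs ] ∑[ y ∈ ys ] φ x y ≈ ∑[ y ∈ ys ] ∑[ x ∈ xs ] φ x y
  ∑-swap []       ys φ = sym (∑-0 ys (λ _ → R.refl))
  ∑-swap (x ∷ xs) ys φ = trans (+-congˡ (∑-swap xs ys φ)) (sym (∑-+ ys (φ x) _))

  ∑-cartesianProduct : ∀ (xs : List X) (ys : List Y) (φ : X × Y → Scalar) →
                       ∑ (cartesianProduct xs ys) φ ≈ ∑[ x ∈ xs ] ∑[ y ∈ ys ] φ (x , y)
  ∑-cartesianProduct []       ys φ = R.refl
  ∑-cartesianProduct (x ∷ xs) ys φ = trans (∑-++ (map (x ,_) ys) _ φ)
    (+-cong (reflexive (∑-map (x ,_) ys φ)) (∑-cartesianProduct xs ys φ))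

  ∑-splits : ∀ n (xs : List X) φ → (∀ p q → length p ≢ n → φ (p , q) ≈ 0#) →
             ∑ (splits xs) φ ≈ φ (take n xs , drop n xs)
  ∑-splits zero    []       φ h = +-identityʳ _
  ∑-splits (suc n) []       φ h = +-identityʳ _
  ∑-splits zero    (x ∷ xs) φ h = trans (+-congˡ (trans (reflexive (∑-map _ (splits xs) φ))
    (∑-0 (splits xs) (λ {(p , q)} _ → h (x ∷ p) q (λ ()))))) (+-identityʳ _)
  ∑-splits (suc n) (x ∷ xs) φ h =
      trans (+-cong (h [] (x ∷ xs) (λ ())) (trans (reflexive (∑-map _ (splits xs) φ))
    (∑-splits n xs _ (λ p q p≢n → h (x ∷ p) q (p≢n ∘ ℕ.suc-injective))))) (+-identityˡ _)

  ∑-splits-last : ∀ (xs : List X) φ → (∀ p x q → φ (p , x ∷ q) ≈ 0#) → ∑ (splits xs) φ ≈ φ (xs , [])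
  ∑-splits-last []       φ h = +-identityʳ _
  ∑-splits-last (x ∷ xs) φ h = trans (+-cong (h [] x xs) (trans (reflexive (∑-map _ (splits xs) φ))
    (∑-splits-last xs _ (λ p → h (x ∷ p))))) (+-identityˡ _)

  -- Coassociativity of deconcatenation: both sides sum over the cuts into three parts, and the
  -- induction separates the cuts whose first part is empty.
  ∑-splits-assoc : ∀ (xs : List X) (φ : List X → List X → List X → Scalar) →
    ∑[ (p , q) ∈ splits xs ] ∑[ (p₁ , p₂) ∈ splits p ] φ p₁ p₂ q ≈
    ∑[ (p , q) ∈ splits xs ] ∑[ (q₁ , q₂) ∈ splits q ] φ p q₁ q₂
  ∑-splits-assoc []       φ = R.refl
  ∑-splits-assoc (x ∷ xs) φ = begin
    φ [] [] (x ∷ xs) + 0# + ∑ (map _ (splits xs)) _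
      ≈⟨ +-cong (+-identityʳ _) (trans (reflexive (∑-map _ (splits xs) _)) (trans
           (∑-cong (splits xs) (λ (p , q) → +-congˡ (reflexive (∑-map _ (splits p) _))))
           (∑-+ (splits xs) _ _))) ⟩
    φ [] [] (x ∷ xs) + (∑[ (p , q) ∈ splits xs ] φ [] (x ∷ p) q
      + ∑[ (p , q) ∈ splits xs ] ∑[ (p₁ , p₂) ∈ splits p ] φ (x ∷ p₁) p₂ q)
      ≈⟨ sym (+-assoc _ _ _) ⟩
    φ [] [] (x ∷ xs) + ∑[ (p , q) ∈ splits xs ] φ [] (x ∷ p) q
      + ∑[ (p , q) ∈ splits xs ] ∑[ (p₁ , p₂) ∈ splits p ] φ (x ∷ p₁) p₂ q
      ≈⟨ +-cong (+-congˡ (reflexive (≡.sym (∑-map _ (splits xs) _))))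
           (trans (∑-splits-assoc xs (λ p → φ (x ∷ p))) (reflexive (≡.sym (∑-map _ (splits xs) _)))) ⟩
    ∑ (splits (x ∷ xs)) (λ (q₁ , q₂) → φ [] q₁ q₂)
      + ∑ (map _ (splits xs)) (λ (p , q) → ∑ (splits q) (λ (q₁ , q₂) → φ p q₁ q₂)) ∎

  module _ (ℓ : ℕ) where
    open Colored ℓ using (shuffles)

    ∑-shuffles-∷ : ∀ x xs y ys (φ : List X → Scalar) →
      ∑ (shuffles (x ∷ xs) (y ∷ ys)) φ ≈
      ∑ (shuffles xs (y ∷ ys)) (φ ∘ (x ∷_)) + ∑ (shuffles (x ∷ xs) ys) (φ ∘ (y ∷_))
    ∑-shuffles-∷ x xs y ys φ = trans (∑-++ (map (x ∷_) (shuffles xs (y ∷ ys))) _ φ)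
      (reflexive (cong₂ _+_ (∑-map (x ∷_) (shuffles xs (y ∷ ys)) φ) (∑-map (y ∷_) (shuffles (x ∷ xs) ys) φ)))

    ∑-shuffles-[]ʳ : ∀ xs (φ : List X → Scalar) → ∑ (shuffles xs []) φ ≈ φ xs
    ∑-shuffles-[]ʳ xs φ rewrite shuffles-[]ʳ ℓ xs = +-identityʳ _

    -- The two enumerations list the triple shuffles in different orders, so associativity is stated
    -- for sums. The induction sorts the shuffles by whether they begin with `x`, `y` or `z`.
    ∑-shuffles-assoc : ∀ xs ys zs (φ : List X → Scalar) →
      ∑[ s ∈ shuffles xs ys ] ∑ (shuffles s zs) φ ≈ ∑[ s ∈ shuffles ys zs ] ∑ (shuffles xs s) φ
    ∑-shuffles-assoc [] ys zs φ = trans (+-identityʳ _) (∑-cong (shuffles ys zs) (λ s → sym (+-identityʳ _)))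
    ∑-shuffles-assoc (x ∷ xs) [] zs φ = R.refl
    ∑-shuffles-assoc (x ∷ xs) (y ∷ ys) [] φ = trans
      (∑-cong (shuffles (x ∷ xs) (y ∷ ys)) (λ s → ∑-shuffles-[]ʳ s φ)) (sym (+-identityʳ _))
    ∑-shuffles-assoc (x ∷ xs) (y ∷ ys) (z ∷ zs) φ = begin
      ∑[ s ∈ shuffles (x ∷ xs) (y ∷ ys) ] ∑ (shuffles s (z ∷ zs)) φ
        ≈⟨ ∑-shuffles-∷ x xs y ys _ ⟩
      ∑[ s ∈ xs:y ] ∑ (shuffles (x ∷ s) (z ∷ zs)) φ + ∑[ s ∈ x:ys ] ∑ (shuffles (y ∷ s) (z ∷ zs)) φ
        ≈⟨ +-cong (split x xs:y) (split y x:ys) ⟩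
      (∑[ s ∈ xs:y ] ∑ (shuffles s (z ∷ zs)) (φ ∘ (x ∷_)) + ∑[ s ∈ xs:y ] ∑ (shuffles (x ∷ s) zs) (φ ∘ (z ∷_)))
        + (∑[ s ∈ x:ys ] ∑ (shuffles s (z ∷ zs)) (φ ∘ (y ∷_))
            + ∑[ s ∈ x:ys ] ∑ (shuffles (y ∷ s) zs) (φ ∘ (z ∷_)))
        ≈⟨ +.interchange _ _ _ _ ⟩
      (∑[ s ∈ xs:y ] ∑ (shuffles s (z ∷ zs)) (φ ∘ (x ∷_)) + ∑[ s ∈ x:ys ] ∑ (shuffles s (z ∷ zs)) (φ ∘ (y ∷_)))
        + (∑[ s ∈ xs:y ] ∑ (shuffles (x ∷ s) zs) (φ ∘ (z ∷_))
            + ∑[ s ∈ x:ys ] ∑ (shuffles (y ∷ s) zs) (φ ∘ (z ∷_)))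
        ≈⟨ +-cong (+-cong (∑-shuffles-assoc xs (y ∷ ys) (z ∷ zs) _) (∑-shuffles-assoc (x ∷ xs) ys (z ∷ zs) _))
             (trans (sym (∑-shuffles-∷ x xs y ys _)) (∑-shuffles-assoc (x ∷ xs) (y ∷ ys) zs _)) ⟩
      (∑[ s ∈ shuffles (y ∷ ys) (z ∷ zs) ] ∑ (shuffles xs s) (φ ∘ (x ∷_))
        + ∑[ s ∈ y:z ] ∑ (shuffles (x ∷ xs) s) (φ ∘ (y ∷_))) + ∑[ s ∈ yz: ] ∑ (shuffles (x ∷ xs) s) (φ ∘ (z ∷_))
        ≈⟨ +-congʳ (+-congʳ (∑-shuffles-∷ y ys z zs _)) ⟩
      ((∑[ s ∈ y:z ] ∑ (shuffles xs (y ∷ s)) (φ ∘ (x ∷_)) + ∑[ s ∈ yz: ] ∑ (shuffles xs (z ∷ s)) (φ ∘ (x ∷_)))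
        + ∑[ s ∈ y:z ] ∑ (shuffles (x ∷ xs) s) (φ ∘ (y ∷_))) + ∑[ s ∈ yz: ] ∑ (shuffles (x ∷ xs) s) (φ ∘ (z ∷_))
        ≈⟨ +-congʳ (+.xy∙z≈xz∙y _ _ _) ⟩
      ((∑[ s ∈ y:z ] ∑ (shuffles xs (y ∷ s)) (φ ∘ (x ∷_)) + ∑[ s ∈ y:z ] ∑ (shuffles (x ∷ xs) s) (φ ∘ (y ∷_)))
        + ∑[ s ∈ yz: ] ∑ (shuffles xs (z ∷ s)) (φ ∘ (x ∷_))) + ∑[ s ∈ yz: ] ∑ (shuffles (x ∷ xs) s) (φ ∘ (z ∷_))
        ≈⟨ +-assoc _ _ _ ⟩
      (∑[ s ∈ y:z ] ∑ (shuffles xs (y ∷ s)) (φ ∘ (x ∷_)) + ∑[ s ∈ y:z ] ∑ (shuffles (x ∷ xs) s) (φ ∘ (y ∷_)))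
        + (∑[ s ∈ yz: ] ∑ (shuffles xs (z ∷ s)) (φ ∘ (x ∷_))
            + ∑[ s ∈ yz: ] ∑ (shuffles (x ∷ xs) s) (φ ∘ (z ∷_)))
        ≈⟨ +-cong (join y y:z) (join z yz:) ⟩
      ∑[ s ∈ y:z ] ∑ (shuffles (x ∷ xs) (y ∷ s)) φ + ∑[ s ∈ yz: ] ∑ (shuffles (x ∷ xs) (z ∷ s)) φ
        ≈⟨ ∑-shuffles-∷ y ys z zs _ ⟨
      ∑[ s ∈ shuffles (y ∷ ys) (z ∷ zs) ] ∑ (shuffles (x ∷ xs) s) φ ∎
      where
      xs:y = shuffles xs (y ∷ ys)
      x:ys = shuffles (x ∷ xs) ys
      y:z  = shuffles ys (z ∷ zs)
      yz:  = shuffles (y ∷ ys) zs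
      split : ∀ w L → ∑[ s ∈ L ] ∑ (shuffles (w ∷ s) (z ∷ zs)) φ ≈
        ∑[ s ∈ L ] ∑ (shuffles s (z ∷ zs)) (φ ∘ (w ∷_)) + ∑[ s ∈ L ] ∑ (shuffles (w ∷ s) zs) (φ ∘ (z ∷_))
      split w L = trans (∑-cong L (λ s → ∑-shuffles-∷ w s z zs φ)) (∑-+ L _ _)
      join : ∀ w L → ∑[ s ∈ L ] ∑ (shuffles xs (w ∷ s)) (φ ∘ (x ∷_))
          + ∑[ s ∈ L ] ∑ (shuffles (x ∷ xs) s) (φ ∘ (w ∷_))
        ≈ ∑[ s ∈ L ] ∑ (shuffles (x ∷ xs) (w ∷ s)) φ
      join w L = trans (sym (∑-+ L _ _)) (∑-cong L (λ s → sym (∑-shuffles-∷ x xs w s φ)))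

    -- Shuffle product and deconcatenation form a bialgebra.
    ∑-splits-shuffles : ∀ xs ys (φ : List X → List X → Scalar) →
      ∑[ s ∈ shuffles xs ys ] ∑[ (s₁ , s₂) ∈ splits s ] φ s₁ s₂ ≈
      ∑[ (x₁ , x₂) ∈ splits xs ] ∑[ (y₁ , y₂) ∈ splits ys ]
        ∑[ s₁ ∈ shuffles x₁ y₁ ] ∑[ s₂ ∈ shuffles x₂ y₂ ] φ s₁ s₂
    ∑-splits-shuffles [] ys φ = +-congʳ (∑-cong (splits ys) (λ _ → sym (trans (+-identityʳ _) (+-identityʳ _))))
    ∑-splits-shuffles (x ∷ xs) [] φ = trans (+-identityʳ _) (∑-cong (splits (x ∷ xs)) (λ (x₁ , x₂) →
      sym (trans (+-identityʳ _) (trans (∑-shuffles-[]ʳ x₁ _) (∑-shuffles-[]ʳ x₂ _)))))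
    ∑-splits-shuffles {X = X} (x ∷ xs) (y ∷ ys) φ = begin
      ∑[ s ∈ shuffles (x ∷ xs) (y ∷ ys) ] ∑[ (s₁ , s₂) ∈ splits s ] φ s₁ s₂
        ≈⟨ ∑-shuffles-∷ x xs y ys _ ⟩
      ∑[ s ∈ xs:y ] ∑[ (s₁ , s₂) ∈ splits (x ∷ s) ] φ s₁ s₂
          + ∑[ s ∈ x:ys ] ∑[ (s₁ , s₂) ∈ splits (y ∷ s) ] φ s₁ s₂
        ≈⟨ +-cong (split x xs:y) (split y x:ys) ⟩
      (∑[ s ∈ xs:y ] φ [] (x ∷ s) + ∑[ s ∈ xs:y ] ∑[ (s₁ , s₂) ∈ splits s ] φ (x ∷ s₁) s₂)
        + (∑[ s ∈ x:ys ] φ [] (y ∷ s) + ∑[ s ∈ x:ys ] ∑[ (s₁ , s₂) ∈ splits s ] φ (y ∷ s₁) s₂)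
        ≈⟨ +.interchange _ _ _ _ ⟩
      (∑[ s ∈ xs:y ] φ [] (x ∷ s) + ∑[ s ∈ x:ys ] φ [] (y ∷ s))
        + (∑[ s ∈ xs:y ] ∑[ (s₁ , s₂) ∈ splits s ] φ (x ∷ s₁) s₂
            + ∑[ s ∈ x:ys ] ∑[ (s₁ , s₂) ∈ splits s ] φ (y ∷ s₁) s₂)
        ≈⟨ +-cong (sym (∑-shuffles-∷ x xs y ys (φ [])))
             (+-cong (trans (∑-splits-shuffles xs (y ∷ ys) _) expand-y)
               (trans (∑-splits-shuffles (x ∷ xs) ys _) expand-x)) ⟩
      P + ((Q + S) + (T + U))
        ≈⟨ +-congˡ (trans (+.xy∙z≈y∙xz Q S (T + U))
          (trans (+-congˡ (+.x∙yz≈y∙xz Q T U)) (+.x∙yz≈y∙xz S T (Q + U)))) ⟩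
      P + (T + (S + (Q + U)))
        ≈⟨ +-congˡ (+-congˡ (+.x∙yz≈y∙xz S Q U)) ⟩
      P + (T + (Q + (S + U)))
        ≈⟨ sym (+-assoc P T _) ⟩
      (P + T) + (Q + (S + U))
        ≈⟨ +-cong (sym collect-[]) (sym collect-∷) ⟩
      ∑[ (y₁ , y₂) ∈ splits (y ∷ ys) ] F [] (x ∷ xs) y₁ y₂ φ
        + ∑[ (x₁ , x₂) ∈ splits xs ] ∑[ (y₁ , y₂) ∈ splits (y ∷ ys) ] F (x ∷ x₁) x₂ y₁ y₂ φ
        ≈⟨ +-congˡ (reflexive (≡.sym (∑-map _ (splits xs) _))) ⟩
      ∑[ (x₁ , x₂) ∈ splits (x ∷ xs) ] ∑[ (y₁ , y₂) ∈ splits (y ∷ ys) ] F x₁ x₂ y₁ y₂ φ ∎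
      where
      xs:y = shuffles xs (y ∷ ys)
      x:ys = shuffles (x ∷ xs) ys
      F : (x₁ x₂ y₁ y₂ : List X) → (List X → List X → Scalar) → Scalar
      F x₁ x₂ y₁ y₂ φ = ∑[ s₁ ∈ shuffles x₁ y₁ ] ∑[ s₂ ∈ shuffles x₂ y₂ ] φ s₁ s₂
      φx = λ s → φ (x ∷ s)
      φy = λ s → φ (y ∷ s)
      -- The five sums sort the cut shuffles by their first part: empty in `P`; beginning with `x`,
      -- without or with `y`, in `Q` and `S`; beginning with `y`, without or with `x`, in `T` and
      -- `U`. The left side groups them by first letter, the right side by whether `x` lies in the
      -- first part.
      P = ∑ (shuffles (x ∷ xs) (y ∷ ys)) (φ [])
      Q = ∑[ (x₁ , x₂) ∈ splits xs ] ∑[ s ∈ shuffles x₂ (y ∷ ys) ] φx x₁ s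
      S = ∑[ (x₁ , x₂) ∈ splits xs ] ∑[ (y₁ , y₂) ∈ splits ys ] F x₁ x₂ (y ∷ y₁) y₂ φx
      T = ∑[ (y₁ , y₂) ∈ splits ys ] ∑[ s ∈ shuffles (x ∷ xs) y₂ ] φy y₁ s
      U = ∑[ (x₁ , x₂) ∈ splits xs ] ∑[ (y₁ , y₂) ∈ splits ys ] F (x ∷ x₁) x₂ y₁ y₂ φy

      split : ∀ w L → ∑[ s ∈ L ] ∑[ (s₁ , s₂) ∈ splits (w ∷ s) ] φ s₁ s₂ ≈
        ∑[ s ∈ L ] φ [] (w ∷ s) + ∑[ s ∈ L ] ∑[ (s₁ , s₂) ∈ splits s ] φ (w ∷ s₁) s₂
      split w L = trans (∑-cong L (λ s → +-congˡ (reflexive (∑-map _ (splits s) _)))) (∑-+ L _ _)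

      expand-y : ∑[ (x₁ , x₂) ∈ splits xs ] ∑[ (y₁ , y₂) ∈ splits (y ∷ ys) ] F x₁ x₂ y₁ y₂ φx ≈ Q + S
      expand-y = trans (∑-cong (splits xs) (λ (x₁ , x₂) →
        +-cong (∑-shuffles-[]ʳ x₁ _) (reflexive (∑-map _ (splits ys) _)))) (∑-+ (splits xs) _ _)

      expand-x : ∑[ (x₁ , x₂) ∈ splits (x ∷ xs) ] ∑[ (y₁ , y₂) ∈ splits ys ] F x₁ x₂ y₁ y₂ φy ≈ T + U
      expand-x = +-cong (∑-cong (splits ys) (λ _ → +-identityʳ _)) (reflexive (∑-map _ (splits xs) _))

      collect-[] : ∑[ (y₁ , y₂) ∈ splits (y ∷ ys) ] F [] (x ∷ xs) y₁ y₂ φ ≈ P + T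
      collect-[] = +-cong (+-identityʳ _) (trans (reflexive (∑-map _ (splits ys) _))
        (∑-cong (splits ys) (λ _ → +-identityʳ _)))

      collect-∷ : ∑[ (x₁ , x₂) ∈ splits xs ] ∑[ (y₁ , y₂) ∈ splits (y ∷ ys) ] F (x ∷ x₁) x₂ y₁ y₂ φ
          ≈ Q + (S + U)
      collect-∷ = trans (∑-cong (splits xs) (λ (x₁ , x₂) → +-cong (+-identityʳ _)
          (trans (reflexive (∑-map _ (splits ys) _)) (trans
            (∑-cong (splits ys) (λ (y₁ , y₂) → ∑-shuffles-∷ x x₁ y y₁ _)) (∑-+ (splits ys) _ _)))))
        (trans (∑-+ (splits xs) _ _) (+-congˡ (∑-+ (splits xs) _ _)))

-- Free modules through coefficients and linear functionals.

module LinearAlgebra {c r} (R : CommutativeRing c r) where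
  open CommutativeRing R hiding (refl) renaming (Carrier to Scalar)
  open FreeModule R
  open Sums R
  open import Relation.Binary.Reasoning.Setoid setoid
  open RingProperties ring using (-1*x≈-x)
  private
    module R = CommutativeRing R
    module + = CommutativeSemigroupProperties (CommutativeRing.+-commutativeSemigroup R)
    module * = CommutativeSemigroupProperties (CommutativeRing.*-commutativeSemigroup R)

  χ : Dec X → Scalar
  χ P? = if does P? then 1# else 0#

  χ-⇔ : ∀ {P : Set α} {Q : Set β} {P? : Dec P} {Q? : Dec Q} → (P → Q) → (Q → P) → χ P? ≡ χ Q?
  χ-⇔ {P? = P?} {Q?} f g = cong (if_then 1# else 0#) (does-⇔ (mk⇔ f g) P? Q?)

  χ-no : ∀ {P : Set α} {P? : Dec P} → ¬ P → χ P? ≈ 0#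
  χ-no {P? = P?} ¬p = reflexive (cong (if_then 1# else 0#) (dec-false P? ¬p))

  χ-× : ∀ {P : Set α} {Q : Set β} (P? : Dec P) (Q? : Dec Q) → χ (P? ×-dec Q?) ≈ χ P? * χ Q?
  χ-× P? Q? with does P?
  ... | true  = sym (*-identityˡ _)
  ... | false = sym (zeroˡ _)

  δ : ∀ B → Index B → Index B → Scalar
  δ B b b′ = χ (GradedBasis._≟_ B b b′)

  δ-⊗ : ∀ B B′ b b′ c c′ → δ (B ⊗ᵇ B′) (b , b′) (c , c′) ≈ δ B b c * δ B′ b′ c′
  δ-⊗ B B′ b b′ c c′ = trans
    (reflexive (χ-⇔ {P? = GradedBasis._≟_ (B ⊗ᵇ B′) (b , b′) (c , c′)}
                    {GradedBasis._≟_ B b c ×-dec GradedBasis._≟_ B′ b′ c′} ,-injective ×-≡,≡→≡))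
    (χ-× (GradedBasis._≟_ B b c) (GradedBasis._≟_ B′ b′ c′))

  -- Passes between a sum of indicators and membership. The decision `y∈?` is arbitrary, so that
  -- each use may supply its own.
  ∑-χ-unique : ∀ {xs : List X} (_≟_ : ∀ x y → Dec (x ≡ y)) y → Unique xs → (y∈? : Dec (y ∈ xs)) →
               ∑[ x ∈ xs ] χ (x ≟ y) ≈ χ y∈?
  ∑-χ-unique {xs = []} _≟_ y [] y∈? = sym (χ-no {P? = y∈?} (λ ()))
  ∑-χ-unique {xs = x ∷ xs} _≟_ y (x∉ ∷ xs!) y∈? with x ≟ y
  ... | yes refl = trans (+-congˡ (∑-0 xs (λ {z} z∈ → χ-no {P? = z ≟ y} (All.lookup x∉ z∈ ∘ ≡.sym))))
    (trans (+-identityʳ 1#) (reflexive (cong (if_then 1# else 0#) (≡.sym (dec-true y∈? (here refl))))))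
  ... | no x≢y = trans (+-identityˡ _) (trans (∑-χ-unique _≟_ y xs! y∈xs?)
    (reflexive (χ-⇔ {P? = y∈xs?} {y∈?} there λ { (here y≡x) → ⊥-elim (x≢y (≡.sym y≡x)) ; (there y∈) → y∈ })))
    where y∈xs? = any? (λ z → y ≟ z) xs

  -- The linear functional with values `φ` on the basis. It is computed from the terms; `eval-cong`
  -- shows that it depends on the coefficients only.
  eval : ∀ {B} → (Index B → Scalar) → Free B → Scalar
  eval φ x = ∑[ (s , b) ∈ terms x ] (s * φ b)

  module _ {B : GradedBasis} where
    open GradedBasis B using (_≟_)

    eval-δ : ∀ (x : Free B) b → coefficient x b ≈ eval (λ b′ → δ B b′ b) x
    eval-δ ⟦ [] ⟧           b = R.refl
    eval-δ ⟦ (s , b′) ∷ x ⟧ b = +-cong (scale (does (b′ ≟ b))) (eval-δ ⟦ x ⟧ b)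
      where
      scale : ∀ β → (if β then s else 0#) ≈ s * (if β then 1# else 0#)
      scale true  = sym (*-identityʳ s)
      scale false = sym (zeroʳ s)

    eval-congˡ : ∀ {φ ψ} → (∀ b → φ b ≈ ψ b) → (x : Free B) → eval φ x ≈ eval ψ x
    eval-congˡ h x = ∑-cong (terms x) (λ (s , b) → *-congˡ (h b))

    eval-+ : ∀ φ (x y : Free B) → eval φ (x +ᴹ y) ≈ eval φ x + eval φ y
    eval-+ φ x y = ∑-++ (terms x) (terms y) _

    eval-*ₗ : ∀ φ s (x : Free B) → eval φ (s *ₗ x) ≈ s * eval φ x
    eval-*ₗ φ s x = trans (reflexive (∑-map _ (terms x) _))
      (trans (∑-cong (terms x) (λ (t , b) → *-assoc s t _)) (∑-*ˡ s (terms x) _))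

    eval-⟨⟩ : ∀ φ b → eval {B} φ ⟨ b ⟩ ≈ φ b
    eval-⟨⟩ φ b = trans (+-identityʳ _) (*-identityˡ _)

    eval-∑⟨⟩ : ∀ φ bs → eval {B} φ ∑⟨ bs ⟩ ≈ ∑ bs φ
    eval-∑⟨⟩ φ bs = trans (reflexive (∑-map _ bs _)) (∑-cong bs (λ b → *-identityˡ _))

    eval-scale : ∀ s φ (x : Free B) → eval (λ b → s * φ b) x ≈ s * eval φ x
    eval-scale s φ x = trans (∑-cong (terms x) (λ (t , b) → *.x∙yz≈y∙xz t s (φ b))) (∑-*ˡ s (terms x) _)

    eval-scaleʳ : ∀ s φ (x : Free B) → eval (λ b → φ b * s) x ≈ eval φ x * s
    eval-scaleʳ s φ x = trans (eval-congˡ (λ b → *-comm (φ b) s) x) (trans (eval-scale s φ x) (*-comm s _))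

    eval-add : ∀ φ ψ (x : Free B) → eval (λ b → φ b + ψ b) x ≈ eval φ x + eval ψ x
    eval-add φ ψ x = trans (∑-cong (terms x) (λ (s , b) → distribˡ s _ _)) (∑-+ (terms x) _ _)

    eval-∑ : ∀ (xs : List X) (φ : X → Index B → Scalar) (x : Free B) →
             eval (λ b → ∑[ a ∈ xs ] φ a b) x ≈ ∑[ a ∈ xs ] eval (φ a) x
    eval-∑ xs φ x = trans (∑-cong (terms x) (λ (s , b) → sym (∑-*ˡ s xs _))) (∑-swap (terms x) xs _)

    without : Index B → Free B → Free B
    without b x = ⟦ filter (λ (_ , b′) → ¬? (b′ ≟ b)) (terms x) ⟧

    eval-without : ∀ φ b (x : Free B) → eval φ x ≈ coefficient x b * φ b + eval φ (without b x)
    eval-without φ b ⟦ [] ⟧ = sym (trans (+-identityʳ _) (zeroˡ _))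
    eval-without φ b ⟦ (s , b′) ∷ x ⟧ with b′ ≟ b
    ... | yes refl = trans (+-congˡ (eval-without φ b ⟦ x ⟧))
        (trans (sym (+-assoc _ _ _)) (+-congʳ (sym (distribʳ _ s _))))
    ... | no  _    = trans (+-congˡ (eval-without φ b ⟦ x ⟧)) (trans (+.x∙yz≈y∙xz _ _ _)
                       (+-congʳ (*-congʳ (sym (+-identityˡ _)))))

    -- A basis element may occur in several terms that cancel, so the sum is not zero term by term.
    -- All occurrences of the first basis element are collected into its coefficient, and the
    -- induction is on the number of terms left. The disjunction serves comparison of two elements
    -- and of two functionals alike.
    eval-vanish : ∀ φ (x : Free B) → (∀ b → coefficient x b ≈ 0# ⊎ φ b ≈ 0#) → eval φ x ≈ 0#
    eval-vanish φ x = go (length (terms x)) x ℕ.≤-refl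
      where
      go : ∀ n (x : Free B) → length (terms x) ≤ n → (∀ b → coefficient x b ≈ 0# ⊎ φ b ≈ 0#) → eval φ x ≈ 0#
      go n       ⟦ [] ⟧           _  _ = R.refl
      go (suc n) ⟦ (s , b) ∷ ts ⟧ le h = begin
        eval φ x⁺                                    ≈⟨ eval-without φ b x⁺ ⟩
        coefficient x⁺ b * φ b + eval φ (without b x⁺) ≈⟨ +-cong
          ([ (λ e → trans (*-congʳ e) (zeroˡ _)) , (λ e → trans (*-congˡ e) (zeroʳ _)) ]′ (h b))
          -- The leading term is itself removed, so the remaining list is strictly shorter.
          (go n (without b x⁺) (ℕ.≤-trans (ℕ.≤-reflexive (cong length drop-b))
            (ℕ.≤-trans (List.length-filter _ ts) (s≤s⁻¹ le))) h′) ⟩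
        0# + 0# ≈⟨ +-identityˡ 0# ⟩
        0# ∎
        where
        x⁺ : Free B
        x⁺ = ⟦ (s , b) ∷ ts ⟧
        drop-b : terms (without b x⁺) ≡ terms (without b ⟦ ts ⟧)
        drop-b = List.filter-reject (λ (_ , b′) → ¬? (b′ ≟ b)) {xs = ts} (λ b≢b → b≢b refl)
        h′ : ∀ b′ → coefficient (without b x⁺) b′ ≈ 0# ⊎ φ b′ ≈ 0#
        h′ b′ = [ (λ e → inj₁ (vanishes b′ (b ≟ b′) e)) , inj₂ ]′ (h b′)
          where
          vanishes : ∀ b′ → Dec (b ≡ b′) → coefficient x⁺ b′ ≈ 0# → coefficient (without b x⁺) b′ ≈ 0#
          vanishes b′ (no b≢b′) e = begin
            coefficient (without b x⁺) b′ ≈⟨ +-identityˡ _ ⟨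
            0# + coefficient (without b x⁺) b′
              ≈⟨ +-cong (sym (trans (*-congˡ (χ-no {P? = b ≟ b′} b≢b′)) (zeroʳ _))) (eval-δ (without b x⁺) b′) ⟩
            coefficient x⁺ b * δ B b b′ + eval _ (without b x⁺) ≈⟨ eval-without (λ b″ → δ B b″ b′) b x⁺ ⟨
            eval _ x⁺ ≈⟨ eval-δ x⁺ b′ ⟨
            coefficient x⁺ b′ ≈⟨ e ⟩
            0# ∎
          vanishes b (yes refl) e = begin
            coefficient (without b x⁺) b ≈⟨ eval-δ (without b x⁺) b ⟩
            eval _ (without b x⁺) ≈⟨ ∑-0 (terms (without b x⁺)) (λ {(t , b′)} m →
               trans (*-congˡ (χ-no {P? = b′ ≟ b}
                 (proj₂ (∈.∈-filter⁻ (λ (_ , b″) → ¬? (b″ ≟ b)) {xs = terms x⁺} m)))) (zeroʳ t)) ⟩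
            0# ∎

    -- Apply `eval-vanish` to the functional `φ - ψ`.
    eval-cong-on : ∀ {φ ψ} (x : Free B) → (∀ b → coefficient x b ≈ 0# ⊎ φ b ≈ ψ b) → eval φ x ≈ eval ψ x
    eval-cong-on {φ} {ψ} x h = begin
      eval φ x                          ≈⟨ +-identityʳ _ ⟨
      eval φ x + 0#                     ≈⟨ +-congˡ (-‿inverseˡ (eval ψ x)) ⟨
      eval φ x + (- eval ψ x + eval ψ x) ≈⟨ +-assoc _ _ _ ⟨
      eval φ x + - eval ψ x + eval ψ x ≈⟨ +-congʳ (+-congˡ (trans (eval-scale (- 1#) ψ x) (-1*x≈-x _))) ⟨
      eval φ x + eval (λ b → - 1# * ψ b) x + eval ψ x ≈⟨ +-congʳ (eval-add φ _ x) ⟨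
      eval (λ b → φ b + - 1# * ψ b) x + eval ψ x ≈⟨ +-congʳ (eval-vanish _ x (λ b →
        [ inj₁ , (λ e → inj₂ (trans (+-cong e (-1*x≈-x _)) (-‿inverseʳ _))) ]′ (h b))) ⟩
      0# + eval ψ x                     ≈⟨ +-identityˡ _ ⟩
      eval ψ x ∎

    -- The coefficients of `x - y` all vanish, so `eval-vanish` applies to it.
    eval-cong : ∀ φ {x y : Free B} → x ≈ᴹ y → eval φ x ≈ eval φ y
    eval-cong φ {x} {y} x≈y = begin
      eval φ x                              ≈⟨ +-identityʳ _ ⟨
      eval φ x + 0#                         ≈⟨ +-congˡ (-‿inverseˡ (eval φ y)) ⟨
      eval φ x + (- eval φ y + eval φ y)    ≈⟨ +-assoc _ _ _ ⟨
      eval φ x + - eval φ y + eval φ y      ≈⟨ +-congʳ (+-congˡ (trans (eval-*ₗ φ (- 1#) y) (-1*x≈-x _))) ⟨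
      eval φ x + eval φ (-ᴹ y) + eval φ y   ≈⟨ +-congʳ (eval-+ φ x (-ᴹ y)) ⟨
      eval φ (x +ᴹ -ᴹ y) + eval φ y         ≈⟨ +-congʳ (eval-vanish φ (x +ᴹ -ᴹ y) (λ b → inj₁ (begin
        coefficient (x +ᴹ -ᴹ y) b           ≈⟨ coefficient-+ x (-ᴹ y) b ⟩
        coefficient x b + coefficient (-ᴹ y) b
          ≈⟨ +-cong (at x≈y b) (trans (coefficient-*ₗ (- 1#) y b) (-1*x≈-x _)) ⟩
        coefficient y b + - coefficient y b ≈⟨ -‿inverseʳ _ ⟩
        0# ∎))) ⟩
      0# + eval φ y                         ≈⟨ +-identityˡ _ ⟩
      eval φ y ∎

    coefficient-⟨⟩ : ∀ b b′ → coefficient {B} ⟨ b ⟩ b′ ≈ δ B b b′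
    coefficient-⟨⟩ b b′ = trans (eval-δ ⟨ b ⟩ b′) (eval-⟨⟩ (λ b″ → δ B b″ b′) b)

    coefficient-∑⟨⟩ : ∀ bs b → coefficient {B} ∑⟨ bs ⟩ b ≈ ∑[ b′ ∈ bs ] δ B b′ b
    coefficient-∑⟨⟩ bs b = trans (eval-δ ∑⟨ bs ⟩ b) (eval-∑⟨⟩ (λ b″ → δ B b″ b) bs)

    eval-∑χ : ∀ (xs : List X) (f : X → Index B) (x : Free B) →
              eval (λ b → ∑[ a ∈ xs ] δ B b (f a)) x ≈ ∑[ a ∈ xs ] coefficient x (f a)
    eval-∑χ xs f x = trans (eval-∑ xs (λ a b → δ B b (f a)) x) (∑-cong xs (λ a → sym (eval-δ x (f a))))

  module _ {B B′ : GradedBasis} where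

    eval-extend : ∀ φ (f : Index B → Free B′) (x : Free B) → eval φ (extend f x) ≈ eval (λ b → eval φ (f b)) x
    eval-extend φ f ⟦ [] ⟧          = R.refl
    eval-extend φ f ⟦ (s , b) ∷ x ⟧ = trans (eval-+ φ (s *ₗ f b) (extend {B} f ⟦ x ⟧))
      (+-cong (eval-*ₗ φ s (f b)) (eval-extend φ f ⟦ x ⟧))

    coefficient-extend : ∀ (f : Index B → Free B′) (x : Free B) b′ →
                         coefficient (extend f x) b′ ≈ eval (λ b → coefficient (f b) b′) x
    coefficient-extend f x b′ = trans (eval-δ (extend f x) b′) (trans (eval-extend (λ c → δ B′ c b′) f x)
      (eval-congˡ (λ b → sym (eval-δ (f b) b′)) x))

    -- When the structure constants of a bilinear map are sums of products of `δ`, its coefficients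
    -- are convolutions of those of the arguments. Both the product and the product on the tensor
    -- square have this form.
    eval₂-∑δ : ∀ (xs : List X) (f : X → Index B) (g : X → Index B′) (x : Free B) (y : Free B′) →
      eval (λ b → eval (λ b′ → ∑[ a ∈ xs ] (δ B b (f a) * δ B′ b′ (g a))) y) x ≈
      ∑[ a ∈ xs ] (coefficient x (f a) * coefficient y (g a))
    eval₂-∑δ xs f g x y = begin
      eval (λ b → eval (λ b′ → ∑[ a ∈ xs ] (δ B b (f a) * δ B′ b′ (g a))) y) x
        ≈⟨ eval-congˡ (λ b → trans (eval-∑ xs (λ a b′ → δ B b (f a) * δ B′ b′ (g a)) y)
             (∑-cong xs (λ a → trans (eval-scale (δ B b (f a)) (λ b′ → δ B′ b′ (g a)) y)
               (*-congˡ (sym (eval-δ y (g a))))))) x ⟩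
      eval (λ b → ∑[ a ∈ xs ] (δ B b (f a) * coefficient y (g a))) x
        ≈⟨ eval-∑ xs (λ a b → δ B b (f a) * coefficient y (g a)) x ⟩
      ∑[ a ∈ xs ] eval (λ b → δ B b (f a) * coefficient y (g a)) x
        ≈⟨ ∑-cong xs (λ a → trans (eval-scaleʳ (coefficient y (g a)) (λ b → δ B b (f a)) x)
             (*-congʳ (sym (eval-δ x (f a))))) ⟩
      ∑[ a ∈ xs ] (coefficient x (f a) * coefficient y (g a)) ∎

  module _ {B B′ : GradedBasis} where

    eval-⊗ : ∀ (φ : Index B → Scalar) (ψ : Index B′ → Scalar) (x : Free B) (y : Free B′) →
             eval {B ⊗ᵇ B′} (λ (b , b′) → φ b * ψ b′) (x ⊗ y) ≈ eval φ x * eval ψ y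
    eval-⊗ φ ψ x y = trans (eval-extend {B} {B ⊗ᵇ B′} (λ (b , b′) → φ b * ψ b′)
        (λ b → extend (λ b′ → ⟨ b , b′ ⟩) y) x) (trans
      (eval-congˡ (λ b → trans (eval-extend {B′} {B ⊗ᵇ B′} (λ (b , b′) → φ b * ψ b′) (λ b′ → ⟨ b , b′ ⟩) y)
        (trans
        (eval-congˡ (λ b′ → eval-⟨⟩ {B ⊗ᵇ B′} (λ (b , b′) → φ b * ψ b′) (b , b′)) y) (eval-scale (φ b) ψ y))) x)
      (eval-scaleʳ (eval ψ y) φ x))

    coefficient-⊗ : ∀ (x : Free B) (y : Free B′) b b′ →
                    coefficient {B ⊗ᵇ B′} (x ⊗ y) (b , b′) ≈ coefficient x b * coefficient y b′
    coefficient-⊗ x y b b′ = trans (eval-δ {B ⊗ᵇ B′} (x ⊗ y) (b , b′)) (trans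
      (eval-congˡ {B ⊗ᵇ B′} (λ (c , c′) → δ-⊗ B B′ c c′ b b′) (x ⊗ y))
      (trans (eval-⊗ _ _ x y) (sym (*-cong (eval-δ x b) (eval-δ y b′)))))

  coefficient-⊗ᶠ : ∀ {B B′ C C′} (f : Free B → Free C) (g : Free B′ → Free C′) (x : Free (B ⊗ᵇ B′)) c c′ →
    coefficient {C ⊗ᵇ C′} ((f ⊗ᶠ g) x) (c , c′) ≈ eval {B ⊗ᵇ B′}
        (λ (b , b′) → coefficient (f ⟨ b ⟩) c * coefficient (g ⟨ b′ ⟩) c′) x
  coefficient-⊗ᶠ {B} {B′} {C} {C′} f g x c c′ = trans (coefficient-extend {B ⊗ᵇ B′} {C ⊗ᵇ C′}
      (λ (b , b′) → f ⟨ b ⟩ ⊗ g ⟨ b′ ⟩) x (c , c′))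
    (eval-congˡ {B ⊗ᵇ B′} (λ (b , b′) → coefficient-⊗ (f ⟨ b ⟩) (g ⟨ b′ ⟩) c c′) x)

  coefficient-associator : ∀ {B B′ B″} (x : Free ((B ⊗ᵇ B′) ⊗ᵇ B″)) b b′ b″ →
    coefficient {B ⊗ᵇ (B′ ⊗ᵇ B″)} (associator {B} {B′} {B″} x) (b , (b′ , b″)) ≈ coefficient x ((b , b′) , b″)
  coefficient-associator {B} {B′} {B″} x b b′ b″ = trans (coefficient-extend {(B ⊗ᵇ B′) ⊗ᵇ B″} {B ⊗ᵇ (B′ ⊗ᵇ B″)}
      (λ ((c , c′) , c″) → ⟨ c , (c′ , c″) ⟩) x (b , (b′ , b″))) (trans
    (eval-congˡ {(B ⊗ᵇ B′) ⊗ᵇ B″}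
      (λ ((c , c′) , c″) → trans (coefficient-⟨⟩ {B ⊗ᵇ (B′ ⊗ᵇ B″)} (c , (c′ , c″)) (b , (b′ , b″)))
      (reflexive (χ-⇔ {P? = GradedBasis._≟_ (B ⊗ᵇ (B′ ⊗ᵇ B″)) (c , (c′ , c″)) (b , (b′ , b″))}
                      {GradedBasis._≟_ ((B ⊗ᵇ B′) ⊗ᵇ B″) ((c , c′) , c″) ((b , b′) , b″)}
                      (λ { refl → refl }) (λ { refl → refl })))) x)
    (sym (eval-δ {(B ⊗ᵇ B′) ⊗ᵇ B″} x ((b , b′) , b″))))

  module _ {m₁ m₂ n₁ n₂} (M : Module R m₁ m₂) (N : Module R n₁ n₂) where
    private
      module M = Module M
      module N = Module N
      module N′ = ModuleProperties N

    -- Zero, negatives and the right action in a module homomorphism follow from additivity and left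
    -- homogeneity.
    linear : (L : M.Carrierᴹ → N.Carrierᴹ) →
             (∀ {x y} → x M.≈ᴹ y → L x N.≈ᴹ L y) →
             (∀ x y → L (x M.+ᴹ y) N.≈ᴹ L x N.+ᴹ L y) →
             (∀ s x → L (s M.*ₗ x) N.≈ᴹ s N.*ₗ L x) →
             (IsModuleHomomorphism M.rawModule N.rawModule L)
    linear L L-cong L-+ L-*ₗ = record { isBimoduleHomomorphism = record
      { +ᴹ-isGroupHomomorphism = record
        { isMonoidHomomorphism = record
          { isMagmaHomomorphism = record { isRelHomomorphism = record { cong = L-cong } ; homo = L-+ }
          ; ε-homo = L-0 }
        ; ⁻¹-homo = λ x → N′.inverseʳ-uniqueᴹ (L x) (L (M.-ᴹ x))
            (N.≈ᴹ-trans (N.≈ᴹ-sym (L-+ x (M.-ᴹ x))) (N.≈ᴹ-trans (L-cong (M.-ᴹ‿inverseʳ x)) L-0)) }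
      ; *ₗ-homo = L-*ₗ
      ; *ᵣ-homo = λ s x → N.≈ᴹ-trans (L-cong (M.≈ᴹ-sym (M.*ₗ-*ᵣ-coincident s x)))
          (N.≈ᴹ-trans (L-*ₗ s x) (N.*ₗ-*ᵣ-coincident s (L x))) } }
      where
      L-0 : L M.0ᴹ N.≈ᴹ N.0ᴹ
      L-0 = N.≈ᴹ-trans (L-cong (M.≈ᴹ-sym (M.*ₗ-zeroʳ 0#)))
        (N.≈ᴹ-trans (L-*ₗ 0# M.0ᴹ) (N.*ₗ-zeroˡ (L M.0ᴹ)))

  extend-linear : ∀ {B B′} (f : Index B → Free B′) → IsLinear (free B) (free B′) (extend f)
  extend-linear {B} {B′} f = linear (free B) (free B′) (extend f)
    (λ {x} {y} x≈y → pointwise λ b → trans (coefficient-extend f x b)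
      (trans (eval-cong _ x≈y) (sym (coefficient-extend f y b))))
    (λ x y → pointwise λ b → trans (coefficient-extend f (x +ᴹ y) b) (trans (eval-+ _ x y)
      (trans (sym (+-cong (coefficient-extend f x b) (coefficient-extend f y b)))
        (sym (coefficient-+ (extend f x) (extend f y) b)))))
    (λ s x → pointwise λ b → trans (coefficient-extend f (s *ₗ x) b) (trans (eval-*ₗ _ s x)
      (trans (*-congˡ (sym (coefficient-extend f x b))) (sym (coefficient-*ₗ s (extend f x) b)))))

-- Colored parkization.

parkLetter-↭ : ∀ {v w} → v ↭ w → ∀ x → parkLetter v x ≡ parkLetter w x
parkLetter-↭ v↭w x = cong suc (height-cong (ℕ.pred x) (λ {i} _ → count≤-↭ (suc i) v↭w))

module ColoredParkization (ℓ : ℕ) where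
  open Colored ℓ renaming (_∈_*_ to IsConvolution; _∈?_*_ to isConvolution?)

  open DecMembership _≟ᵇ_ using (_∈?_)

  biword-≡ : ∀ {v w : Biword} → map proj₁ v ≡ map proj₁ w → map proj₂ v ≡ map proj₂ w → v ≡ w
  biword-≡ {[]}    {[]}    _ _ = refl
  biword-≡ {_ ∷ _} {_ ∷ _} p q = cong₂ _∷_ (×-≡,≡→≡ (List.∷-injectiveˡ p , List.∷-injectiveˡ q))
                                            (biword-≡ (List.∷-injectiveʳ p) (List.∷-injectiveʳ q))

  map-proj₁-map₁ : ∀ (f : ℕ → ℕ) (w : Biword) → map proj₁ (map (map₁ f) w) ≡ map f (map proj₁ w)
  map-proj₁-map₁ f w = ≡.trans (≡.sym (List.map-∘ w)) (List.map-∘ w)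

  map-proj₂-map₁ : ∀ (f : ℕ → ℕ) (w : Biword) → map proj₂ (map (map₁ f) w) ≡ map proj₂ w
  map-proj₂-map₁ f w = ≡.sym (List.map-∘ w)

  parkBiword : Biword → Biword
  parkBiword w = map (map₁ (parkLetter (map proj₁ w))) w

  letters-parkBiword : ∀ w → map proj₁ (parkBiword w) ≡ parkMap (map proj₁ w)
  letters-parkBiword w = map-proj₁-map₁ _ w

  colors-parkBiword : ∀ w → map proj₂ (parkBiword w) ≡ map proj₂ w
  colors-parkBiword w = map-proj₂-map₁ _ w

  cpark : Biword → ColoredPF
  cpark w = parkBiword w , [ subst IsParking (≡.sym (letters-parkBiword w)) (parkMap-parking (map proj₁ w)) ]

  cpark-≡ : ∀ {v w} → parkMap (map proj₁ v) ≡ parkMap (map proj₁ w) → map proj₂ v ≡ map proj₂ w →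
      cpark v ≡ cpark w
  cpark-≡ {v} {w} p q = Refinement.value-injective (biword-≡
    (≡.trans (letters-parkBiword v) (≡.trans p (≡.sym (letters-parkBiword w))))
    (≡.trans (colors-parkBiword v) (≡.trans q (≡.sym (colors-parkBiword w)))))

  -- The stored proof is irrelevant; decidability of `IsParking` recovers a usable one.
  word-CountPF : ∀ a → CountPF (word a)
  word-CountPF (w , [ p ]) = IsParking⇒CountPF (recompute (isParking? (map proj₁ w)) p)

  cpark-value : ∀ a → cpark (value a) ≡ a
  cpark-value a = Refinement.value-injective (biword-≡
    (≡.trans (letters-parkBiword (value a)) (parkMap-id (word-CountPF a))) (colors-parkBiword (value a)))

  size-cpark : ∀ w → size (cpark w) ≡ length w
  size-cpark w = List.length-map _ w

  cpark-take : ∀ n w → cpark (take n (parkBiword w)) ≡ cpark (take n w)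
  cpark-take n w = cpark-≡
    (≡.trans (cong parkMap (≡.trans (≡.sym (List.take-map n (parkBiword w)))
      (cong (take n) (letters-parkBiword w))))
      (≡.trans (parkMap-take n (map proj₁ w)) (cong parkMap (List.take-map n w))))
    (≡.trans (≡.sym (List.take-map n (parkBiword w))) (≡.trans (cong (take n) (colors-parkBiword w))
      (List.take-map n w)))

  cpark-drop : ∀ n w → cpark (drop n (parkBiword w)) ≡ cpark (drop n w)
  cpark-drop n w = cpark-≡
    (≡.trans (cong parkMap (≡.trans (≡.sym (List.drop-map n (parkBiword w)))
      (cong (drop n) (letters-parkBiword w))))
      (≡.trans (parkMap-drop n (map proj₁ w)) (cong parkMap (List.drop-map n w))))
    (≡.trans (≡.sym (List.drop-map n (parkBiword w))) (≡.trans (cong (drop n) (colors-parkBiword w))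
      (List.drop-map n w)))

  -- Shifted shuffles

  _↑_ : Biword → ℕ → Biword
  w ↑ k = map (map₁ (k ℕ.+_)) w

  ↑-↑ : ∀ w j k → (w ↑ j) ↑ k ≡ w ↑ (k ℕ.+ j)
  ↑-↑ w j k = ≡.trans (≡.sym (List.map-∘ w))
      (List.map-cong (λ (x , u) → cong (_, u) (≡.sym (ℕ.+-assoc k j x))) w)

  -- `height` never exceeds `length v`; saturation at `N` makes the letters above `N` park just
  -- above `length v`.
  Far : ℕ → List ℕ → Set
  Far N v = height (λ i → count≤ i v) N ≡ length v

  -- All these shuffles are permutations of one word, hence are parked by one letter map `τ`, and
  -- letter maps commute with shuffling.
  parkBiword-shuffles : ∀ {N} v w → All (1 ≤_) (map proj₁ w) → Far N (map proj₁ v) →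
    map parkBiword (shuffles v (w ↑ N)) ≡ shuffles (parkBiword v) (parkBiword w ↑ length v)
  parkBiword-shuffles {N} v w pos far = begin
    map parkBiword (shuffles v (w ↑ N))              ≡⟨ List.map-cong-local (All.tabulate same) ⟩
    map (map (map₁ τ)) (shuffles v (w ↑ N))          ≡⟨ shuffles-map ℓ (map₁ τ) v (w ↑ N) ⟨
    shuffles (map (map₁ τ) v) (map (map₁ τ) (w ↑ N)) ≡⟨ cong₂ shuffles left right ⟩
    shuffles (parkBiword v) (parkBiword w ↑ length v) ∎
    where
    open ≡.≡-Reasoning
    V = map proj₁ v
    W = map proj₁ w
    S = V ++ map (N ℕ.+_) W
    τ = parkLetter S
    split : ∀ i → count≤ i S ≡ count≤ i V ℕ.+ count≤ i (map (N ℕ.+_) W)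
    split i = count≤-++ i V _
    same : ∀ {s} → s ∈ shuffles v (w ↑ N) → parkBiword s ≡ map (map₁ τ) s
    same {s} s∈ = List.map-cong (λ (x , u) → cong (_, u) (parkLetter-↭ s↭S x)) s
      where
      s↭S : map proj₁ s ↭ S
      s↭S = subst (map proj₁ s ↭_) (≡.trans (List.map-++ proj₁ v (w ↑ N)) (cong (V ++_) (map-proj₁-map₁ _ w)))
              (↭.map⁺ proj₁ (shuffles-↭ ℓ v (w ↑ N) s∈))
    left : map (map₁ τ) v ≡ parkBiword v
    left = List.map-cong-local
        (All.map (λ {xu} x≤N → cong (_, proj₂ xu) (parkLetter-left V W S pos split far x≤N))
      (All.map⁻ (far⇒≤ V far)))
    right : map (map₁ τ) (w ↑ N) ≡ parkBiword w ↑ length v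
    right = ≡.trans (≡.sym (List.map-∘ w)) (≡.trans (List.map-cong-local (All.map (λ {xu} 1≤x →
        cong (_, proj₂ xu) (≡.trans (parkLetter-right V W S pos split far 1≤x)
            (cong (ℕ._+ _) (List.length-map proj₁ v))))
      (All.map⁻ pos))) (List.map-∘ w))

  far-word : ∀ a → Far (size a) (word a)
  far-word a = subst (λ n → Far n (word a)) (List.length-map proj₁ (value a))
    (far-subword (word a) [] (word-CountPF a) (λ i → ≡.sym (ℕ.+-identityʳ _)) (≡.sym (ℕ.+-identityʳ _)))

  -- With the shift `size a`, parking `a` and `b` separately changes nothing. So a shifted shuffle
  -- of parking functions consists of fixed points of parkization.
  parkBiword-⋓ : ∀ a b → map parkBiword (a ⋓ b) ≡ a ⋓ b
  parkBiword-⋓ a b = ≡.trans (parkBiword-shuffles (value a) (value b) (proj₁ (word-CountPF b)) (far-word a))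
    (cong₂ (λ v w → shuffles v (w ↑ size a)) (cong value (cpark-value a)) (cong value (cpark-value b)))

  ⋓-parking : ∀ a b {s} → s ∈ a ⋓ b → parkBiword s ≡ s
  ⋓-parking a b = All.lookup (fixed (a ⋓ b) (parkBiword-⋓ a b))
    where
    fixed : ∀ xs → map parkBiword xs ≡ xs → All (λ s → parkBiword s ≡ s) xs
    fixed []       _ = []
    fixed (x ∷ xs) e = List.∷-injectiveˡ e ∷ fixed xs (List.∷-injectiveʳ e)

  ⋓-unique : ∀ a b → Unique (a ⋓ b)
  ⋓-unique a b = shuffles-unique ℓ (value a) (value b ↑ size a) λ z∈a z∈b →
    ℕ.<⇒≱ (All.lookup above z∈b) (All.lookup below z∈a)
    where
    below : All (λ z → proj₁ z ≤ size a) (value a)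
    below = All.map⁻ (far⇒≤ (word a) (far-word a))
    above : All (λ z → size a < proj₁ z) (value b ↑ size a)
    above = All.map⁺ (All.map (ℕ.m<m+n (size a)) (All.map⁻ (proj₁ (word-CountPF b))))

  ⋓-length : ∀ a b {s} → s ∈ a ⋓ b → length s ≡ size a ℕ.+ size b
  ⋓-length a b s∈ = ≡.trans (↭.↭-length (shuffles-↭ ℓ (value a) (value b ↑ size a) s∈))
    (≡.trans (List.length-++ (value a)) (cong (size a ℕ.+_) (List.length-map _ (value b))))

  -- Enumeration of the colored parking functions

  ∈-wordsOfLength⁺ : ∀ {A : Set} {xs : List A} {w} → All (_∈ xs) w → w ∈ wordsOfLength (length w) xs
  ∈-wordsOfLength⁺ []       = here refl
  ∈-wordsOfLength⁺ (p ∷ ps) = ∈.∈-cartesianProductWith⁺ _∷_ p (∈-wordsOfLength⁺ ps)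

  ∈-wordsOfLength⁻ : ∀ {A : Set} n {xs : List A} {w} → w ∈ wordsOfLength n xs → length w ≡ n
  ∈-wordsOfLength⁻ zero    (here refl) = refl
  ∈-wordsOfLength⁻ (suc n) {xs} w∈ with ∈.∈-cartesianProductWith⁻ _∷_ xs (wordsOfLength n xs) w∈
  ... | _ , _ , _ , v∈ , refl = cong suc (∈-wordsOfLength⁻ n v∈)

  wordsOfLength-unique : ∀ {A : Set} n {xs : List A} → Unique xs → Unique (wordsOfLength n xs)
  wordsOfLength-unique zero    xs! = [] ∷ []
  wordsOfLength-unique (suc n) xs! = Unique.cartesianProductWith⁺ _∷_ List.∷-injective xs!
      (wordsOfLength-unique n xs!)

  -- On values the attached proofs disappear, and uniqueness and membership reduce to those of a
  -- filtered list of words.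
  values-mapMaybe : ∀ ws → map value (mapMaybe toColoredPF ws) ≡ filter (λ w → isParking? (map proj₁ w)) ws
  values-mapMaybe []       = refl
  values-mapMaybe (w ∷ ws) with isParking? (map proj₁ w)
  ... | yes p = ≡.trans (cong (w ∷_) (values-mapMaybe ws))
      (≡.sym (List.filter-accept (λ w → isParking? (map proj₁ w)) p))
  ... | no ¬p = ≡.trans (values-mapMaybe ws) (≡.sym (List.filter-reject (λ w → isParking? (map proj₁ w)) ¬p))

  letters : ℕ → List (ℕ × Color)
  letters n = cartesianProduct (map suc (upTo n)) (allFin ℓ)

  values-coloredPFs : ∀ n → map value (coloredPFs n) ≡ filter (λ w → isParking? (map proj₁ w))
      (wordsOfLength n (letters n))
  values-coloredPFs n = values-mapMaybe (wordsOfLength n (letters n))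

  coloredPFs-unique : ∀ n → Unique (coloredPFs n)
  coloredPFs-unique n = AllPairs.map (_∘ cong value) (AllPairs.map⁻ (subst Unique (≡.sym (values-coloredPFs n))
    (Unique.filter⁺ _ (wordsOfLength-unique n
      (Unique.cartesianProduct⁺ (Unique.map⁺ ℕ.suc-injective (Unique.upTo⁺ n)) (Unique.allFin⁺ ℓ))))))

  ∈-coloredPFs⁻ : ∀ {n c} → c ∈ coloredPFs n → size c ≡ n
  ∈-coloredPFs⁻ {n} {c} c∈ = ∈-wordsOfLength⁻ n (proj₁ (∈.∈-filter⁻ (λ w → isParking? (map proj₁ w))
    (subst (value c ∈_) (values-coloredPFs n) (∈.∈-map⁺ value c∈))))

  ∈-coloredPFs⁺ : ∀ c → c ∈ coloredPFs (size c)
  ∈-coloredPFs⁺ c with ∈.∈-map⁻ value (subst (value c ∈_) (≡.sym (values-coloredPFs (size c))) value∈)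
    where
    pf = word-CountPF c
    letter∈ : ∀ {z} → 1 ≤ proj₁ z × proj₁ z ≤ length (word c) → z ∈ letters (size c)
    letter∈ {suc x , u} (_ , x≤) = ∈.∈-cartesianProduct⁺
      (∈.∈-map⁺ suc (∈.∈-upTo⁺ (subst (x <_) (List.length-map proj₁ (value c)) x≤))) (∈.∈-allFin u)
    value∈ = ∈.∈-filter⁺ (λ w → isParking? (map proj₁ w))
      (∈-wordsOfLength⁺ (All.map letter∈ (All.map⁻ (All.zip (proj₁ pf , CountPF⇒≤ pf)))))
      (CountPF⇒IsParking pf)
  ... | c′ , c′∈ , e with Refinement.value-injective {v = c} {w = c′} e
  ...   | refl = c′∈

  -- A named copy of the list local to `unshuffles`.
  candidates : ℕ → List ColoredPF
  candidates n = concatMap coloredPFs (upTo (suc n))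

  candidates-unique : ∀ n → Unique (candidates n)
  candidates-unique n = Unique.concat⁺ {xss = map coloredPFs (upTo (suc n))}
      (All.map⁺ (All.universal coloredPFs-unique (upTo (suc n))))
    (AllPairs.map⁺ {f = coloredPFs}
      (AllPairs.map (λ {i} {j} i≢j {_} (c∈ , c∈′) →
        i≢j (≡.trans (≡.sym (∈-coloredPFs⁻ {i} c∈)) (∈-coloredPFs⁻ {j} c∈′)))
      (Unique.upTo⁺ (suc n))))

  ∈-candidates⁺ : ∀ {n} c → size c ≤ n → c ∈ candidates n
  ∈-candidates⁺ c c≤n = ∈.∈-concat⁺′ (∈-coloredPFs⁺ c) (∈.∈-map⁺ coloredPFs (∈.∈-upTo⁺ (s≤s c≤n)))

  unshuffles-unique : ∀ c → Unique (unshuffles c)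
  unshuffles-unique c = Unique.filter⁺ (λ (a , b) → value c ∈? a ⋓ b)
      (Unique.cartesianProduct⁺ (candidates-unique (size c)) (candidates-unique (size c)))

  ∈-unshuffles⁺ : ∀ {a b c} → value c ∈ a ⋓ b → (a , b) ∈ unshuffles c
  ∈-unshuffles⁺ {a} {b} {c} c∈ = ∈.∈-filter⁺ (λ (a , b) → value c ∈? a ⋓ b) (∈.∈-cartesianProduct⁺
    (∈-candidates⁺ a (ℕ.≤-trans (ℕ.m≤m+n _ _) (ℕ.≤-reflexive (≡.sym len))))
    (∈-candidates⁺ b (ℕ.≤-trans (ℕ.m≤n+m _ _) (ℕ.≤-reflexive (≡.sym len))))) c∈
    where len = ⋓-length a b c∈

  ∈-unshuffles⁻ : ∀ {a b c} → (a , b) ∈ unshuffles c → value c ∈ a ⋓ b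
  ∈-unshuffles⁻ {a} {b} {c} ab∈ = proj₂ (∈.∈-filter⁻ (λ (a , b) → value c ∈? a ⋓ b)
      {xs = cartesianProduct (candidates (size c)) (candidates (size c))} ab∈)

  -- Letters of a parking function are positive, so `park` may be replaced by `parkMap` on both
  -- factors; the colors are cut along with the word.
  convolution⁺ : ∀ {a b c} → cpark (take (size a) (value c)) ≡ a → cpark (drop (size a) (value c)) ≡ b →
      IsConvolution c a b
  convolution⁺ {a} {b} {c} p q =
      ≡.trans (letters-at (take n) (All.take⁺ n) (List.take-map n)) (cong word p)
    , ≡.trans (letters-at (drop n) (All.drop⁺ n) (List.drop-map n)) (cong word q)
    , ≡.trans (cong (map proj₂) (≡.sym (List.take++drop≡id n (value c))))
      (≡.trans (List.map-++ proj₂ (take n (value c)) _)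
        (cong₂ _++_ (≡.trans (≡.sym (colors-parkBiword (take n (value c)))) (cong colors p))
                    (≡.trans (≡.sym (colors-parkBiword (drop n (value c)))) (cong colors q))))
    where
    n = size a
    letters-at : ∀ (sub : ∀ {A : Set} → List A → List A) →
                 (∀ {w} → All (1 ≤_) w → All (1 ≤_) (sub w)) →
                 (∀ {f : ℕ × Color → ℕ} w → sub (map f w) ≡ map f (sub w)) →
                 park (sub (word c)) ≡ map proj₁ (parkBiword (sub (value c)))
    letters-at sub sub-All sub-map = ≡.trans (park≡parkMap (sub-All (proj₁ (word-CountPF c))))
      (≡.trans (cong parkMap (sub-map (value c))) (≡.sym (letters-parkBiword (sub (value c)))))

  convolution⁻ : ∀ {a b c} → IsConvolution c a b →
      cpark (take (size a) (value c)) ≡ a × cpark (drop (size a) (value c)) ≡ b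
  convolution⁻ {a} {b} {c} (p , q , r) =
      Refinement.value-injective (biword-≡
        (≡.trans (letters-parkBiword (take n (value c)))
          (≡.trans (cong parkMap (≡.sym (List.take-map n (value c))))
          (≡.trans (≡.sym (park≡parkMap (All.take⁺ n pos))) p)))
        (≡.trans (colors-parkBiword (take n (value c))) (≡.trans (≡.sym (List.take-map n (value c)))
          (≡.trans (cong (take n) r) take-colors))))
    , Refinement.value-injective (biword-≡
        (≡.trans (letters-parkBiword (drop n (value c)))
          (≡.trans (cong parkMap (≡.sym (List.drop-map n (value c))))
          (≡.trans (≡.sym (park≡parkMap (All.drop⁺ n pos))) q)))
        (≡.trans (colors-parkBiword (drop n (value c))) (≡.trans (≡.sym (List.drop-map n (value c)))
          (≡.trans (cong (drop n) r) drop-colors))))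
    where
    n = size a
    pos = proj₁ (word-CountPF c)
    n≡ : n ≡ length (colors a)
    n≡ = ≡.sym (List.length-map proj₂ (value a))
    take-colors : take n (colors a ++ colors b) ≡ colors a
    take-colors = ≡.trans (cong (λ m → take m (colors a ++ colors b)) n≡) (take-length (colors a))
      where
      take-length : ∀ {A : Set} (xs : List A) {ys} → take (length xs) (xs ++ ys) ≡ xs
      take-length []       = refl
      take-length (x ∷ xs) = cong (x ∷_) (take-length xs)
    drop-colors : drop n (colors a ++ colors b) ≡ colors b
    drop-colors = ≡.trans (cong (λ m → drop m (colors a ++ colors b)) n≡) (drop-length (colors a))
      where
      drop-length : ∀ {A : Set} (xs : List A) {ys} → drop (length xs) (xs ++ ys) ≡ ys
      drop-length []       = refl
      drop-length (x ∷ xs) = drop-length xs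

  -- When a shuffle of `a` and a shifted `b` is cut, both pieces keep the shift `size a`, although
  -- they contain only a factor of `a`. This shift is still far enough.
  far-take : ∀ n a → Far (size a) (map proj₁ (take n (value a)))
  far-take n a = ≡.subst₂ Far (List.length-map proj₁ (value a)) (List.take-map n (value a))
    (far-subword (take n (word a)) (drop n (word a)) (word-CountPF a) (count≤-take-drop n (word a))
      (≡.trans (cong length (≡.sym (List.take++drop≡id n (word a)))) (List.length-++ (take n (word a)))))

  far-drop : ∀ n a → Far (size a) (map proj₁ (drop n (value a)))
  far-drop n a = ≡.subst₂ Far (List.length-map proj₁ (value a)) (List.drop-map n (value a))
    (far-subword (drop n (word a)) (take n (word a)) (word-CountPF a)
      (λ i → ≡.trans (count≤-take-drop n (word a) i) (ℕ.+-comm (count≤ i (take n (word a))) _))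
      (≡.trans (cong length (≡.sym (List.take++drop≡id n (word a)))) (≡.trans (List.length-++ (take n (word a)))
        (ℕ.+-comm (length (take n (word a))) _))))

  size-0 : ∀ {a} → size a ≡ 0 → ∅ ≡ a
  size-0 {[] , _} _ = refl

-- Coefficients of products and coproducts.

module Coefficients {c r} (R : CommutativeRing c r) (ℓ : ℕ) where
  open CommutativeRing R hiding (refl) renaming (Carrier to Scalar)
  open PQSym R ℓ renaming (_∈_*_ to IsConvolution; _∈?_*_ to isConvolution?)
  open Sums R
  open LinearAlgebra R
  open ColoredParkization ℓ
  open import Relation.Binary.Reasoning.Setoid setoid
  PF PF⊗PF : GradedBasis
  PF = coloredPFBasis
  PF⊗PF = coloredPFBasis ⊗ᵇ coloredPFBasis

  open DecMembership _≟ᵇ_ using (_∈?_)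

  -- `c` is listed at most once, and exactly when cutting it at `size a` gives `a` and `b`. Every
  -- other cut contributes zero, since `cpark` keeps the length. The sum over all cuts no longer
  -- refers to `size a`, so it extends bilinearly.
  product-coefficient-basis : ∀ a b c →
    coefficient {PF} ∑⟨ filter (λ c → isConvolution? c a b) (coloredPFs (size a ℕ.+ size b)) ⟩ c ≈
    ∑[ (p , q) ∈ splits (value c) ] (δ PF a (cpark p) * δ PF b (cpark q))
  product-coefficient-basis a b c = begin
    coefficient {PF} ∑⟨ terms∈ ⟩ c                      ≈⟨ coefficient-∑⟨⟩ {PF} terms∈ c ⟩
    ∑[ c′ ∈ terms∈ ] δ PF c′ c
      ≈⟨ ∑-χ-unique _≟_ c (Unique.filter⁺ (λ c → isConvolution? c a b)
        (coloredPFs-unique (size a ℕ.+ size b))) c∈? ⟩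
    χ c∈?
      ≡⟨ χ-⇔ {P? = c∈?} {(a ≟ cpark v) ×-dec (b ≟ cpark w)} to from ⟩
    χ ((a ≟ cpark v) ×-dec (b ≟ cpark w))               ≈⟨ χ-× (a ≟ cpark v) (b ≟ cpark w) ⟩
    δ PF a (cpark v) * δ PF b (cpark w)                 ≈⟨ ∑-splits (size a) (value c) _ off ⟨
    ∑[ (p , q) ∈ splits (value c) ] (δ PF a (cpark p) * δ PF b (cpark q)) ∎
    where
    terms∈ = filter (λ c → isConvolution? c a b) (coloredPFs (size a ℕ.+ size b))
    c∈? = any? (c ≟_) terms∈
    v = take (size a) (value c)
    w = drop (size a) (value c)
    to : c ∈ terms∈ → a ≡ cpark v × b ≡ cpark w
    to c∈ with convolution⁻ {a} {b} {c}
        (proj₂ (∈.∈-filter⁻ (λ c → isConvolution? c a b) {xs = coloredPFs (size a ℕ.+ size b)} c∈))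
    ... | p , q = ≡.sym p , ≡.sym q
    size-c : ∀ {a b c} → IsConvolution c a b → size c ≡ size a ℕ.+ size b
    size-c {a} {b} {c} (_ , _ , e) = ≡.trans (≡.sym (List.length-map proj₂ (value c))) (≡.trans (cong length e)
      (≡.trans (List.length-++ (colors a)) (cong₂ ℕ._+_ (List.length-map proj₂ (value a))
        (List.length-map proj₂ (value b)))))
    from : a ≡ cpark v × b ≡ cpark w → c ∈ terms∈
    from (p , q) = ∈.∈-filter⁺ (λ c → isConvolution? c a b)
        (subst (λ n → c ∈ coloredPFs n) (size-c {a} {b} {c} conv) (∈-coloredPFs⁺ c)) conv
      where conv = convolution⁺ {a} {b} {c} (≡.sym p) (≡.sym q)
    off : ∀ p q → length p ≢ size a → δ PF a (cpark p) * δ PF b (cpark q) ≈ 0#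
    off p q p≢a = trans (*-congʳ
        (χ-no {P? = a ≟ cpark p} (λ a≡p → p≢a (≡.sym (≡.trans (cong size a≡p) (size-cpark p)))))) (zeroˡ _)

  product-coefficient : ∀ f g c → coefficient (f · g) c ≈
    ∑[ (p , q) ∈ splits (value c) ] (coefficient f (cpark p) * coefficient g (cpark q))
  product-coefficient f g c = begin
    coefficient (f · g) c
      ≈⟨ coefficient-extend {PF} {PF} (λ a → extend (f·g a) g) f c ⟩
    eval (λ a → coefficient (extend (f·g a) g) c) f
      ≈⟨ eval-congˡ {PF} (λ a → trans (coefficient-extend {PF} {PF} (f·g a) g c)
           (eval-congˡ {PF} (λ b → product-coefficient-basis a b c) g)) f ⟩
    eval (λ a → eval (λ b → ∑[ (p , q) ∈ splits (value c) ] (δ PF a (cpark p) * δ PF b (cpark q))) g) f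
      ≈⟨ eval₂-∑δ {PF} {PF} (splits (value c)) (cpark ∘ proj₁) (cpark ∘ proj₂) f g ⟩
    ∑[ (p , q) ∈ splits (value c) ] (coefficient f (cpark p) * coefficient g (cpark q)) ∎
    where
    f·g : ColoredPF → ColoredPF → PQSym
    f·g a b = ∑⟨ filter (λ c → isConvolution? c a b) (coloredPFs (size a ℕ.+ size b)) ⟩

  -- f ↦ (w ↦ coefficient f (cpark w)) embeds PQSym in the algebra of series on words.
  product-series : ∀ f g w → coefficient (f · g) (cpark w) ≈
    ∑[ (p , q) ∈ splits w ] (coefficient f (cpark p) * coefficient g (cpark q))
  product-series f g w = begin
    coefficient (f · g) (cpark w)
      ≈⟨ product-coefficient f g (cpark w) ⟩
    ∑[ (p , q) ∈ splits (parkBiword w) ] (coefficient f (cpark p) * coefficient g (cpark q))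
      ≡⟨ cong (λ ss → ∑[ (p , q) ∈ ss ] (coefficient f (cpark p) * coefficient g (cpark q))) (splits-map t w) ⟩
    ∑[ (p , q) ∈ map (λ (p , q) → map t p , map t q) (splits w) ]
        (coefficient f (cpark p) * coefficient g (cpark q))
      ≡⟨ ∑-map _ (splits w) _ ⟩
    ∑[ (p , q) ∈ splits w ] (coefficient f (cpark (map t p)) * coefficient g (cpark (map t q)))
      -- Here `t` parks letters by the counts of all of `w`; parking the factor again gives the same
      -- as parking it directly.
      ≈⟨ ∑-cong-∈ (splits w) (λ {pq} pq∈ → reflexive (cong₂ (λ p q → coefficient f p * coefficient g q)
           (same take List.take-map cpark-take (length (proj₁ pq)) (proj₁ pq) (proj₁ (∈-splits w pq∈)))
           (same drop List.drop-map cpark-drop (length (proj₁ pq)) (proj₂ pq) (proj₂ (∈-splits w pq∈))))) ⟩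
    ∑[ (p , q) ∈ splits w ] (coefficient f (cpark p) * coefficient g (cpark q)) ∎
    where
    t = map₁ (parkLetter (map proj₁ w))
    same : (sub : ℕ → Biword → Biword) → (∀ {f} n w → sub n (map f w) ≡ map f (sub n w)) →
           (∀ n w → cpark (sub n (parkBiword w)) ≡ cpark (sub n w)) →
           ∀ n p → p ≡ sub n w → cpark (map t p) ≡ cpark p
    same sub sub-map sub-cpark n .(sub n w) refl = ≡.trans (cong cpark (≡.sym (sub-map n w))) (sub-cpark n w)

  -- The shuffle formula serves as the definition; its agreement with the ordered sum is
  -- `Δ-isOrderedSumCoproduct`.
  Δ : PQSym → PQSym⊗PQSym
  Δ = extend {PF} {PF⊗PF} (λ c → ∑⟨ unshuffles c ⟩)

  coefficient-unshuffles : ∀ c a b → coefficient {PF⊗PF} ∑⟨ unshuffles c ⟩ (a , b) ≈ χ (value c ∈? a ⋓ b)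
  coefficient-unshuffles c a b = begin
    coefficient {PF⊗PF} ∑⟨ unshuffles c ⟩ (a , b) ≈⟨ coefficient-∑⟨⟩ {PF⊗PF} (unshuffles c) (a , b) ⟩
    ∑[ ab ∈ unshuffles c ] δ PF⊗PF ab (a , b)
      ≈⟨ ∑-χ-unique (GradedBasis._≟_ PF⊗PF) (a , b) (unshuffles-unique c) ab∈? ⟩
    χ ab∈?
      ≡⟨ χ-⇔ {P? = ab∈?} {value c ∈? a ⋓ b} (∈-unshuffles⁻ {a} {b} {c}) (∈-unshuffles⁺ {a} {b} {c}) ⟩
    χ (value c ∈? a ⋓ b)                          ∎
    where ab∈? = any? (GradedBasis._≟_ PF⊗PF (a , b)) (unshuffles c)

  -- Membership in the duplicate-free list `a ⋓ b` becomes a sum of `δ`, which extends linearly in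
  -- `f`. Its words are already parked, so `cpark s` stands for `s`.
  coproduct-coefficient : ∀ f a b → coefficient (Δ f) (a , b) ≈ ∑[ s ∈ a ⋓ b ] coefficient f (cpark s)
  coproduct-coefficient f a b = begin
    coefficient (Δ f) (a , b)
      ≈⟨ coefficient-extend {PF} {PF⊗PF} (λ c → ∑⟨ unshuffles c ⟩) f (a , b) ⟩
    eval (λ c → coefficient {PF⊗PF} ∑⟨ unshuffles c ⟩ (a , b)) f
      ≈⟨ eval-congˡ {PF} basis f ⟩
    eval (λ c → ∑[ s ∈ a ⋓ b ] δ PF c (cpark s)) f
      ≈⟨ eval-∑χ {PF} (a ⋓ b) cpark f ⟩
    ∑[ s ∈ a ⋓ b ] coefficient f (cpark s) ∎
    where
    basis : ∀ c → coefficient {PF⊗PF} ∑⟨ unshuffles c ⟩ (a , b) ≈ ∑[ s ∈ a ⋓ b ] δ PF c (cpark s)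
    basis c = begin
      coefficient {PF⊗PF} ∑⟨ unshuffles c ⟩ (a , b) ≈⟨ coefficient-unshuffles c a b ⟩
      χ (value c ∈? a ⋓ b)
        ≈⟨ ∑-χ-unique _≟ᵇ_ (value c) (⋓-unique a b) (value c ∈? a ⋓ b) ⟨
      ∑[ s ∈ a ⋓ b ] χ (s ≟ᵇ value c)
        ≈⟨ ∑-cong-∈ (a ⋓ b) (λ {s} s∈ → reflexive (χ-⇔ {P? = s ≟ᵇ value c} {c ≟ cpark s}
          (λ s≡c → Refinement.value-injective (≡.trans (≡.sym s≡c) (≡.sym (⋓-parking a b s∈))))
          (λ c≡s → ≡.trans (≡.sym (⋓-parking a b s∈)) (≡.sym (cong value c≡s))))) ⟩
      ∑[ s ∈ a ⋓ b ] δ PF c (cpark s) ∎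

  -- The counterpart of `product-series`: the words need not be parking functions, and any far shift
  -- gives the same sum.
  coproduct-series : ∀ f {N} v w → All (1 ≤_) (map proj₁ w) → Far N (map proj₁ v) →
    coefficient (Δ f) (cpark v , cpark w) ≈ ∑[ s ∈ shuffles v (w ↑ N) ] coefficient f (cpark s)
  coproduct-series f {N} v w pos far = begin
    coefficient (Δ f) (cpark v , cpark w)
      ≈⟨ coproduct-coefficient f (cpark v) (cpark w) ⟩
    ∑[ s ∈ cpark v ⋓ cpark w ] coefficient f (cpark s)
      ≡⟨ cong (λ n → ∑[ s ∈ shuffles (parkBiword v) (parkBiword w ↑ n) ] coefficient f (cpark s))
        (size-cpark v) ⟩
    ∑[ s ∈ shuffles (parkBiword v) (parkBiword w ↑ length v) ] coefficient f (cpark s)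
      ≡⟨ cong (λ ss → ∑[ s ∈ ss ] coefficient f (cpark s)) (parkBiword-shuffles v w pos far) ⟨
    ∑[ s ∈ map parkBiword (shuffles v (w ↑ N)) ] coefficient f (cpark s)
      ≡⟨ ∑-map parkBiword (shuffles v (w ↑ N)) _ ⟩
    ∑[ s ∈ shuffles v (w ↑ N) ] coefficient f (cpark (parkBiword s))
      ≈⟨ ∑-cong (shuffles v (w ↑ N)) (λ s → reflexive (cong (coefficient f) (cpark-value (cpark s)))) ⟩
    ∑[ s ∈ shuffles v (w ↑ N) ] coefficient f (cpark s) ∎

  coefficient-1 : ∀ c → coefficient 1PQSym c ≈ δ PF ∅ c
  coefficient-1 = coefficient-⟨⟩ {PF} ∅

-- The axioms of a graded connected bialgebra.

module BialgebraStructure {c r} (R : CommutativeRing c r) (ℓ : ℕ) where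
  open CommutativeRing R hiding (refl) renaming (Carrier to Scalar)
  open PQSym R ℓ renaming (_∈_*_ to IsConvolution; _∈?_*_ to isConvolution?)
  open Sums R
  open LinearAlgebra R
  open ColoredParkization ℓ
  open Coefficients R ℓ
  open DecMembership _≟ᵇ_ using (_∈?_)
  open import Relation.Binary.Reasoning.Setoid setoid
  private
    module * = CommutativeSemigroupProperties (CommutativeRing.*-commutativeSemigroup R)

  ·-cong : ∀ {f f′ g g′} → f ≈ᴹ f′ → g ≈ᴹ g′ → f · g ≈ᴹ f′ · g′
  ·-cong {f} {f′} {g} {g′} f≈ g≈ = pointwise λ c → begin
    coefficient (f · g) c ≈⟨ product-coefficient f g c ⟩
    _ ≈⟨ ∑-cong (splits (value c)) (λ (p , q) → *-cong (at f≈ (cpark p)) (at g≈ (cpark q))) ⟩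
    _ ≈⟨ product-coefficient f′ g′ c ⟨
    coefficient (f′ · g′) c ∎

  -- The factors of `value c` need not be parking functions; `product-series` evaluates the inner
  -- product on them by a further cut. Both sides are then sums over the cuts into three parts.
  ·-assoc : ∀ f g h → (f · g) · h ≈ᴹ f · (g · h)
  ·-assoc f g h = pointwise λ c → let w = value c in begin
    coefficient ((f · g) · h) c
      ≈⟨ product-coefficient (f · g) h c ⟩
    ∑[ (p , q) ∈ splits w ] (coefficient (f · g) (cpark p) * coefficient h (cpark q))
      ≈⟨ ∑-cong (splits w) (λ (p , q) → trans (*-congʳ (product-series f g p))
           (sym (∑-*ʳ (coefficient h (cpark q)) (splits p) _))) ⟩
    ∑[ (p , q) ∈ splits w ] ∑[ (p₁ , p₂) ∈ splits p ]
      (coefficient f (cpark p₁) * coefficient g (cpark p₂) * coefficient h (cpark q))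
      ≈⟨ ∑-splits-assoc w
          (λ p₁ p₂ p₃ → coefficient f (cpark p₁) * coefficient g (cpark p₂) * coefficient h (cpark p₃)) ⟩
    ∑[ (p , q) ∈ splits w ] ∑[ (q₁ , q₂) ∈ splits q ]
      (coefficient f (cpark p) * coefficient g (cpark q₁) * coefficient h (cpark q₂))
      ≈⟨ ∑-cong (splits w) (λ (p , q) → trans (∑-cong (splits q) (λ _ → *-assoc _ _ _))
           (trans (∑-*ˡ (coefficient f (cpark p)) (splits q) _) (*-congˡ (sym (product-series g h q))))) ⟩
    ∑[ (p , q) ∈ splits w ] (coefficient f (cpark p) * coefficient (g · h) (cpark q))
      ≈⟨ product-coefficient f (g · h) c ⟨
    coefficient (f · (g · h)) c ∎

  ∅-size : ∀ w → length w ≢ 0 → δ PF ∅ (cpark w) ≈ 0#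
  ∅-size w w≢ = χ-no {P? = ∅ ≟ cpark w} (λ e → w≢ (≡.trans (≡.sym (size-cpark w)) (cong size (≡.sym e))))

  ·-identityˡ : ∀ f → 1PQSym · f ≈ᴹ f
  ·-identityˡ f = pointwise λ c → begin
    coefficient (1PQSym · f) c
      ≈⟨ product-coefficient 1PQSym f c ⟩
    ∑[ (p , q) ∈ splits (value c) ] (coefficient 1PQSym (cpark p) * coefficient f (cpark q))
      ≈⟨ ∑-splits 0 (value c) _ (λ p q p≢ → trans (*-congʳ (trans (coefficient-1 (cpark p)) (∅-size p p≢)))
        (zeroˡ _)) ⟩
    coefficient 1PQSym (cpark []) * coefficient f (cpark (value c))
      ≈⟨ *-cong (coefficient-1 (cpark [])) (reflexive (cong (coefficient f) (cpark-value c))) ⟩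
    1# * coefficient f c
      ≈⟨ *-identityˡ _ ⟩
    coefficient f c ∎

  ·-identityʳ : ∀ f → f · 1PQSym ≈ᴹ f
  ·-identityʳ f = pointwise λ c → begin
    coefficient (f · 1PQSym) c
      ≈⟨ product-coefficient f 1PQSym c ⟩
    ∑[ (p , q) ∈ splits (value c) ] (coefficient f (cpark p) * coefficient 1PQSym (cpark q))
      ≈⟨ ∑-splits-last (value c) _ (λ p x q →
        trans (*-congˡ (trans (coefficient-1 (cpark (x ∷ q))) (∅-size (x ∷ q) λ ()))) (zeroʳ _)) ⟩
    coefficient f (cpark (value c)) * coefficient 1PQSym (cpark [])
      ≈⟨ *-cong (reflexive (cong (coefficient f) (cpark-value c))) (coefficient-1 (cpark [])) ⟩
    coefficient f c * 1#
      ≈⟨ *-identityʳ _ ⟩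
    coefficient f c ∎

  ·-distribˡ : ∀ f g h → f · (g +ᴹ h) ≈ᴹ f · g +ᴹ f · h
  ·-distribˡ f g h = pointwise λ c → let ss = splits (value c) in begin
    coefficient (f · (g +ᴹ h)) c
      ≈⟨ product-coefficient f (g +ᴹ h) c ⟩
    ∑[ (p , q) ∈ ss ] (coefficient f (cpark p) * coefficient (g +ᴹ h) (cpark q))
      ≈⟨ ∑-cong ss (λ (p , q) → trans (*-congˡ (coefficient-+ g h (cpark q))) (distribˡ _ _ _)) ⟩
    ∑[ (p , q) ∈ ss ] (coefficient f (cpark p) * coefficient g (cpark q)
        + coefficient f (cpark p) * coefficient h (cpark q))
      ≈⟨ ∑-+ ss _ _ ⟩
    ∑[ (p , q) ∈ ss ] (coefficient f (cpark p) * coefficient g (cpark q))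
      + ∑[ (p , q) ∈ ss ] (coefficient f (cpark p) * coefficient h (cpark q))
      ≈⟨ +-cong (product-coefficient f g c) (product-coefficient f h c) ⟨
    coefficient (f · g) c + coefficient (f · h) c
      ≈⟨ coefficient-+ (f · g) (f · h) c ⟨
    coefficient (f · g +ᴹ f · h) c ∎

  ·-distribʳ : ∀ h f g → (f +ᴹ g) · h ≈ᴹ f · h +ᴹ g · h
  ·-distribʳ h f g = pointwise λ c → let ss = splits (value c) in begin
    coefficient ((f +ᴹ g) · h) c
      ≈⟨ product-coefficient (f +ᴹ g) h c ⟩
    ∑[ (p , q) ∈ ss ] (coefficient (f +ᴹ g) (cpark p) * coefficient h (cpark q))
      ≈⟨ ∑-cong ss (λ (p , q) → trans (*-congʳ (coefficient-+ f g (cpark p))) (distribʳ _ _ _)) ⟩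
    ∑[ (p , q) ∈ ss ] (coefficient f (cpark p) * coefficient h (cpark q)
        + coefficient g (cpark p) * coefficient h (cpark q))
      ≈⟨ ∑-+ ss _ _ ⟩
    ∑[ (p , q) ∈ ss ] (coefficient f (cpark p) * coefficient h (cpark q))
      + ∑[ (p , q) ∈ ss ] (coefficient g (cpark p) * coefficient h (cpark q))
      ≈⟨ +-cong (product-coefficient f h c) (product-coefficient g h c) ⟨
    coefficient (f · h) c + coefficient (g · h) c
      ≈⟨ coefficient-+ (f · h) (g · h) c ⟨
    coefficient (f · h +ᴹ g · h) c ∎

  isAlgebra : IsAlgebra PF _·_ 1PQSym
  isAlgebra = record
    { isRing = record
      { +-isAbelianGroup = IsLeftModule.+ᴹ-isAbelianGroup isLeftModule
      ; *-cong     = ·-cong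
      ; *-assoc    = ·-assoc
      ; *-identity = ·-identityˡ , ·-identityʳ
      ; distrib    = ·-distribˡ , ·-distribʳ
      }
    ; *ₗ-∙ = λ s f g → pointwise λ c → let ss = splits (value c) in begin
        coefficient ((s *ₗ f) · g) c
          ≈⟨ product-coefficient (s *ₗ f) g c ⟩
        ∑[ (p , q) ∈ ss ] (coefficient (s *ₗ f) (cpark p) * coefficient g (cpark q))
          ≈⟨ ∑-cong ss (λ (p , q) → trans (*-congʳ (coefficient-*ₗ s f (cpark p))) (*-assoc s _ _)) ⟩
        ∑[ (p , q) ∈ ss ] (s * (coefficient f (cpark p) * coefficient g (cpark q)))
          ≈⟨ ∑-*ˡ s ss _ ⟩
        s * ∑[ (p , q) ∈ ss ] (coefficient f (cpark p) * coefficient g (cpark q))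
          ≈⟨ *-congˡ (product-coefficient f g c) ⟨
        s * coefficient (f · g) c
          ≈⟨ coefficient-*ₗ s (f · g) c ⟨
        coefficient (s *ₗ (f · g)) c ∎
    ; ∙-*ₗ = λ s f g → pointwise λ c → let ss = splits (value c) in begin
        coefficient (f · (s *ₗ g)) c
          ≈⟨ product-coefficient f (s *ₗ g) c ⟩
        ∑[ (p , q) ∈ ss ] (coefficient f (cpark p) * coefficient (s *ₗ g) (cpark q))
          ≈⟨ ∑-cong ss (λ (p , q) → trans (*-congˡ (coefficient-*ₗ s g (cpark q))) (*.x∙yz≈y∙xz _ s _)) ⟩
        ∑[ (p , q) ∈ ss ] (s * (coefficient f (cpark p) * coefficient g (cpark q)))
          ≈⟨ ∑-*ˡ s ss _ ⟩
        s * ∑[ (p , q) ∈ ss ] (coefficient f (cpark p) * coefficient g (cpark q))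
          ≈⟨ *-congˡ (product-coefficient f g c) ⟨
        s * coefficient (f · g) c
          ≈⟨ coefficient-*ₗ s (f · g) c ⟨
        coefficient (s *ₗ (f · g)) c ∎
    }

  coefficient-Δ⟨⟩ : ∀ d a b → coefficient {PF⊗PF} (Δ ⟨ d ⟩) (a , b) ≈ ∑[ s ∈ a ⋓ b ] δ PF d (cpark s)
  coefficient-Δ⟨⟩ d a b = trans (coproduct-coefficient ⟨ d ⟩ a b)
    (∑-cong (a ⋓ b) (λ s → coefficient-⟨⟩ {PF} d (cpark s)))

  -- Both coefficients are the sum of `F` over the shuffles of `a`, `b` shifted by `size a`, and `c`
  -- shifted by `size a + size b`.
  Δ-coassociative : ∀ f → associator {PF} {PF} {PF} ((Δ ⊗ᶠ id) (Δ f)) ≈ᴹ (id ⊗ᶠ Δ) (Δ f)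
  Δ-coassociative f = pointwise λ (a , (b , c)) → begin
    coefficient {PF ⊗ᵇ PF⊗PF} (associator {PF} {PF} {PF} ((Δ ⊗ᶠ id) (Δ f))) (a , (b , c))
      ≈⟨ coefficient-associator {PF} {PF} {PF} ((Δ ⊗ᶠ id) (Δ f)) a b c ⟩
    coefficient {PF⊗PF ⊗ᵇ PF} ((Δ ⊗ᶠ id) (Δ f)) ((a , b) , c)
      ≈⟨ coefficient-⊗ᶠ {PF} {PF} {PF⊗PF} {PF} Δ id (Δ f) (a , b) c ⟩
    eval {PF⊗PF} (λ (d , c′) → coefficient {PF⊗PF} (Δ ⟨ d ⟩) (a , b) * coefficient {PF} ⟨ c′ ⟩ c) (Δ f)
      ≈⟨ eval-congˡ {PF⊗PF} (λ (d , c′) → trans (*-cong (coefficient-Δ⟨⟩ d a b) (coefficient-⟨⟩ {PF} c′ c))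
           (trans (sym (∑-*ʳ (δ PF c′ c) (a ⋓ b) _)) (∑-cong (a ⋓ b) (λ s → sym (δ-⊗ PF PF d c′ (cpark s) c)))))
             (Δ f) ⟩
    eval {PF⊗PF} (λ dc → ∑[ s ∈ a ⋓ b ] δ PF⊗PF dc (cpark s , c)) (Δ f)
      ≈⟨ eval-∑χ {PF⊗PF} (a ⋓ b) (λ s → cpark s , c) (Δ f) ⟩
    ∑[ s ∈ a ⋓ b ] coefficient (Δ f) (cpark s , c)
      -- `s` is its own parkization and has length `size a + size b`, which fixes the shift of `c`.
      ≈⟨ ∑-cong-∈ (a ⋓ b) (λ {s} s∈ → trans (coproduct-coefficient f (cpark s) c)
           (reflexive (cong₂ (λ v n → ∑[ t ∈ shuffles v (value c ↑ n) ] F t) (⋓-parking a b s∈)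
             (≡.trans (size-cpark s) (⋓-length a b s∈))))) ⟩
    ∑[ s ∈ a ⋓ b ] ∑ (shuffles s (value c ↑ (size a ℕ.+ size b))) F
      ≈⟨ ∑-shuffles-assoc ℓ (value a) (value b ↑ size a) (value c ↑ (size a ℕ.+ size b)) F ⟩
    ∑[ s ∈ shuffles (value b ↑ size a) (value c ↑ (size a ℕ.+ size b)) ] ∑ (shuffles (value a) s) F
      ≡⟨ cong (λ ss → ∑[ s ∈ ss ] ∑ (shuffles (value a) s) F) (≡.trans
           (cong (shuffles (value b ↑ size a)) (≡.sym (↑-↑ (value c) (size b) (size a))))
           (shuffles-map ℓ (map₁ (size a ℕ.+_)) (value b) (value c ↑ size b))) ⟩
    ∑[ s ∈ map (_↑ size a) (b ⋓ c) ] ∑ (shuffles (value a) s) F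
      ≡⟨ ∑-map (_↑ size a) (b ⋓ c) _ ⟩
    ∑[ s ∈ b ⋓ c ] ∑ (shuffles (value a) (s ↑ size a)) F
      ≈⟨ ∑-cong-∈ (b ⋓ c) (λ {s} s∈ → trans (reflexive (cong (λ v → ∑ (shuffles (value a) (v ↑ size a)) F)
           (≡.sym (⋓-parking b c s∈)))) (sym (coproduct-coefficient f a (cpark s)))) ⟩
    ∑[ s ∈ b ⋓ c ] coefficient (Δ f) (a , cpark s)
      ≈⟨ eval-∑χ {PF⊗PF} (b ⋓ c) (λ s → a , cpark s) (Δ f) ⟨
    eval {PF⊗PF} (λ ad → ∑[ s ∈ b ⋓ c ] δ PF⊗PF ad (a , cpark s)) (Δ f)
      ≈⟨ eval-congˡ {PF⊗PF} (λ (a′ , d) → trans (∑-cong (b ⋓ c) (λ s → δ-⊗ PF PF a′ d a (cpark s)))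
           (trans (∑-*ˡ (δ PF a′ a) (b ⋓ c) _)
             (sym (*-cong (coefficient-⟨⟩ {PF} a′ a) (coefficient-Δ⟨⟩ d b c))))) (Δ f) ⟩
    eval {PF⊗PF} (λ (a′ , d) → coefficient {PF} ⟨ a′ ⟩ a * coefficient {PF⊗PF} (Δ ⟨ d ⟩) (b , c)) (Δ f)
      ≈⟨ coefficient-⊗ᶠ {PF} {PF} {PF} {PF⊗PF} id Δ (Δ f) a (b , c) ⟨
    coefficient {PF ⊗ᵇ PF⊗PF} ((id ⊗ᶠ Δ) (Δ f)) (a , (b , c)) ∎
    where
    F : Biword → Scalar
    F t = coefficient f (cpark t)

  Δ-counitˡ : ∀ f → ε⊗id PF Δ counit (Δ f) ≈ᴹ f
  Δ-counitˡ f = pointwise λ b → begin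
    coefficient {PF} (ε⊗id PF Δ counit (Δ f)) b
      ≈⟨ coefficient-extend {PF⊗PF} {PF} (λ (a , b′) → counit ⟨ a ⟩ *ₗ ⟨ b′ ⟩) (Δ f) b ⟩
    eval {PF⊗PF} (λ (a , b′) → coefficient {PF} (counit ⟨ a ⟩ *ₗ ⟨ b′ ⟩) b) (Δ f)
      ≈⟨ eval-congˡ {PF⊗PF} (λ (a , b′) → trans (coefficient-*ₗ {PF} (counit ⟨ a ⟩) ⟨ b′ ⟩ b)
           (trans (*-cong (coefficient-⟨⟩ {PF} a ∅) (coefficient-⟨⟩ {PF} b′ b)) (sym (δ-⊗ PF PF a b′ ∅ b))))
             (Δ f) ⟩
    eval {PF⊗PF} (λ ab → δ PF⊗PF ab (∅ , b)) (Δ f)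
      ≈⟨ eval-δ {PF⊗PF} (Δ f) (∅ , b) ⟨
    coefficient (Δ f) (∅ , b)
      ≈⟨ coproduct-coefficient f ∅ b ⟩
    coefficient f (cpark (value b ↑ 0)) + 0#
      ≈⟨ +-identityʳ _ ⟩
    coefficient f (cpark (value b ↑ 0))
      ≡⟨ cong (coefficient f) (≡.trans (cong cpark (List.map-id (value b))) (cpark-value b)) ⟩
    coefficient f b ∎

  Δ-counitʳ : ∀ f → id⊗ε PF Δ counit (Δ f) ≈ᴹ f
  Δ-counitʳ f = pointwise λ a → begin
    coefficient {PF} (id⊗ε PF Δ counit (Δ f)) a
      ≈⟨ coefficient-extend {PF⊗PF} {PF} (λ (a′ , b) → counit ⟨ b ⟩ *ₗ ⟨ a′ ⟩) (Δ f) a ⟩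
    eval {PF⊗PF} (λ (a′ , b) → coefficient {PF} (counit ⟨ b ⟩ *ₗ ⟨ a′ ⟩) a) (Δ f)
      ≈⟨ eval-congˡ {PF⊗PF} (λ (a′ , b) → trans (coefficient-*ₗ {PF} (counit ⟨ b ⟩) ⟨ a′ ⟩ a)
           (trans (*-comm _ _) (trans (*-cong (coefficient-⟨⟩ {PF} a′ a) (coefficient-⟨⟩ {PF} b ∅))
             (sym (δ-⊗ PF PF a′ b a ∅))))) (Δ f) ⟩
    eval {PF⊗PF} (λ ab → δ PF⊗PF ab (a , ∅)) (Δ f)
      ≈⟨ eval-δ {PF⊗PF} (Δ f) (a , ∅) ⟨
    coefficient (Δ f) (a , ∅)
      ≈⟨ coproduct-coefficient f a ∅ ⟩
    ∑[ s ∈ shuffles (value a) [] ] coefficient f (cpark s)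
      ≈⟨ ∑-shuffles-[]ʳ ℓ (value a) _ ⟩
    coefficient f (cpark (value a))
      ≡⟨ cong (coefficient f) (cpark-value a) ⟩
    coefficient f a ∎

  isCoalgebra : IsCoalgebra PF Δ counit
  isCoalgebra = record
    { Δ-linear      = extend-linear {PF} {PF⊗PF} (λ c → ∑⟨ unshuffles c ⟩)
    ; ε-linear      = linear (free PF) scalars counit (λ x≈y → at x≈y ∅)
                        (λ x y → coefficient-+ x y ∅) (λ s x → coefficient-*ₗ s x ∅)
    ; coassociative = Δ-coassociative
    ; counitˡ       = Δ-counitˡ
    ; counitʳ       = Δ-counitʳ
    }

  infix 6 _·⊗_
  _·⊗_ : PQSym⊗PQSym → PQSym⊗PQSym → PQSym⊗PQSym
  _·⊗_ = _∙⊗_ PF _·_ 1PQSym Δ counit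

  -- The two cuts are joined into one sum over pairs of splits, so that `eval₂-∑δ` applies on the
  -- tensor square.
  ·⊗-coefficient : ∀ x y a b → coefficient {PF⊗PF} (x ·⊗ y) (a , b) ≈
    ∑[ (a₁ , a₂) ∈ splits (value a) ] ∑[ (b₁ , b₂) ∈ splits (value b) ]
      (coefficient x (cpark a₁ , cpark b₁) * coefficient y (cpark a₂ , cpark b₂))
  ·⊗-coefficient x y a b = begin
    coefficient {PF⊗PF} (x ·⊗ y) (a , b)
      ≈⟨ coefficient-extend {PF⊗PF} {PF⊗PF} (λ p → extend {PF⊗PF} {PF⊗PF} (m p) y) x (a , b) ⟩
    eval {PF⊗PF} (λ p → coefficient {PF⊗PF} (extend {PF⊗PF} {PF⊗PF} (m p) y) (a , b)) x
      ≈⟨ eval-congˡ {PF⊗PF} (λ p → trans (coefficient-extend {PF⊗PF} {PF⊗PF} (m p) y (a , b))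
           (eval-congˡ {PF⊗PF} (λ q → basis p q) y)) x ⟩
    eval {PF⊗PF} (λ p → eval {PF⊗PF} (λ q → ∑[ s ∈ ss ] (δ PF⊗PF p (left s) * δ PF⊗PF q (right s))) y) x
      ≈⟨ eval₂-∑δ {PF⊗PF} {PF⊗PF} ss left right x y ⟩
    ∑[ s ∈ ss ] (coefficient x (left s) * coefficient y (right s))
      ≈⟨ ∑-cartesianProduct (splits (value a)) (splits (value b))
          (λ s → coefficient x (left s) * coefficient y (right s)) ⟩
    ∑[ (a₁ , a₂) ∈ splits (value a) ] ∑[ (b₁ , b₂) ∈ splits (value b) ]
      (coefficient x (cpark a₁ , cpark b₁) * coefficient y (cpark a₂ , cpark b₂)) ∎
    where
    m : ColoredPF × ColoredPF → ColoredPF × ColoredPF → PQSym⊗PQSym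
    m (c , d) (c′ , d′) = (⟨ c ⟩ · ⟨ c′ ⟩) ⊗ (⟨ d ⟩ · ⟨ d′ ⟩)
    ss = cartesianProduct (splits (value a)) (splits (value b))
    left right : (Biword × Biword) × (Biword × Biword) → ColoredPF × ColoredPF
    left  ((a₁ , a₂) , (b₁ , b₂)) = cpark a₁ , cpark b₁
    right ((a₁ , a₂) , (b₁ , b₂)) = cpark a₂ , cpark b₂
    product⟨⟩ : ∀ c c′ a → coefficient (⟨ c ⟩ · ⟨ c′ ⟩) a ≈
      ∑[ (p , q) ∈ splits (value a) ] (δ PF c (cpark p) * δ PF c′ (cpark q))
    product⟨⟩ c c′ a = trans (product-coefficient ⟨ c ⟩ ⟨ c′ ⟩ a) (∑-cong (splits (value a)) (λ (p , q) →
      *-cong (coefficient-⟨⟩ {PF} c (cpark p)) (coefficient-⟨⟩ {PF} c′ (cpark q))))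
    basis : ∀ p q → coefficient {PF⊗PF} (m p q) (a , b) ≈ ∑[ s ∈ ss ] (δ PF⊗PF p (left s) * δ PF⊗PF q (right s))
    basis (c , d) (c′ , d′) = begin
      coefficient {PF⊗PF} (m (c , d) (c′ , d′)) (a , b)
        ≈⟨ coefficient-⊗ {PF} {PF} (⟨ c ⟩ · ⟨ c′ ⟩) (⟨ d ⟩ · ⟨ d′ ⟩) a b ⟩
      coefficient (⟨ c ⟩ · ⟨ c′ ⟩) a * coefficient (⟨ d ⟩ · ⟨ d′ ⟩) b
        ≈⟨ *-cong (product⟨⟩ c c′ a) (product⟨⟩ d d′ b) ⟩
      ∑[ (a₁ , a₂) ∈ splits (value a) ] (δ PF c (cpark a₁) * δ PF c′ (cpark a₂))
        * ∑[ (b₁ , b₂) ∈ splits (value b) ] (δ PF d (cpark b₁) * δ PF d′ (cpark b₂))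
        ≈⟨ ∑-*-∑ (splits (value a)) (splits (value b)) _ _ ⟨
      ∑[ (a₁ , a₂) ∈ splits (value a) ] ∑[ (b₁ , b₂) ∈ splits (value b) ]
        (δ PF c (cpark a₁) * δ PF c′ (cpark a₂) * (δ PF d (cpark b₁) * δ PF d′ (cpark b₂)))
        ≈⟨ ∑-cong (splits (value a)) (λ (a₁ , a₂) → ∑-cong (splits (value b)) (λ (b₁ , b₂) → trans
             (*.interchange _ _ _ _)
             (sym (*-cong (δ-⊗ PF PF c d (cpark a₁) (cpark b₁)) (δ-⊗ PF PF c′ d′ (cpark a₂) (cpark b₂)))))) ⟩
      ∑[ (a₁ , a₂) ∈ splits (value a) ] ∑[ (b₁ , b₂) ∈ splits (value b) ]
        (δ PF⊗PF (c , d) (cpark a₁ , cpark b₁) * δ PF⊗PF (c′ , d′) (cpark a₂ , cpark b₂))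
        ≈⟨ ∑-cartesianProduct (splits (value a)) (splits (value b))
             (λ s → δ PF⊗PF (c , d) (left s) * δ PF⊗PF (c′ , d′) (right s)) ⟨
      ∑[ s ∈ ss ] (δ PF⊗PF (c , d) (left s) * δ PF⊗PF (c′ , d′) (right s)) ∎

  -- `product-series` cuts every shuffle, `∑-splits-shuffles` turns the cut shuffles into shuffles
  -- of the cuts, and the summand factors over the two parts. Each factor is then a coefficient of a
  -- coproduct.
  Δ-multiplicative : ∀ f g → Δ (f · g) ≈ᴹ Δ f ·⊗ Δ g
  Δ-multiplicative f g = pointwise λ (a , b) → begin
    coefficient (Δ (f · g)) (a , b)
      ≈⟨ coproduct-coefficient (f · g) a b ⟩
    ∑[ s ∈ a ⋓ b ] coefficient (f · g) (cpark s)
      ≈⟨ ∑-cong (a ⋓ b) (λ s → product-series f g s) ⟩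
    ∑[ s ∈ a ⋓ b ] ∑[ (s₁ , s₂) ∈ splits s ] (F s₁ * H s₂)
      ≈⟨ ∑-splits-shuffles ℓ (value a) (value b ↑ size a) (λ s₁ s₂ → F s₁ * H s₂) ⟩
    ∑[ (a₁ , a₂) ∈ splits (value a) ] ∑[ (b₁ , b₂) ∈ splits (value b ↑ size a) ]
      ∑[ s₁ ∈ shuffles a₁ b₁ ] ∑[ s₂ ∈ shuffles a₂ b₂ ] (F s₁ * H s₂)
      ≈⟨ ∑-cong (splits (value a)) (λ (a₁ , a₂) → trans
           (reflexive (≡.trans (cong
             (λ ss → ∑[ (b₁ , b₂) ∈ ss ] ∑[ s₁ ∈ shuffles a₁ b₁ ] ∑[ s₂ ∈ shuffles a₂ b₂ ] (F s₁ * H s₂))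
               (splits-map (map₁ (size a ℕ.+_)) (value b)))
             (∑-map _ (splits (value b)) _)))
           (∑-cong (splits (value b)) (λ (b₁ , b₂) →
             ∑-*-∑ (shuffles a₁ (b₁ ↑ size a)) (shuffles a₂ (b₂ ↑ size a)) F H))) ⟩
    ∑[ (a₁ , a₂) ∈ splits (value a) ] ∑[ (b₁ , b₂) ∈ splits (value b) ]
      (∑ (shuffles a₁ (b₁ ↑ size a)) F * ∑ (shuffles a₂ (b₂ ↑ size a)) H)
      -- Both parts carry the shift `size a` of the uncut word, which is far for the factors of `a`.
      ≈⟨ ∑-cong-∈ (splits (value a)) (λ a∈ → ∑-cong-∈ (splits (value b)) (λ b∈ → sym (factor a b a∈ b∈))) ⟩
    ∑[ (a₁ , a₂) ∈ splits (value a) ] ∑[ (b₁ , b₂) ∈ splits (value b) ]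
      (coefficient (Δ f) (cpark a₁ , cpark b₁) * coefficient (Δ g) (cpark a₂ , cpark b₂))
      ≈⟨ ·⊗-coefficient (Δ f) (Δ g) a b ⟨
    coefficient {PF⊗PF} (Δ f ·⊗ Δ g) (a , b) ∎
    where
    F H : Biword → Scalar
    F s = coefficient f (cpark s)
    H s = coefficient g (cpark s)
    factor : ∀ a b {a₁ a₂ b₁ b₂} → (a₁ , a₂) ∈ splits (value a) → (b₁ , b₂) ∈ splits (value b) →
      coefficient (Δ f) (cpark a₁ , cpark b₁) * coefficient (Δ g) (cpark a₂ , cpark b₂) ≈
      ∑ (shuffles a₁ (b₁ ↑ size a)) F * ∑ (shuffles a₂ (b₂ ↑ size a)) H
    factor a b {a₁} {a₂} {b₁} {b₂} a∈ b∈ with ∈-splits (value a) a∈ | ∈-splits (value b) b∈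
    ... | a₁≡ , a₂≡ | b₁≡ , b₂≡ = *-cong
      (coproduct-series f a₁ b₁ (subst (λ b → All (1 ≤_) (map proj₁ b)) (≡.sym b₁≡)
        (All.map⁺ (All.take⁺ (length b₁) pos)))
        (subst (λ a′ → Far (size a) (map proj₁ a′)) (≡.sym a₁≡) (far-take (length a₁) a)))
      (coproduct-series g a₂ b₂ (subst (λ b → All (1 ≤_) (map proj₁ b)) (≡.sym b₂≡)
        (All.map⁺ (All.drop⁺ (length b₁) pos)))
        (subst (λ a′ → Far (size a) (map proj₁ a′)) (≡.sym a₂≡) (far-drop (length a₁) a)))
      where pos = All.map⁻ (proj₁ (word-CountPF b))

  Δ-unit : Δ 1PQSym ≈ᴹ 1PQSym ⊗ 1PQSym
  Δ-unit = pointwise λ (a , b) → begin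
    coefficient {PF⊗PF} (Δ ⟨ ∅ ⟩) (a , b)
      ≈⟨ coefficient-extend {PF} {PF⊗PF} (λ c → ∑⟨ unshuffles c ⟩) ⟨ ∅ ⟩ (a , b) ⟩
    eval {PF} (λ c → coefficient {PF⊗PF} ∑⟨ unshuffles c ⟩ (a , b)) ⟨ ∅ ⟩
      ≈⟨ eval-⟨⟩ {PF} (λ c → coefficient {PF⊗PF} ∑⟨ unshuffles c ⟩ (a , b)) ∅ ⟩
    coefficient {PF⊗PF} ∑⟨ unshuffles ∅ ⟩ (a , b)
      ≈⟨ coefficient-unshuffles ∅ a b ⟩
    χ (value ∅ ∈? a ⋓ b)
      ≡⟨ χ-⇔ {P? = value ∅ ∈? a ⋓ b} {GradedBasis._≟_ PF⊗PF (∅ , ∅) (a , b)}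
           (λ []∈ → let e = ≡.sym (⋓-length a b []∈) in cong₂ _,_ (size-0 {a} (ℕ.m+n≡0⇒m≡0 (size a) e))
             (size-0 {b} (ℕ.m+n≡0⇒n≡0 (size a) e)))
           (λ { refl → here refl }) ⟩
    δ PF⊗PF (∅ , ∅) (a , b)
      ≈⟨ δ-⊗ PF PF ∅ ∅ a b ⟩
    δ PF ∅ a * δ PF ∅ b
      ≈⟨ *-cong (coefficient-1 a) (coefficient-1 b) ⟨
    coefficient 1PQSym a * coefficient 1PQSym b
      ≈⟨ coefficient-⊗ {PF} {PF} 1PQSym 1PQSym a b ⟨
    coefficient {PF⊗PF} (1PQSym ⊗ 1PQSym) (a , b) ∎

  isBialgebra : IsBialgebra PF _·_ 1PQSym Δ counit
  isBialgebra = record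
    { isAlgebra   = isAlgebra
    ; isCoalgebra = isCoalgebra
    ; Δ-∙         = Δ-multiplicative
    ; Δ-𝟙         = Δ-unit
    -- The empty word has a single split.
    ; ε-∙         = λ f g → trans (product-coefficient f g ∅) (+-identityʳ _)
    ; ε-𝟙         = +-identityʳ 1#
    }

  isGraded : IsGraded PF _·_ 1PQSym Δ counit
  isGraded = record
    { ∙-graded = λ {m} {n} {x} {y} hx hy c c≢ → trans (product-coefficient x y c)
        (∑-0 (splits (value c)) (λ {(p , q)} pq∈ → product-zero {m} {n} {x} {y} hx hy p q (λ e →
          c≢ (≡.trans (split-length c pq∈) e))))
    ; 𝟙-graded = λ c c≢0 → trans (coefficient-1 c) (χ-no {P? = ∅ ≟ c} (λ e → c≢0 (cong size (≡.sym e))))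
    ; Δ-graded = λ {n} {x} hx (a , b) ab≢ → trans (coproduct-coefficient x a b)
        (∑-0 (a ⋓ b) (λ {s} s∈ → hx (cpark s)
          (λ e → ab≢ (≡.trans (≡.sym (⋓-length a b s∈)) (≡.trans (≡.sym (size-cpark s)) e)))))
    ; ε-graded = λ n≢0 hx → hx ∅ (λ e → n≢0 (≡.sym e))
    }
    where
    split-length : ∀ c {p q} → (p , q) ∈ splits (value c) → size c ≡ length p ℕ.+ length q
    split-length c {p} {q} pq∈ with ∈-splits (value c) pq∈
    ... | p≡ , q≡ = ≡.trans (cong length (≡.sym (List.take++drop≡id (length p) (value c))))
      (≡.trans (cong length (cong₂ _++_ (≡.sym p≡) (≡.sym q≡))) (List.length-++ p))
    product-zero : ∀ {m n} {x y : PQSym} → Homogeneous m x → Homogeneous n y → ∀ p q →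
        length p ℕ.+ length q ≢ m ℕ.+ n →
                   coefficient x (cpark p) * coefficient y (cpark q) ≈ 0#
    product-zero {m} {n} hx hy p q ≢mn with length p ℕ.≟ m | length q ℕ.≟ n
    ... | no p≢m | _      = trans (*-congʳ (hx (cpark p) (λ e → p≢m (≡.trans (≡.sym (size-cpark p)) e))))
        (zeroˡ _)
    ... | yes _  | no q≢n = trans (*-congˡ (hy (cpark q) (λ e → q≢n (≡.trans (≡.sym (size-cpark q)) e))))
        (zeroʳ _)
    ... | yes refl | yes refl = ⊥-elim (≢mn refl)

  isConnected : IsConnected PF _·_ 1PQSym Δ counit
  isConnected = record
    { 𝟙-spans = λ x hx → coefficient x ∅ , pointwise λ c → trans (spans x hx c (size c ℕ.≟ 0))
        (sym (trans (coefficient-*ₗ (coefficient x ∅) 1PQSym c) (*-congˡ (coefficient-1 c))))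
    ; 𝟙-free  = λ s h → trans (sym (*-identityʳ s)) (trans (*-congˡ (sym (+-identityʳ 1#)))
        (trans (sym (coefficient-*ₗ s 1PQSym ∅)) (at h ∅)))
    }
    where
    spans : ∀ (x : PQSym) → Homogeneous 0 x → ∀ c → Dec (size c ≡ 0) →
        coefficient x c ≈ coefficient x ∅ * δ PF ∅ c
    spans x hx c (no c≢0) = trans (hx c c≢0)
        (sym (trans (*-congˡ (χ-no {P? = ∅ ≟ c} (λ e → c≢0 (cong size (≡.sym e))))) (zeroʳ _)))
    spans x hx c (yes c≡0) with size-0 {c} c≡0
    ... | refl = sym (*-identityʳ _)

  isGradedConnectedBialgebra : IsGradedConnectedBialgebra PF _·_ 1PQSym Δ counit
  isGradedConnectedBialgebra = record
    { isBialgebra = isBialgebra ; isGraded = isGraded ; isConnected = isConnected }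

-- Parkization over 𝔸 ⊕ 𝔸

𝔸⊕𝔸 : Set
𝔸⊕𝔸 = Letters (𝔸 ⊕ 𝔸)

letter-positive : ∀ (x : Letters 𝔸) → 1 ≤ value x
letter-positive (n , [ n≢0 ]) = ℕ.>-nonZero⁻¹ n {{recompute (ℕ.nonZero? n) n≢0}}

lefts rights : List 𝔸⊕𝔸 → List ℕ
lefts  w = map value (mapMaybe isInj₁ w)
rights w = map value (mapMaybe isInj₂ w)

-- What `parkLetter-left` and `parkLetter-right` give for any far shift: `N` has dropped out, and
-- right letters are parked above as many places as there are left letters.
parkLetter⊕ : List ℕ → List ℕ → 𝔸⊕𝔸 → ℕ
parkLetter⊕ v w (inj₁ x) = parkLetter v (value x)
parkLetter⊕ v w (inj₂ y) = length v ℕ.+ parkLetter w (value y)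

parkLetter⊕-↭ : ∀ {v v′ w w′} → v ↭ v′ → w ↭ w′ → ∀ z → parkLetter⊕ v w z ≡ parkLetter⊕ v′ w′ z
parkLetter⊕-↭ v↭ w↭ (inj₁ x) = parkLetter-↭ v↭ (value x)
parkLetter⊕-↭ v↭ w↭ (inj₂ y) = cong₂ ℕ._+_ (↭.↭-length v↭) (parkLetter-↭ w↭ (value y))

park⊕ : List 𝔸⊕𝔸 → List ℕ
park⊕ w = map (parkLetter⊕ (lefts w) (rights w)) w

module ≤⊕ = DecTotalOrder (𝔸 ⊕ 𝔸)
open SetoidMembership ≤⊕.Eq.setoid using () renaming (_∈_ to _∈⊕_)
open SetoidUnique ≤⊕.Eq.setoid using () renaming (Unique to Unique⊕)
open SetoidSubset ≤⊕.Eq.setoid using () renaming (_⊆_ to _⊆⊕_)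

rank-inj₁ : ∀ F x → rank (𝔸 ⊕ 𝔸) F (inj₁ x) ≡ count≤ (value x) (lefts F)
rank-inj₁ []           x = refl
rank-inj₁ (inj₁ z ∷ F) x with value z ≤? value x
... | yes p = ≡.trans (cong length (List.filter-accept (≤⊕._≤? inj₁ x) {xs = F} (₁∼₁ p)))
                (≡.trans (cong suc (rank-inj₁ F x)) (≡.sym (count≤-∷-yes (lefts F) p)))
... | no ¬p = ≡.trans (cong length (List.filter-reject (≤⊕._≤? inj₁ x) {xs = F} (¬p ∘ drop-inj₁)))
                (≡.trans (rank-inj₁ F x) (≡.sym (count≤-∷-no (lefts F) ¬p)))
rank-inj₁ (inj₂ z ∷ F) x = rank-inj₁ F x

rank-inj₂ : ∀ F y → rank (𝔸 ⊕ 𝔸) F (inj₂ y) ≡ length (lefts F) ℕ.+ count≤ (value y) (rights F)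
rank-inj₂ []           y = refl
rank-inj₂ (inj₁ z ∷ F) y = cong suc (rank-inj₂ F y)
rank-inj₂ (inj₂ z ∷ F) y with value z ≤? value y
... | yes p = ≡.trans (cong length (List.filter-accept (≤⊕._≤? inj₂ y) {xs = F} (₂∼₂ p)))
                (≡.trans (cong suc (rank-inj₂ F y)) (≡.trans (≡.sym (ℕ.+-suc _ _))
                  (cong (length (lefts F) ℕ.+_) (≡.sym (count≤-∷-yes (rights F) p)))))
... | no ¬p = ≡.trans (cong length (List.filter-reject (≤⊕._≤? inj₂ y) {xs = F} (¬p ∘ drop-inj₂)))
                (≡.trans (rank-inj₂ F y) (cong (length (lefts F) ℕ.+_) (≡.sym (count≤-∷-no (rights F) ¬p))))

All-lefts : ∀ {p} {P : ℕ → Set p} F → (∀ x → inj₁ x ∈ F → P (value x)) → All P (lefts F)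
All-lefts []           h = []
All-lefts (inj₁ x ∷ F) h = h x (here refl) ∷ All-lefts F (λ y → h y ∘ there)
All-lefts (inj₂ x ∷ F) h = All-lefts F (λ y → h y ∘ there)

All-rights : ∀ {p} {P : ℕ → Set p} F → (∀ y → inj₂ y ∈ F → P (value y)) → All P (rights F)
All-rights []           h = []
All-rights (inj₁ x ∷ F) h = All-rights F (λ y → h y ∘ there)
All-rights (inj₂ x ∷ F) h = h x (here refl) ∷ All-rights F (λ y → h y ∘ there)

lefts-unique : ∀ {F} → Unique⊕ F → Unique (lefts F)
lefts-unique {[]}         []         = []
lefts-unique {inj₁ x ∷ F} (x∉ ∷ F!) = All-lefts F (λ y y∈ x≡y → All.lookup x∉ y∈ (inj₁ x≡y)) ∷ lefts-unique F!
lefts-unique {inj₂ x ∷ F} (x∉ ∷ F!) = lefts-unique F!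

rights-unique : ∀ {F} → Unique⊕ F → Unique (rights F)
rights-unique {[]}         []         = []
rights-unique {inj₁ x ∷ F} (x∉ ∷ F!) = rights-unique F!
rights-unique {inj₂ x ∷ F} (x∉ ∷ F!) =
    All-rights F (λ y y∈ x≡y → All.lookup x∉ y∈ (inj₂ x≡y)) ∷ rights-unique F!

∈-lefts : ∀ {F x} → inj₁ x ∈⊕ F → value x ∈ lefts F
∈-lefts {inj₁ y ∷ F} (here (inj₁ x≡y)) = here x≡y
∈-lefts {inj₁ y ∷ F} (there x∈)        = there (∈-lefts x∈)
∈-lefts {inj₂ y ∷ F} (there x∈)        = ∈-lefts x∈

∈-rights : ∀ {F x} → inj₂ x ∈⊕ F → value x ∈ rights F
∈-rights {inj₂ y ∷ F} (here (inj₂ x≡y)) = here x≡y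
∈-rights {inj₂ y ∷ F} (there x∈)        = there (∈-rights x∈)
∈-rights {inj₁ y ∷ F} (there x∈)        = ∈-rights x∈

count≤-suc-∉ : ∀ {x xs} → suc x ∉ xs → count≤ (suc x) xs ≡ count≤ x xs
count≤-suc-∉ {x} {[]}     _  = refl
count≤-suc-∉ {x} {y ∷ xs} x∉ with y ≤? x
... | yes p rewrite count≤-∷-yes xs p | count≤-∷-yes xs (ℕ.m≤n⇒m≤1+n p) = cong suc (count≤-suc-∉ (x∉ ∘ there))
... | no ¬p rewrite count≤-∷-no xs ¬p | count≤-∷-no {suc x} xs (λ y≤ → x∉ (here (ℕ.≤-antisym (ℕ.≰⇒> ¬p) y≤))) =
  count≤-suc-∉ (x∉ ∘ there)

count≤-suc-∈ : ∀ {x xs} → Unique xs → suc x ∈ xs → count≤ (suc x) xs ≡ suc (count≤ x xs)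
count≤-suc-∈ {x} {_ ∷ xs} (x∉ ∷ xs!) (here refl)
  rewrite count≤-∷-yes xs (ℕ.≤-refl {suc x}) | count≤-∷-no {x} xs (ℕ.n≮n x) =
  cong suc (count≤-suc-∉ (λ x∈ → All.lookup x∉ x∈ refl))
count≤-suc-∈ {x} {y ∷ xs} (y∉ ∷ xs!) (there x∈) with y ≤? x
... | yes p rewrite count≤-∷-yes xs p | count≤-∷-yes xs (ℕ.m≤n⇒m≤1+n p) = cong suc (count≤-suc-∈ xs! x∈)
... | no ¬p rewrite count≤-∷-no xs ¬p | count≤-∷-no {suc x} xs
    (λ y≤ → All.lookup y∉ x∈ (ℕ.≤-antisym y≤ (ℕ.≰⇒> ¬p))) =
  count≤-suc-∈ xs! x∈

-- Each `x + 1` up to `m` occurs exactly once and adds one to the count. Hence in such a set the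
-- rank of a letter up to `m` is the letter itself.
count≤-interval : ∀ {m xs} → Unique xs → All (1 ≤_) xs → (∀ {i} → i < m → suc i ∈ xs) → ∀ {x} → x ≤ m →
    count≤ x xs ≡ x
count≤-interval {m} {xs} xs! pos full {zero}  _   = count≤-none xs pos
count≤-interval {m} {xs} xs! pos full {suc x} x<m = ≡.trans (count≤-suc-∈ xs! (full x<m))
  (cong suc (count≤-interval xs! pos full (ℕ.≤-trans (ℕ.n≤1+n x) x<m)))

count≤-lefts-rights : ∀ N i w → count≤ i (map [ value , (λ y → N ℕ.+ value y) ]′ w) ≡
                      count≤ i (lefts w) ℕ.+ count≤ i (map (N ℕ.+_) (rights w))
count≤-lefts-rights N i [] = refl
count≤-lefts-rights N i (inj₁ x ∷ w) with value x ≤? i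
... | yes p rewrite count≤-∷-yes (map [ value , (λ y → N ℕ.+ value y) ]′ w) p | count≤-∷-yes (lefts w) p =
  cong suc (count≤-lefts-rights N i w)
... | no ¬p rewrite count≤-∷-no (map [ value , (λ y → N ℕ.+ value y) ]′ w) ¬p | count≤-∷-no (lefts w) ¬p =
  count≤-lefts-rights N i w
count≤-lefts-rights N i (inj₂ y ∷ w) with N ℕ.+ value y ≤? i
... | yes p rewrite count≤-∷-yes (map [ value , (λ y → N ℕ.+ value y) ]′ w) p | count≤-∷-yes
    (map (N ℕ.+_) (rights w)) p =
  ≡.trans (cong suc (count≤-lefts-rights N i w)) (≡.sym (ℕ.+-suc (count≤ i (lefts w)) _))
... | no ¬p rewrite count≤-∷-no (map [ value , (λ y → N ℕ.+ value y) ]′ w) ¬p | count≤-∷-no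
    (map (N ℕ.+_) (rights w)) ¬p =
  count≤-lefts-rights N i w

∈⇒∈-lefts : ∀ {w x} → inj₁ x ∈ w → value x ∈ lefts w
∈⇒∈-lefts {w} = ∈-lefts ∘ Any.map ≤⊕.Eq.reflexive

∈⇒∈-rights : ∀ {w x} → inj₂ x ∈ w → value x ∈ rights w
∈⇒∈-rights {w} = ∈-rights ∘ Any.map ≤⊕.Eq.reflexive

-- A finite set of letters containing {1, …, m} on both sides, for m large, puts the right
-- letters far above the left ones.
park⊕-isParkization : ∀ w → IsParkization (𝔸 ⊕ 𝔸) w (park⊕ w)
park⊕-isParkization w = F₀ , λ F F! F₀⊆F → let open Ranks F F! F₀⊆F in
  ≡.trans (cong park ranks) (≡.trans (park≡parkMap positive) parked)
  where
  V = lefts w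
  W = rights w
  -- `far-beyond` asks for `sum V + length V`; adding `sum W` bounds the right letters as well.
  m = (sum V ℕ.+ length V) ℕ.+ sum W
  letter : ℕ → Letters 𝔸
  letter i = suc i , [ _ ]
  left right : ℕ → 𝔸⊕𝔸
  left  i = inj₁ (letter i)
  right i = inj₂ (letter i)
  F₀ = map left (upTo m) ++ map right (upTo m)

  V≤m : All (_≤ m) V
  V≤m = All.map (λ x≤ → ℕ.≤-trans x≤ (ℕ.≤-trans (ℕ.m≤m+n (sum V) _) (ℕ.m≤m+n _ (sum W)))) (letters≤sum V)
  W≤m : All (_≤ m) W
  W≤m = All.map (λ x≤ → ℕ.≤-trans x≤ (ℕ.m≤n+m (sum W) _)) (letters≤sum W)
  W-positive : All (1 ≤_) W
  W-positive = All-rights w (λ y _ → letter-positive y)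

  module Ranks F (F! : Unique⊕ F) (F₀⊆F : F₀ ⊆⊕ F) where
    -- `F` may contain further left letters, so the shift varies with `F` and is only known to be at
    -- least `m`.
    N = length (lefts F)
    f = [ value , (λ y → N ℕ.+ value y) ]′

    count-lefts : ∀ {x} → x ≤ m → count≤ x (lefts F) ≡ x
    count-lefts = count≤-interval (lefts-unique F!) (All-lefts F (λ x _ → letter-positive x)) λ i<m →
      ∈-lefts (F₀⊆F (Any.map ≤⊕.Eq.reflexive (∈.∈-++⁺ˡ (∈.∈-map⁺ left (∈.∈-upTo⁺ i<m)))))
    count-rights : ∀ {x} → x ≤ m → count≤ x (rights F) ≡ x
    count-rights = count≤-interval (rights-unique F!) (All-rights F (λ x _ → letter-positive x)) λ i<m →
      ∈-rights (F₀⊆F (Any.map ≤⊕.Eq.reflexive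
        (∈.∈-++⁺ʳ (map left (upTo m)) (∈.∈-map⁺ right (∈.∈-upTo⁺ i<m)))))

    rank≡ : ∀ {z} → z ∈ w → rank (𝔸 ⊕ 𝔸) F z ≡ f z
    rank≡ {inj₁ x} z∈ = ≡.trans (rank-inj₁ F x) (count-lefts (All.lookup V≤m (∈⇒∈-lefts z∈)))
    rank≡ {inj₂ y} z∈ = ≡.trans (rank-inj₂ F y) (cong (N ℕ.+_) (count-rights (All.lookup W≤m (∈⇒∈-rights z∈))))

    ranks : map (rank (𝔸 ⊕ 𝔸) F) w ≡ map f w
    ranks = List.map-cong-local (All.tabulate rank≡)

    positive : All (1 ≤_) (map f w)
    positive = All.map⁺ (All.universal (λ { (inj₁ x) → letter-positive x
                                          ; (inj₂ y) → ℕ.≤-trans (letter-positive y) (ℕ.m≤n+m (value y) N) }) w)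

    m≤N : m ≤ N
    m≤N = ℕ.≤-trans (ℕ.≤-reflexive (≡.sym (count-lefts ℕ.≤-refl))) (List.length-filter (_≤? m) (lefts F))

    far : height (λ i → count≤ i V) N ≡ length V
    far = far-beyond V (letters≤sum V) (ℕ.≤-trans (ℕ.m≤m+n _ (sum W)) m≤N)

    parked : parkMap (map f w) ≡ park⊕ w
    parked = ≡.trans (≡.sym (List.map-∘ w)) (List.map-cong-local (All.tabulate parkLetter≡))
      where
      split = λ i → count≤-lefts-rights N i w
      parkLetter≡ : ∀ {z} → z ∈ w → parkLetter (map f w) (f z) ≡ parkLetter⊕ V W z
      parkLetter≡ {inj₁ x} z∈ = parkLetter-left V W (map f w) W-positive split far
          (All.lookup (far⇒≤ V far) (∈⇒∈-lefts z∈))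
      parkLetter≡ {inj₂ y} z∈ = parkLetter-right V W (map f w) W-positive split far (letter-positive y)

-- Realization on colored words and the ordered sum.

module Realization {c r} (R : CommutativeRing c r) (ℓ : ℕ) where
  open CommutativeRing R hiding (refl) renaming (Carrier to Scalar)
  open PQSym R ℓ renaming (_∈_*_ to IsConvolution; _∈?_*_ to isConvolution?)
  open Sums R
  open LinearAlgebra R
  open ColoredParkization ℓ
  open Coefficients R ℓ
  open import Relation.Binary.Reasoning.Setoid setoid

  𝔸word = List (Letters 𝔸 × Color)

  underlying : 𝔸word → Biword
  underlying = map (map₁ value)

  underlying-positive : ∀ w → All (1 ≤_) (map proj₁ (underlying w))
  underlying-positive w = All.map⁺ (All.map⁺ (All.universal (letter-positive ∘ proj₁) w))

  zip-map : ∀ {X : Set} (f : X → ℕ) (w : List (X × Color)) → zip (map f (map proj₁ w)) (map proj₂ w)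
      ≡ map (map₁ f) w
  zip-map f []      = refl
  zip-map f (z ∷ w) = cong (_ ∷_) (zip-map f w)

  colored-park𝔸 : ∀ w → zip (park𝔸 (map proj₁ w)) (map proj₂ w) ≡ value (cpark (underlying w))
  colored-park𝔸 w = ≡.trans
    (cong (λ v → zip v (map proj₂ w)) (≡.trans
      (cong park (≡.sym letters≡)) (≡.trans (park≡parkMap (underlying-positive w))
        (≡.trans (cong parkMap letters≡)
        (≡.trans (≡.sym (List.map-∘ (map proj₁ w))) (cong (λ v → map (parkLetter v ∘ value) (map proj₁ w))
          (≡.sym letters≡)))))))
    (≡.trans (zip-map _ w) (List.map-∘ w))
    where
    letters≡ : map proj₁ (underlying w) ≡ map value (map proj₁ w)
    letters≡ = ≡.trans (≡.sym (List.map-∘ w)) (List.map-∘ w)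

  -- A word occurs in the series of exactly one `G a`, so the series of `f` at `w` reads off one
  -- coefficient.
  realize-coefficient : ∀ {X : Set} (p : List X → List ℕ) f w c →
    zip (p (map proj₁ w)) (map proj₂ w) ≡ value c → realize p f w ≈ coefficient f c
  realize-coefficient p f w c e = trans (eval-congˡ {PF} (λ a → reflexive (χ-⇔ {P? = _ ≟ᵇ value a} {a ≟ c}
      (λ e′ → Refinement.value-injective (≡.trans (≡.sym e′) e)) (λ e′ → ≡.trans e (≡.sym (cong value e′))))) f)
    (sym (eval-δ {PF} f c))

  realize⊗-coefficient : ∀ t v w → realize⊗ park𝔸 park𝔸 t v w
      ≈ coefficient t (cpark (underlying v) , cpark (underlying w))
  realize⊗-coefficient t v w = trans (eval-congˡ {PF⊗PF} (λ (a , b) → trans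
      (*-cong (trans (realize-coefficient park𝔸 (G a) v (cpark (underlying v)) (colored-park𝔸 v))
        (coefficient-⟨⟩ {PF} a (cpark (underlying v))))
              (trans (realize-coefficient park𝔸 (G b) w (cpark (underlying w)) (colored-park𝔸 w))
                (coefficient-⟨⟩ {PF} b (cpark (underlying w)))))
      (sym (δ-⊗ PF PF a b (cpark (underlying v)) (cpark (underlying w))))) t)
    (sym (eval-δ {PF⊗PF} t (cpark (underlying v) , cpark (underlying w))))

  leftWord : 𝔸word → List (𝔸⊕𝔸 × Color)
  leftWord = map (λ (x , u) → inj₁ x , u)

  rightWord : 𝔸word → List (𝔸⊕𝔸 × Color)
  rightWord = map (λ (y , u) → inj₂ y , u)

  lefts-words : ∀ v w → lefts (map proj₁ (leftWord v ++ rightWord w)) ≡ map proj₁ (underlying v)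
  lefts-words []      []      = refl
  lefts-words []      (y ∷ w) = lefts-words [] w
  lefts-words (x ∷ v) w       = cong (_ ∷_) (lefts-words v w)

  rights-words : ∀ v w → rights (map proj₁ (leftWord v ++ rightWord w)) ≡ map proj₁ (underlying w)
  rights-words []      []      = refl
  rights-words []      (y ∷ w) = cong (_ ∷_) (rights-words [] w)
  rights-words (x ∷ v) w       = rights-words v w

  -- The shuffles identified by commutation have the same left and right letters, hence are parked
  -- by one letter map, and that map carries them onto `a ⋓ b` with order and multiplicity.
  Δ-isOrderedSumCoproduct : IsOrderedSumCoproduct park⊕ Δ
  Δ-isOrderedSumCoproduct f v w = begin
    realize⊗ park𝔸 park𝔸 (Δ f) v w
      ≈⟨ realize⊗-coefficient (Δ f) v w ⟩
    coefficient (Δ f) (a , b)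
      ≈⟨ coproduct-coefficient f a b ⟩
    ∑[ t ∈ a ⋓ b ] coefficient f (cpark t)
      ≡⟨ cong (λ ts → ∑[ t ∈ ts ] coefficient f (cpark t)) a⋓b ⟩
    ∑[ t ∈ map parkₛ ss ] coefficient f (cpark t)
      ≡⟨ ∑-map parkₛ ss _ ⟩
    ∑[ s ∈ ss ] coefficient f (cpark (parkₛ s))
      ≈⟨ ∑-cong-∈ ss (λ {s} s∈ → sym (realize-coefficient park⊕ f s (cpark (parkₛ s)) (parked s∈))) ⟩
    ∑[ s ∈ ss ] realize park⊕ f s
      ≡⟨ List.foldr-map _+_ (realize park⊕ f) 0# ss ⟨
    commute (realize park⊕ f) v w ∎
    where
    a = cpark (underlying v)
    b = cpark (underlying w)
    V = map proj₁ (underlying v)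
    W = map proj₁ (underlying w)
    ss = shuffles (leftWord v) (rightWord w)
    parkₛ : List (𝔸⊕𝔸 × Color) → Biword
    parkₛ = map (map₁ (parkLetter⊕ V W))
    a⋓b : a ⋓ b ≡ map parkₛ ss
    a⋓b = ≡.trans (cong₂ shuffles
        (≡.trans (≡.sym (List.map-∘ v)) (List.map-∘ v))
        (≡.trans (≡.sym (List.map-∘ (underlying w))) (≡.trans (≡.sym (List.map-∘ w)) (≡.trans
          (List.map-cong (λ (y , u) → cong (λ n → n ℕ.+ parkLetter W (value y) , u)
            (≡.trans (size-cpark (underlying v)) (≡.sym (List.length-map proj₁ (underlying v))))) w)
              (List.map-∘ w)))))
      (shuffles-map ℓ (map₁ (parkLetter⊕ V W)) (leftWord v) (rightWord w))
    parked : ∀ {s} → s ∈ ss → zip (park⊕ (map proj₁ s)) (map proj₂ s) ≡ value (cpark (parkₛ s))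
    parked {s} s∈ = ≡.trans (zip-map (parkLetter⊕ _ _) s) (≡.trans
      (List.map-cong (λ (z , u) → cong (_, u) (parkLetter⊕-↭ lefts↭ rights↭ z)) s)
      (≡.sym (⋓-parking a b (subst (parkₛ s ∈_) (≡.sym a⋓b) (∈.∈-map⁺ parkₛ s∈)))))
      where
      letters↭ = ↭.map⁺ proj₁ (shuffles-↭ ℓ (leftWord v) (rightWord w) s∈)
      lefts↭  = subst (lefts (map proj₁ s) ↭_) (lefts-words v w) (↭.map⁺ value (↭.mapMaybe-↭ isInj₁ letters↭))
      rights↭ = subst (rights (map proj₁ s) ↭_) (rights-words v w) (↭.map⁺ value (↭.mapMaybe-↭ isInj₂ letters↭))

  -- The parking function, read as a word over the alphabet, has itself as parkization. So
  -- realization sees every coefficient.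
  lift : ∀ a → ∃ λ v → underlying v ≡ value a
  lift a = go (value a) (All.map⁻ (proj₁ (word-CountPF a)))
    where
    go : ∀ w → All (λ z → 1 ≤ proj₁ z) w → ∃ λ v → underlying v ≡ w
    go []                []        = [] , refl
    go ((suc x , u) ∷ w) (_ ∷ pos) with go w pos
    ... | v , e = ((suc x , [ _ ]) , u) ∷ v , cong (_ ∷_) e

  -- Every pair of basis elements is the parkization of some pair of words, so the realized series
  -- determines all coefficients.
  orderedSumCoproduct-unique : ∀ Δ′ → IsOrderedSumCoproduct park⊕ Δ′ → ∀ f → Δ′ f ≈ᴹ Δ f
  orderedSumCoproduct-unique Δ′ isΔ′ f = pointwise λ (a , b) → equal a b (lift a) (lift b)
    where
    equal : ∀ a b → (∃ λ v → underlying v ≡ value a) → (∃ λ w → underlying w ≡ value b) →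
            coefficient (Δ′ f) (a , b) ≈ coefficient (Δ f) (a , b)
    equal a b (v , v≡) (w , w≡) = begin
      coefficient (Δ′ f) (a , b) ≡⟨ cong₂ (λ a b → coefficient (Δ′ f) (a , b)) a≡ b≡ ⟨
      coefficient (Δ′ f) (cpark (underlying v) , cpark (underlying w)) ≈⟨ realize⊗-coefficient (Δ′ f) v w ⟨
      realize⊗ park𝔸 park𝔸 (Δ′ f) v w ≈⟨ trans (isΔ′ f v w) (sym (Δ-isOrderedSumCoproduct f v w)) ⟩
      realize⊗ park𝔸 park𝔸 (Δ f) v w ≈⟨ realize⊗-coefficient (Δ f) v w ⟩
      coefficient (Δ f) (cpark (underlying v) , cpark (underlying w))
        ≡⟨ cong₂ (λ a b → coefficient (Δ f) (a , b)) a≡ b≡ ⟩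
      coefficient (Δ f) (a , b) ∎
      where
      a≡ = ≡.trans (cong cpark v≡) (cpark-value a)
      b≡ = ≡.trans (cong cpark w≡) (cpark-value b)

  Δ-G : ∀ a → Δ (G a) ≈ᴹ ∑⟨ unshuffles a ⟩
  Δ-G a = pointwise λ b → trans (coefficient-extend {PF} {PF⊗PF} (λ c → ∑⟨ unshuffles c ⟩) (G a) b)
    (eval-⟨⟩ {PF} (λ c → coefficient {PF⊗PF} ∑⟨ unshuffles c ⟩ b) a)

-- Calculus of linear extensions.

module Extension {c r} (R : CommutativeRing c r) where
  open CommutativeRing R hiding (refl) renaming (Carrier to Scalar)
  open FreeModule R
  open LinearAlgebra R
  private
    module M B = Module (free B)

  -- Agreement is required only where the coefficient may be nonzero; homogeneity of the coproduct
  -- enters the antipode through this.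
  extend-cong-on : ∀ {B C} (f g : Index B → Free C) (x : Free B) →
                   (∀ b → coefficient x b ≈ 0# ⊎ f b ≈ᴹ g b) → extend f x ≈ᴹ extend g x
  extend-cong-on f g x h = pointwise λ c → trans (coefficient-extend f x c) (trans
    (eval-cong-on x (λ b → [ inj₁ , (λ e → inj₂ (at e c)) ]′ (h b))) (sym (coefficient-extend g x c)))
    where open Data.Sum.Base using ([_,_]′)

  extend-congˡ : ∀ {B C} (f g : Index B → Free C) (x : Free B) → (∀ b → f b ≈ᴹ g b) → extend f x ≈ᴹ extend g x
  extend-congˡ f g x h = extend-cong-on f g x (λ b → inj₂ (h b))

  extend-cong : ∀ {B C} (f : Index B → Free C) {x y : Free B} → x ≈ᴹ y → extend f x ≈ᴹ extend f y
  extend-cong {B} {C} f {x} {y} = IsModuleHomomorphism.⟦⟧-cong (extend-linear {B} {C} f) {x} {y}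

  extend-⟨⟩ : ∀ {B C} (f : Index B → Free C) b → extend {B} f ⟨ b ⟩ ≈ᴹ f b
  extend-⟨⟩ {B} {C} f b = pointwise λ c → trans (coefficient-extend {B} {C} f ⟨ b ⟩ c)
    (eval-⟨⟩ {B} (λ b → coefficient (f b) c) b)

  extend-identity : ∀ {B} (x : Free B) → extend ⟨_⟩ x ≈ᴹ x
  extend-identity {B} x = pointwise λ b → trans (coefficient-extend {B} {B} ⟨_⟩ x b) (trans
    (eval-congˡ {B} (λ b′ → coefficient-⟨⟩ {B} b′ b) x) (sym (eval-δ {B} x b)))

  extend-+ : ∀ {B C} (f g : Index B → Free C) (x : Free B) →
      extend (λ b → f b +ᴹ g b) x ≈ᴹ extend f x +ᴹ extend g x
  extend-+ {B} {C} f g x = pointwise λ c → trans (coefficient-extend {B} {C} (λ b → f b +ᴹ g b) x c) (trans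
    (eval-congˡ {B} (λ b → coefficient-+ (f b) (g b) c) x) (trans
    (eval-add {B} _ _ x) (trans (sym (+-cong (coefficient-extend f x c) (coefficient-extend g x c)))
    (sym (coefficient-+ (extend f x) (extend g x) c)))))

  extend-*ₗ : ∀ {B C} s (f : Index B → Free C) (x : Free B) → extend (λ b → s *ₗ f b) x ≈ᴹ s *ₗ extend f x
  extend-*ₗ {B} {C} s f x = pointwise λ c → trans (coefficient-extend {B} {C} (λ b → s *ₗ f b) x c) (trans
    (eval-congˡ {B} (λ b → coefficient-*ₗ s (f b) c) x) (trans
    (eval-scale {B} s _ x) (trans (*-congˡ (sym (coefficient-extend f x c)))
    (sym (coefficient-*ₗ s (extend f x) c)))))

  extend-∘ : ∀ {A B C} (L : Free B → Free C) → IsLinear (free B) (free C) L →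
      (f : Index A → Free B) (x : Free A) →
             L (extend f x) ≈ᴹ extend (L ∘ f) x
  extend-∘ {A} {B} {C} L L-linear f ⟦ ts ⟧ = go ts
    where
    open IsModuleHomomorphism L-linear
    open M C using (≈ᴹ-trans; +ᴹ-cong)
    go : ∀ ts → L (extend {A} f ⟦ ts ⟧) ≈ᴹ extend {A} (L ∘ f) ⟦ ts ⟧
    go []             = 0ᴹ-homo
    go ((s , a) ∷ ts) = ≈ᴹ-trans (+ᴹ-homo (s *ₗ f a) (extend {A} f ⟦ ts ⟧)) (+ᴹ-cong (*ₗ-homo s (f a)) (go ts))

  linear-extend : ∀ {B C} (L : Free B → Free C) → IsLinear (free B) (free C) L → ∀ x →
      L x ≈ᴹ extend (λ b → L ⟨ b ⟩) x
  linear-extend {B} {C} L L-linear x = M.≈ᴹ-trans C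
    (IsModuleHomomorphism.⟦⟧-cong L-linear (M.≈ᴹ-sym B (extend-identity x))) (extend-∘ {B} L L-linear ⟨_⟩ x)

  extend-extend : ∀ {A B C} (g : Index B → Free C) (f : Index A → Free B) (x : Free A) →
                  extend g (extend f x) ≈ᴹ extend (λ a → extend g (f a)) x
  extend-extend {A} {B} {C} g f x = extend-∘ {A} {B} {C} (extend g) (extend-linear {B} {C} g) f x

  extend-⊗ : ∀ {B B′ C} (h : Index B × Index B′ → Free C) (x : Free B) (y : Free B′) →
             extend {B ⊗ᵇ B′} h (x ⊗ y) ≈ᴹ extend (λ b → extend (λ b′ → h (b , b′)) y) x
  extend-⊗ {B} {B′} {C} h x y = M.≈ᴹ-trans C (extend-extend {B} {B ⊗ᵇ B′} {C} h
      (λ b → extend (λ b′ → ⟨ b , b′ ⟩) y) x)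
    (extend-congˡ {B} {C} _ _ x (λ b → M.≈ᴹ-trans C (extend-extend {B′} {B ⊗ᵇ B′} {C} h (λ b′ → ⟨ b , b′ ⟩) y)
      (extend-congˡ {B′} {C} _ _ y (λ b′ → extend-⟨⟩ {B ⊗ᵇ B′} {C} h (b , b′)))))

-- The antipode of a graded connected bialgebra.

module ConnectedAntipode {c r} (R : CommutativeRing c r) where
  open FreeModule R

  -- With J = id − u, where u is the unit of the convolution product ⋆, the antipode is the
  -- geometric series u − J + J ⋆ J − …: J vanishes in degree 0 because the bialgebra is
  -- connected, so that only the terms up to the degree of the argument contribute.
  module Antipode
    (B : GradedBasis) (_∙_ : Free B → Free B → Free B) (𝟙 : Free B)
    (Δ : Free B → Free (B ⊗ᵇ B)) (ε : Free B → CommutativeRing.Carrier R)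
    (H : IsGradedConnectedBialgebra B _∙_ 𝟙 Δ ε) where

    open CommutativeRing R using (_≈_; 0#; 1#; _*_; trans; sym; *-identityʳ)
    private module R = CommutativeRing R
    open LinearAlgebra R
    open Extension R
    open IsGradedConnectedBialgebra H
    open IsBialgebra isBialgebra
    open IsAlgebra isAlgebra
    open IsCoalgebra isCoalgebra
    open IsGraded isGraded
    open IsConnected isConnected

    private
      B² = B ⊗ᵇ B

      A : Ring _ _
      A = record { isRing = isRing }
      module A = Ring A
      module M = Module (free B)
      module A′ = RingProperties A
      open import Relation.Binary.Reasoning.Setoid A.setoid

      -- A linear endomorphism, given by its values on the basis.
      Map : Set c
      Map = Index B → Free B

    infixl 7 _⋆_
    infix  4 _≗_
    infixl 6 _⊖_

    _≗_ : Map → Map → Set _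
    f ≗ g = ∀ b → f b ≈ᴹ g b

    _⊖_ : Map → Map → Map
    (f ⊖ g) b = f b +ᴹ -ᴹ g b

    _∙²_ : Map → Map → Index B × Index B → Free B
    (f ∙² g) (b₁ , b₂) = f b₁ ∙ g b₂

    _⋆_ : Map → Map → Map
    (f ⋆ g) b = extend {B²} {B} (f ∙² g) (Δ ⟨ b ⟩)

    u : Map
    u b = ε ⟨ b ⟩ *ₗ 𝟙

    Δ-homogeneous : ∀ b b₁ b₂ → degree B b₁ ℕ.+ degree B b₂ ≢ degree B b → coefficient (Δ ⟨ b ⟩) (b₁ , b₂) ≈ 0#
    Δ-homogeneous b b₁ b₂ = Δ-graded {x = ⟨ b ⟩} ⟨⟩-homogeneous (b₁ , b₂)
      where
      ⟨⟩-homogeneous : Homogeneous {B} (degree B b) ⟨ b ⟩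
      ⟨⟩-homogeneous b′ b′≢b = trans (coefficient-⟨⟩ {B} b b′)
        (χ-no {P? = GradedBasis._≟_ B b b′} (λ b≡b′ → b′≢b (cong (degree B) (≡.sym b≡b′))))

    -- Since `Δ` is graded, only pairs whose degrees add up to that of `b` contribute. The
    -- inductions on degree rest on this.
    ⋆-cong-on : ∀ {f f′ g g′ : Map} b →
      (∀ b₁ b₂ → degree B b₁ ℕ.+ degree B b₂ ≡ degree B b → f b₁ ∙ g b₂ ≈ᴹ f′ b₁ ∙ g′ b₂) →
      (f ⋆ g) b ≈ᴹ (f′ ⋆ g′) b
    ⋆-cong-on {f} {f′} {g} {g′} b h = extend-cong-on {B²} {B} (f ∙² g) (f′ ∙² g′) (Δ ⟨ b ⟩) λ (b₁ , b₂) →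
      by-degree b₁ b₂ (degree B b₁ ℕ.+ degree B b₂ ℕ.≟ degree B b)
      where
      by-degree : ∀ b₁ b₂ → Dec (degree B b₁ ℕ.+ degree B b₂ ≡ degree B b) →
                  coefficient (Δ ⟨ b ⟩) (b₁ , b₂) ≈ 0# ⊎ f b₁ ∙ g b₂ ≈ᴹ f′ b₁ ∙ g′ b₂
      by-degree b₁ b₂ (yes e) = inj₂ (h b₁ b₂ e)
      by-degree b₁ b₂ (no ≢)  = inj₁ (Δ-homogeneous b b₁ b₂ ≢)

    ⋆-cong : ∀ {f f′ g g′} → f ≗ f′ → g ≗ g′ → f ⋆ g ≗ f′ ⋆ g′
    ⋆-cong f≗ g≗ b = ⋆-cong-on b (λ b₁ b₂ _ → A.*-cong (f≗ b₁) (g≗ b₂))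

    extend-⊖ : ∀ (f g : Index B² → Free B) (x : Free B²) →
               extend {B²} {B} (λ b → f b +ᴹ -ᴹ g b) x ≈ᴹ extend {B²} {B} f x +ᴹ -ᴹ extend {B²} {B} g x
    extend-⊖ f g x = A.trans (extend-+ {B²} {B} f (λ b → -ᴹ g b) x)
        (A.+-congˡ (extend-*ₗ {B²} {B} (R.- 1#) g x))

    ⋆-⊖ˡ : ∀ f g h → (f ⊖ g) ⋆ h ≗ f ⋆ h ⊖ g ⋆ h
    ⋆-⊖ˡ f g h b = A.trans
      (extend-congˡ {B²} {B} _ _ (Δ ⟨ b ⟩) (λ (b₁ , b₂) → A.trans (A.distribʳ (h b₂) (f b₁) (-ᴹ g b₁))
        (A.+-congˡ (A.sym (A′.-‿distribˡ-* (g b₁) (h b₂))))))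
      (extend-⊖ (f ∙² h) (g ∙² h) (Δ ⟨ b ⟩))

    ⋆-⊖ʳ : ∀ f g h → f ⋆ (g ⊖ h) ≗ f ⋆ g ⊖ f ⋆ h
    ⋆-⊖ʳ f g h b = A.trans
      (extend-congˡ {B²} {B} _ _ (Δ ⟨ b ⟩) (λ (b₁ , b₂) → A.trans (A.distribˡ (f b₁) (g b₂) (-ᴹ h b₂))
        (A.+-congˡ (A.sym (A′.-‿distribʳ-* (f b₁) (h b₂))))))
      (extend-⊖ (f ∙² g) (f ∙² h) (Δ ⟨ b ⟩))

    ⋆-identityˡ : ∀ f → u ⋆ f ≗ f
    ⋆-identityˡ f b = begin
      extend {B²} {B} (u ∙² f) (Δ ⟨ b ⟩)
        ≈⟨ extend-congˡ {B²} {B} _ _ (Δ ⟨ b ⟩) (λ (b₁ , b₂) → A.trans (*ₗ-∙ (ε ⟨ b₁ ⟩) 𝟙 (f b₂)) (A.trans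
             (M.*ₗ-congˡ (A.*-identityˡ (f b₂))) (A.sym (A.trans
             (IsModuleHomomorphism.*ₗ-homo (extend-linear {B} {B} f) (ε ⟨ b₁ ⟩) ⟨ b₂ ⟩)
             (M.*ₗ-congˡ (extend-⟨⟩ {B} {B} f b₂)))))) ⟩
      extend {B²} {B} (λ (b₁ , b₂) → extend {B} f (ε ⟨ b₁ ⟩ *ₗ ⟨ b₂ ⟩)) (Δ ⟨ b ⟩)
        ≈⟨ extend-extend {B²} {B} {B} f (λ (b₁ , b₂) → ε ⟨ b₁ ⟩ *ₗ ⟨ b₂ ⟩) (Δ ⟨ b ⟩) ⟨
      extend {B} f (ε⊗id B Δ ε (Δ ⟨ b ⟩))
        ≈⟨ extend-cong {B} {B} f (counitˡ ⟨ b ⟩) ⟩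
      extend {B} f ⟨ b ⟩
        ≈⟨ extend-⟨⟩ {B} {B} f b ⟩
      f b ∎

    ⋆-identityʳ : ∀ f → f ⋆ u ≗ f
    ⋆-identityʳ f b = begin
      extend {B²} {B} (f ∙² u) (Δ ⟨ b ⟩)
        ≈⟨ extend-congˡ {B²} {B} _ _ (Δ ⟨ b ⟩) (λ (b₁ , b₂) → A.trans (∙-*ₗ (ε ⟨ b₂ ⟩) (f b₁) 𝟙) (A.trans
             (M.*ₗ-congˡ (A.*-identityʳ (f b₁))) (A.sym (A.trans
             (IsModuleHomomorphism.*ₗ-homo (extend-linear {B} {B} f) (ε ⟨ b₂ ⟩) ⟨ b₁ ⟩)
             (M.*ₗ-congˡ (extend-⟨⟩ {B} {B} f b₁)))))) ⟩
      extend {B²} {B} (λ (b₁ , b₂) → extend {B} f (ε ⟨ b₂ ⟩ *ₗ ⟨ b₁ ⟩)) (Δ ⟨ b ⟩)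
        ≈⟨ extend-extend {B²} {B} {B} f (λ (b₁ , b₂) → ε ⟨ b₂ ⟩ *ₗ ⟨ b₁ ⟩) (Δ ⟨ b ⟩) ⟨
      extend {B} f (id⊗ε B Δ ε (Δ ⟨ b ⟩))
        ≈⟨ extend-cong {B} {B} f (counitʳ ⟨ b ⟩) ⟩
      extend {B} f ⟨ b ⟩
        ≈⟨ extend-⟨⟩ {B} {B} f b ⟩
      f b ∎

    ∙-linearˡ : ∀ y → IsLinear (free B) (free B) (_∙ y)
    ∙-linearˡ y = linear (free B) (free B) (_∙ y) A.*-congʳ (A.distribʳ y) (λ s x → *ₗ-∙ s x y)

    ∙-linearʳ : ∀ x → IsLinear (free B) (free B) (x ∙_)
    ∙-linearʳ x = linear (free B) (free B) (x ∙_) A.*-congˡ (A.distribˡ x) (λ s y → ∙-*ₗ s x y)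

    -- Both sides extend a triple product over a twofold coproduct; associativity matches `Φ` with
    -- `Ψ`, coassociativity the coproducts.
    ⋆-assoc : ∀ f g h → (f ⋆ g) ⋆ h ≗ f ⋆ (g ⋆ h)
    ⋆-assoc f g h b = begin
      ((f ⋆ g) ⋆ h) b
        ≈⟨ extend-congˡ {B²} {B} _ _ (Δ ⟨ b ⟩) (λ (b₁ , b₂) → A.sym (left b₁ b₂)) ⟩
      extend {B²} {B} (λ (b₁ , b₂) → extend {B² ⊗ᵇ B} Φ (Δ ⟨ b₁ ⟩ ⊗ ⟨ b₂ ⟩)) (Δ ⟨ b ⟩)
        ≈⟨ extend-extend {B²} {B² ⊗ᵇ B} {B} Φ (λ (b₁ , b₂) → Δ ⟨ b₁ ⟩ ⊗ ⟨ b₂ ⟩) (Δ ⟨ b ⟩) ⟨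
      extend {B² ⊗ᵇ B} Φ ((Δ ⊗ᶠ id) (Δ ⟨ b ⟩))
        ≈⟨ extend-congˡ {B² ⊗ᵇ B} {B} _ _ ((Δ ⊗ᶠ id) (Δ ⟨ b ⟩))
          (λ ((b₁ , b₂) , b₃) → A.trans (A.*-assoc (f b₁) (g b₂) (h b₃))
             (A.sym (extend-⟨⟩ {B ⊗ᵇ B²} {B} Ψ (b₁ , (b₂ , b₃))))) ⟩
      extend {B² ⊗ᵇ B} (λ ((b₁ , b₂) , b₃) → extend {B ⊗ᵇ B²} Ψ ⟨ b₁ , (b₂ , b₃) ⟩) ((Δ ⊗ᶠ id) (Δ ⟨ b ⟩))
        ≈⟨ extend-extend {B² ⊗ᵇ B} {B ⊗ᵇ B²} {B} Ψ (λ ((b₁ , b₂) , b₃) → ⟨ b₁ , (b₂ , b₃) ⟩)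
          ((Δ ⊗ᶠ id) (Δ ⟨ b ⟩)) ⟨
      extend {B ⊗ᵇ B²} Ψ (associator {B} {B} {B} ((Δ ⊗ᶠ id) (Δ ⟨ b ⟩)))
        ≈⟨ extend-cong {B ⊗ᵇ B²} {B} Ψ (coassociative ⟨ b ⟩) ⟩
      extend {B ⊗ᵇ B²} Ψ ((id ⊗ᶠ Δ) (Δ ⟨ b ⟩))
        ≈⟨ extend-extend {B²} {B ⊗ᵇ B²} {B} Ψ (λ (b₁ , b₂) → ⟨ b₁ ⟩ ⊗ Δ ⟨ b₂ ⟩) (Δ ⟨ b ⟩) ⟩
      extend {B²} {B} (λ (b₁ , b₂) → extend {B ⊗ᵇ B²} Ψ (⟨ b₁ ⟩ ⊗ Δ ⟨ b₂ ⟩)) (Δ ⟨ b ⟩)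
        ≈⟨ extend-congˡ {B²} {B} _ _ (Δ ⟨ b ⟩) (λ (b₁ , b₂) → right b₁ b₂) ⟩
      (f ⋆ (g ⋆ h)) b ∎
      where
      Φ : (Index B × Index B) × Index B → Free B
      Φ ((b₁ , b₂) , b₃) = (f b₁ ∙ g b₂) ∙ h b₃
      Ψ : Index B × (Index B × Index B) → Free B
      Ψ (b₁ , (b₂ , b₃)) = f b₁ ∙ (g b₂ ∙ h b₃)
      left : ∀ b₁ b₂ → extend {B² ⊗ᵇ B} Φ (Δ ⟨ b₁ ⟩ ⊗ ⟨ b₂ ⟩) ≈ᴹ (f ⋆ g) b₁ ∙ h b₂
      left b₁ b₂ = begin
        extend {B² ⊗ᵇ B} Φ (Δ ⟨ b₁ ⟩ ⊗ ⟨ b₂ ⟩)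
          ≈⟨ extend-⊗ {B²} {B} {B} Φ (Δ ⟨ b₁ ⟩) ⟨ b₂ ⟩ ⟩
        extend {B²} {B} (λ b → extend {B} (λ b′ → Φ (b , b′)) ⟨ b₂ ⟩) (Δ ⟨ b₁ ⟩)
          ≈⟨ extend-congˡ {B²} {B} _ _ (Δ ⟨ b₁ ⟩) (λ b → extend-⟨⟩ {B} {B} (λ b′ → Φ (b , b′)) b₂) ⟩
        extend {B²} {B} (λ b → Φ (b , b₂)) (Δ ⟨ b₁ ⟩)
          ≈⟨ extend-∘ {B²} {B} {B} (_∙ h b₂) (∙-linearˡ (h b₂)) (f ∙² g) (Δ ⟨ b₁ ⟩) ⟨
        (f ⋆ g) b₁ ∙ h b₂ ∎
      right : ∀ b₁ b₂ → extend {B ⊗ᵇ B²} Ψ (⟨ b₁ ⟩ ⊗ Δ ⟨ b₂ ⟩) ≈ᴹ f b₁ ∙ (g ⋆ h) b₂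
      right b₁ b₂ = begin
        extend {B ⊗ᵇ B²} Ψ (⟨ b₁ ⟩ ⊗ Δ ⟨ b₂ ⟩)
          ≈⟨ extend-⊗ {B} {B²} {B} Ψ ⟨ b₁ ⟩ (Δ ⟨ b₂ ⟩) ⟩
        extend {B} {B} (λ b → extend {B²} (λ b′ → Ψ (b , b′)) (Δ ⟨ b₂ ⟩)) ⟨ b₁ ⟩
          ≈⟨ extend-⟨⟩ {B} {B} (λ b → extend {B²} (λ b′ → Ψ (b , b′)) (Δ ⟨ b₂ ⟩)) b₁ ⟩
        extend {B²} (λ b′ → Ψ (b₁ , b′)) (Δ ⟨ b₂ ⟩)
          ≈⟨ extend-∘ {B²} {B} {B} (f b₁ ∙_) (∙-linearʳ (f b₁)) (g ∙² h) (Δ ⟨ b₂ ⟩) ⟨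
        f b₁ ∙ (g ⋆ h) b₂ ∎

    J : Map
    J = ⟨_⟩ ⊖ u

    -- By connectedness `⟨ b ⟩` is a multiple of `𝟙`; applying `ε` identifies the scalar as
    -- `ε ⟨ b ⟩`, so `⟨ b ⟩` equals `u b`.
    J-degree-0 : ∀ b → degree B b ≡ 0 → J b ≈ᴹ 0ᴹ
    J-degree-0 b b≡0 with 𝟙-spans ⟨ b ⟩ homogeneous
      where
      homogeneous : Homogeneous {B} 0 ⟨ b ⟩
      homogeneous b′ b′≢0 = trans (coefficient-⟨⟩ {B} b b′)
        (χ-no {P? = GradedBasis._≟_ B b b′} (λ { refl → b′≢0 b≡0 }))
    ... | s , b≈s = A.trans (A.+-congʳ (A.trans b≈s (M.*ₗ-congʳ (sym ε≈s)))) (A.-‿inverseʳ (u b))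
      where
      ε≈s : ε ⟨ b ⟩ ≈ s
      ε≈s = trans (IsModuleHomomorphism.⟦⟧-cong ε-linear b≈s) (trans (IsModuleHomomorphism.*ₗ-homo ε-linear s 𝟙)
        (trans (R.*-congˡ ε-𝟙) (*-identityʳ s)))

    -- The partial sums of the geometric series, in Horner form.
    S⟨_⟩ : ℕ → Map
    S⟨ zero  ⟩ = u
    S⟨ suc n ⟩ = u ⊖ S⟨ n ⟩ ⋆ J

    private
      minus : ∀ {x y y′} → y ≈ᴹ y′ → x +ᴹ -ᴹ y ≈ᴹ x +ᴹ -ᴹ y′
      minus e = A.+-congˡ (A.-‿cong e)

      recombine : ∀ x y → x +ᴹ -ᴹ y +ᴹ y ≈ᴹ x
      recombine x y = A.trans (A.+-assoc x (-ᴹ y) y) (A.trans (A.+-congˡ (A.-‿inverseˡ y)) (A.+-identityʳ x))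

    -- `J` kills the second components of degree 0, so the first ones that matter have degree
    -- strictly below that of `b`.
    ⋆J-cong-on : ∀ {f g : Map} b → (∀ b₁ → degree B b₁ ℕ.< degree B b → f b₁ ≈ᴹ g b₁) → (f ⋆ J) b ≈ᴹ (g ⋆ J) b
    ⋆J-cong-on {f} {g} b h = ⋆-cong-on b λ b₁ b₂ e → by-degree b₁ b₂ e (degree B b₂ ℕ.≟ 0)
      where
      by-degree : ∀ b₁ b₂ → degree B b₁ ℕ.+ degree B b₂ ≡ degree B b → Dec (degree B b₂ ≡ 0) →
          f b₁ ∙ J b₂ ≈ᴹ g b₁ ∙ J b₂
      by-degree b₁ b₂ e (yes b₂≡0) = A.trans (A.trans (A.*-congˡ (J-degree-0 b₂ b₂≡0)) (A.zeroʳ (f b₁)))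
        (A.sym (A.trans (A.*-congˡ (J-degree-0 b₂ b₂≡0)) (A.zeroʳ (g b₁))))
      by-degree b₁ b₂ e (no b₂≢0)  =
          A.*-congʳ (h b₁ (ℕ.<-≤-trans (ℕ.m<m+n (degree B b₁) (ℕ.n≢0⇒n>0 b₂≢0)) (ℕ.≤-reflexive e)))

    -- Convolving with `J` raises by one the degree up to which two maps agree; the induction starts
    -- from `J` vanishing in degree 0.
    S-step : ∀ n b → degree B b ≤ n → S⟨ suc n ⟩ b ≈ᴹ S⟨ n ⟩ b
    S-step zero    b b≤0 = A.trans (minus (A.trans (⋆-identityˡ J b) (J-degree-0 b (ℕ.n≤0⇒n≡0 b≤0))))
      (A.trans (A.+-congˡ A′.-0#≈0#) (A.+-identityʳ (u b)))
    S-step (suc n) b b≤n = minus (⋆J-cong-on b (λ b₁ b₁<b → S-step n b₁ (s≤s⁻¹ (ℕ.≤-trans b₁<b b≤n))))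

    antipodeᵇ : Map
    antipodeᵇ b = S⟨ degree B b ⟩ b

    S-stable : ∀ n b → degree B b ≤ n → antipodeᵇ b ≈ᴹ S⟨ n ⟩ b
    S-stable n b b≤n = go (ℕ.≤⇒≤′ b≤n)
      where
      go : ∀ {n} → degree B b ℕ.≤′ n → antipodeᵇ b ≈ᴹ S⟨ n ⟩ b
      go (ℕ.≤′-reflexive refl) = A.refl
      go (ℕ.≤′-step b≤n)       = A.trans (go b≤n) (A.sym (S-step _ b (ℕ.≤′⇒≤ b≤n)))

    -- Partial sums are polynomials in `J`, hence commute with it. This makes the left inverse a
    -- right inverse too.
    J⋆S : ∀ n → J ⋆ S⟨ n ⟩ ≗ S⟨ n ⟩ ⋆ J
    J⋆S zero    b = A.trans (⋆-identityʳ J b) (A.sym (⋆-identityˡ J b))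
    J⋆S (suc n) b = begin
      (J ⋆ (u ⊖ S⟨ n ⟩ ⋆ J)) b            ≈⟨ ⋆-⊖ʳ J u (S⟨ n ⟩ ⋆ J) b ⟩
      (J ⋆ u ⊖ J ⋆ (S⟨ n ⟩ ⋆ J)) b
        ≈⟨ A.+-cong (J⋆S zero b) (A.-‿cong (A.trans (A.sym (⋆-assoc J S⟨ n ⟩ J b))
                                                (⋆-cong (J⋆S n) (λ _ → A.refl) b))) ⟩
      (u ⋆ J ⊖ (S⟨ n ⟩ ⋆ J) ⋆ J) b        ≈⟨ ⋆-⊖ˡ u (S⟨ n ⟩ ⋆ J) J b ⟨
      ((u ⊖ S⟨ n ⟩ ⋆ J) ⋆ J) b            ∎

    antipodeᵇ-unfold : ∀ b → antipodeᵇ b ≈ᴹ u b +ᴹ -ᴹ (S⟨ degree B b ⟩ ⋆ J) b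
    antipodeᵇ-unfold b = S-stable (suc (degree B b)) b (ℕ.n≤1+n _)

    antipodeᵇ⋆J : ∀ b → (antipodeᵇ ⋆ J) b ≈ᴹ (S⟨ degree B b ⟩ ⋆ J) b
    antipodeᵇ⋆J b = ⋆J-cong-on b (λ b₁ b₁<b → S-stable (degree B b) b₁ (ℕ.<⇒≤ b₁<b))

    J⋆antipodeᵇ : ∀ b → (J ⋆ antipodeᵇ) b ≈ᴹ (S⟨ degree B b ⟩ ⋆ J) b
    J⋆antipodeᵇ b = A.trans (⋆-cong-on b (λ b₁ b₂ e → A.*-congˡ (S-stable (degree B b) b₂
      (ℕ.≤-trans (ℕ.m≤n+m (degree B b₂) (degree B b₁)) (ℕ.≤-reflexive e))))) (J⋆S (degree B b) b)

    -- Writing the identity as `J` plus `u`, the convolution is `antipodeᵇ ⋆ J` plus `antipodeᵇ`,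
    -- and unfolding the latter as `u` minus the former leaves `u`.
    antipodeᵇ-inverseˡ : antipodeᵇ ⋆ ⟨_⟩ ≗ u
    antipodeᵇ-inverseˡ b = begin
      (antipodeᵇ ⋆ ⟨_⟩) b                                            ≈⟨ recombine _ ((antipodeᵇ ⋆ u) b) ⟨
      (antipodeᵇ ⋆ ⟨_⟩ ⊖ antipodeᵇ ⋆ u) b +ᴹ (antipodeᵇ ⋆ u) b        ≈⟨ A.+-congʳ (⋆-⊖ʳ antipodeᵇ ⟨_⟩ u b) ⟨
      (antipodeᵇ ⋆ J) b +ᴹ (antipodeᵇ ⋆ u) b
        ≈⟨ A.+-cong (antipodeᵇ⋆J b) (A.trans (⋆-identityʳ antipodeᵇ b) (antipodeᵇ-unfold b)) ⟩
      (S⟨ degree B b ⟩ ⋆ J) b +ᴹ (u b +ᴹ -ᴹ (S⟨ degree B b ⟩ ⋆ J) b)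
        ≈⟨ A.+-comm ((S⟨ degree B b ⟩ ⋆ J) b) (u b +ᴹ -ᴹ (S⟨ degree B b ⟩ ⋆ J) b) ⟩
      u b +ᴹ -ᴹ (S⟨ degree B b ⟩ ⋆ J) b +ᴹ (S⟨ degree B b ⟩ ⋆ J) b    ≈⟨ recombine (u b) _ ⟩
      u b ∎

    antipodeᵇ-inverseʳ : ⟨_⟩ ⋆ antipodeᵇ ≗ u
    antipodeᵇ-inverseʳ b = begin
      (⟨_⟩ ⋆ antipodeᵇ) b                                            ≈⟨ recombine _ ((u ⋆ antipodeᵇ) b) ⟨
      (⟨_⟩ ⋆ antipodeᵇ ⊖ u ⋆ antipodeᵇ) b +ᴹ (u ⋆ antipodeᵇ) b        ≈⟨ A.+-congʳ (⋆-⊖ˡ ⟨_⟩ u antipodeᵇ b) ⟨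
      (J ⋆ antipodeᵇ) b +ᴹ (u ⋆ antipodeᵇ) b
        ≈⟨ A.+-cong (J⋆antipodeᵇ b) (A.trans (⋆-identityˡ antipodeᵇ b) (antipodeᵇ-unfold b)) ⟩
      (S⟨ degree B b ⟩ ⋆ J) b +ᴹ (u b +ᴹ -ᴹ (S⟨ degree B b ⟩ ⋆ J) b)
        ≈⟨ A.+-comm ((S⟨ degree B b ⟩ ⋆ J) b) (u b +ᴹ -ᴹ (S⟨ degree B b ⟩ ⋆ J) b) ⟩
      u b +ᴹ -ᴹ (S⟨ degree B b ⟩ ⋆ J) b +ᴹ (S⟨ degree B b ⟩ ⋆ J) b    ≈⟨ recombine (u b) _ ⟩
      u b ∎

    antipode : Free B → Free B
    antipode = extend {B} {B} antipodeᵇ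

    private
      multiply : Free B² → Free B
      multiply = extend {B²} {B} (λ (b , b′) → ⟨ b ⟩ ∙ ⟨ b′ ⟩)

      multiply-⊗ : ∀ x y → multiply (x ⊗ y) ≈ᴹ x ∙ y
      multiply-⊗ x y = begin
        multiply (x ⊗ y)
          ≈⟨ extend-⊗ {B} {B} {B} (λ (b , b′) → ⟨ b ⟩ ∙ ⟨ b′ ⟩) x y ⟩
        extend {B} {B} (λ b → extend {B} {B} (λ b′ → ⟨ b ⟩ ∙ ⟨ b′ ⟩) y) x
          ≈⟨ extend-congˡ {B} {B} _ _ x (λ b → linear-extend {B} {B} (⟨ b ⟩ ∙_) (∙-linearʳ ⟨ b ⟩) y) ⟨
        extend {B} {B} (λ b → ⟨ b ⟩ ∙ y) x
          ≈⟨ linear-extend {B} {B} (_∙ y) (∙-linearˡ y) x ⟨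
        x ∙ y ∎

      u-extend : ∀ x → extend {B} {B} u x ≈ᴹ ε x *ₗ 𝟙
      u-extend x = A.sym (linear-extend {B} {B} (λ x → ε x *ₗ 𝟙) (linear (free B) (free B) (λ x → ε x *ₗ 𝟙)
        (λ x≈y → M.*ₗ-congʳ (ε.⟦⟧-cong x≈y))
        (λ x y → A.trans (M.*ₗ-congʳ (ε.+ᴹ-homo x y)) (M.*ₗ-distribʳ 𝟙 (ε x) (ε y)))
        (λ s x → A.trans (M.*ₗ-congʳ (ε.*ₗ-homo s x)) (M.*ₗ-assoc s (ε x) 𝟙))) x)
        where module ε = IsModuleHomomorphism ε-linear

      -- Carries an identity of maps on the basis over to all elements, by linearity of `Δ` and `ε`.
      convolve : ∀ {F G : Free B → Free B} {f g : Map} → (∀ b → F ⟨ b ⟩ ≈ᴹ f b) → (∀ b → G ⟨ b ⟩ ≈ᴹ g b) →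
                 f ⋆ g ≗ u → ∀ x → multiply ((F ⊗ᶠ G) (Δ x)) ≈ᴹ ε x *ₗ 𝟙
      convolve {F} {G} {f} {g} F≈ G≈ f⋆g x = begin
        multiply ((F ⊗ᶠ G) (Δ x))
          ≈⟨ extend-extend {B²} {B²} {B} (λ (b , b′) → ⟨ b ⟩ ∙ ⟨ b′ ⟩) (λ (b , b′) → F ⟨ b ⟩ ⊗ G ⟨ b′ ⟩) (Δ x) ⟩
        extend {B²} {B} (λ (b , b′) → multiply (F ⟨ b ⟩ ⊗ G ⟨ b′ ⟩)) (Δ x)
          ≈⟨ extend-congˡ {B²} {B} _ _ (Δ x) (λ (b , b′) → A.trans (multiply-⊗ (F ⟨ b ⟩) (G ⟨ b′ ⟩))
            (A.*-cong (F≈ b) (G≈ b′))) ⟩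
        extend {B²} {B} (f ∙² g) (Δ x)
          ≈⟨ extend-cong {B²} {B} (f ∙² g) (linear-extend {B} {B²} Δ Δ-linear x) ⟩
        extend {B²} {B} (f ∙² g) (extend {B} {B²} (λ b → Δ ⟨ b ⟩) x)
          ≈⟨ extend-extend {B} {B²} {B} (f ∙² g) (λ b → Δ ⟨ b ⟩) x ⟩
        extend {B} {B} (f ⋆ g) x
          ≈⟨ extend-congˡ {B} {B} _ _ x f⋆g ⟩
        extend {B} {B} u x
          ≈⟨ u-extend x ⟩
        ε x *ₗ 𝟙 ∎

    isHopfAlgebra : IsHopfAlgebra B _∙_ 𝟙 Δ ε
    isHopfAlgebra = record
      { isBialgebra = isBialgebra
      ; antipode    = antipode
      ; isAntipode  = record
        { S-linear = extend-linear {B} {B} antipodeᵇ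
        ; inverseˡ = convolve {antipode} {id} (extend-⟨⟩ {B} {B} antipodeᵇ) (λ b → A.refl) antipodeᵇ-inverseˡ
        ; inverseʳ = convolve {id} {antipode} (λ b → A.refl) (extend-⟨⟩ {B} {B} antipodeᵇ) antipodeᵇ-inverseʳ
        }
      }

theorem7p1 : ∀ {c r} (R : CommutativeRing c r) (ℓ : ℕ) → let open PQSym R ℓ in
    Σ[ park⊕ ∈ (List (Letters (𝔸 ⊕ 𝔸)) → List ℕ) ] (∀ w → IsParkization (𝔸 ⊕ 𝔸) w (park⊕ w)) ×
    (Σ[ Δ ∈ (PQSym → PQSym⊗PQSym) ]
    IsOrderedSumCoproduct park⊕ Δ
    × (∀ Δ′ → IsOrderedSumCoproduct park⊕ Δ′ → ∀ f → Δ′ f ≈ᴹ Δ f)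
    × IsGradedConnectedBialgebra coloredPFBasis _·_ 1PQSym Δ counit
    × IsHopfAlgebra coloredPFBasis _·_ 1PQSym Δ counit
    × (∀ a → Δ (G a) ≈ᴹ ∑⟨ unshuffles a ⟩))
theorem7p1 R ℓ = park⊕ , park⊕-isParkization , Δ
  , Δ-isOrderedSumCoproduct
  , orderedSumCoproduct-unique
  , isGradedConnectedBialgebra
  , isHopfAlgebra
  , Δ-G
  where
  open Coefficients R ℓ using (Δ)
  open BialgebraStructure R ℓ using (isGradedConnectedBialgebra)
  open Realization R ℓ using (Δ-isOrderedSumCoproduct; orderedSumCoproduct-unique; Δ-G)
  open PQSym R ℓ using (coloredPFBasis; _·_; 1PQSym; counit)
  open ConnectedAntipode R using (module Antipode)
  open Antipode coloredPFBasis _·_ 1PQSym Δ counit isGradedConnectedBialgebra using (isHopfAlgebra)
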